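{- Let $C\subset\mathbb{P}^4$ be the curve over $\mathbb{Q}$ defined by $$2x_0^2-3x_1^2+x_2^2=0,\qquad 5x_0^2-6x_1^2+x_3^2=0,\qquad 9x_0^2-10x_1^2+x_4^2=0.$$ Then $$C(\mathbb{Q})=\{[\pm1:\pm1:\pm1:\pm1:\pm1],\ [\pm1:\pm3:\pm5:\pm7:\pm9]\}.$$
   Context: All sign combinations are allowed in the listed points. -}

module Defs where

open import Data.Bool using (Bool; true; false)
open import Data.Fin using (Fin; zero; suc)
open import Data.Rational using (ℚ; 0ℚ; 1ℚ; _+_; _-_; _*_; -_)
open import Data.Product using (Σ; _×_; ∃)
open import Data.Sum using (_⊎_)
open import Relation.Binary.PropositionalEquality using (_≡_)
open import Relation.Nullary using (¬_)

Coords : Set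
Coords = Fin 5 → ℚ

-- A representative of a point of ℙ⁴(ℚ): not all coordinates vanish.
NonZeroCoords : Coords → Set
NonZeroCoords x = ¬ (∀ i → x i ≡ 0ℚ)

_∼ₚ_ : Coords → Coords → Set
x ∼ₚ y = Σ ℚ λ c → ¬ (c ≡ 0ℚ) × (∀ i → x i ≡ c * y i)

OnC : Coords → Set
OnC x =
  ((2ℚ' * (x₀ * x₀) - 3ℚ' * (x₁ * x₁)) + x (suc (suc zero)) * x (suc (suc zero)) ≡ 0ℚ)
  × ((5ℚ' * (x₀ * x₀) - 6ℚ' * (x₁ * x₁)) + x₃ * x₃ ≡ 0ℚ)
  × ((9ℚ' * (x₀ * x₀) - 10ℚ' * (x₁ * x₁)) + x₄ * x₄ ≡ 0ℚ)
  where
  open import Data.Integer using (+_)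
  open import Data.Rational using (_/_)
  2ℚ' 3ℚ' 5ℚ' 6ℚ' 9ℚ' 10ℚ' : ℚ
  2ℚ' = + 2 / 1
  3ℚ' = + 3 / 1
  5ℚ' = + 5 / 1
  6ℚ' = + 6 / 1
  9ℚ' = + 9 / 1
  10ℚ' = + 10 / 1
  x₀ = x zero
  x₁ = x (suc zero)
  x₃ = x (suc (suc (suc zero)))
  x₄ = x (suc (suc (suc (suc zero))))

sgn : Bool → ℚ
sgn true = 1ℚ
sgn false = - 1ℚ

ones : Coords
ones _ = 1ℚ

odds : Coords
odds i = + (1 Data.Nat.+ 2 Data.Nat.* toℕ i) / 1
  where
  open import Data.Integer using (+_)
  open import Data.Rational using (_/_)
  import Data.Nat
  open import Data.Fin using (toℕ)

signed : (Fin 5 → Bool) → Coords → Coords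
signed s y i = sgn (s i) * y i

Listed : Coords → Set
Listed x = ∃ λ (s : Fin 5 → Bool) → (x ∼ₚ signed s ones) ⊎ (x ∼ₚ signed s odds)

{-# OPTIONS --safe #-}
-- Write (c , a , b) = (x₀ , x₁ , x₃) and π = 1 + i. Factoring 5 x₄² = (3 b - 2 a) (3 b + 2 a) over ℤ and
-- writing b + c i = π z² over ℤ[i] sends a rational point of C to a point (e , z , W) with e rational on
--   H : W² = 6 k² e⁴ - 9 π k e² z² + 5 i z⁴,   k = 1 or 3.
-- The Jacobian of H has rank one over ℚ(i), and the proof is an elliptic curve Chabauty argument at π.
-- The difference of such a point and the known one gives a solution of
--   n² = M⁴ - 9 k π M² E² + 15 k² π² E⁴   with M and E coprime in ℤ[i],
-- and the rationality of e makes the π-adic valuation of E odd and at least 3. A descent by 2-isogenies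
-- turns such a solution into one where the valuation is smaller by 2, and excludes valuation 3.
module Submission where

open import Defs
open import Algebra.Structures using (IsCommutativeRing)
open import Data.Bool using (Bool; true; false)
open import Data.Empty using (⊥; ⊥-elim)
open import Data.Fin.Base as Fin using (Fin; toℕ; fromℕ<)
open import Data.Fin.Patterns using (0F; 1F; 2F; 3F; 4F)
import Data.Fin.Properties as Finₚ
open import Data.Integer.Base as ℤ using (ℤ; +_; -[1+_])
open import Data.Integer.DivMod using (_%ℕ_; _/ℕ_; n%ℕd<d; a≡a%ℕn+[a/ℕn]*n)
import Data.Integer.Properties as ℤₚ
open import Data.Integer.Tactic.RingSolver using () renaming (ring to ℤ-ring)
open import Data.List.Base using (List; []; _∷_; map; _++_)
open import Data.List.Membership.Propositional using (_∈_)
open import Data.List.Membership.Propositional.Properties using (∈-map⁺; ∈-++⁺ˡ; ∈-++⁺ʳ)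
open import Data.List.Relation.Unary.All as All using (All; []; _∷_)
open import Data.List.Relation.Unary.Any using (here; there)
open import Data.Maybe using (Maybe; just; nothing)
open import Data.Nat.Base as ℕ using (ℕ; zero; suc; z≤n; s≤s)
import Data.Nat.Divisibility as ℕ
import Data.Nat.DivMod as ℕ
import Data.Nat.GCD as ℕ
open import Data.Nat.Induction using (<-wellFounded)
import Data.Nat.Primality as ℕ
import Data.Nat.Properties as ℕₚ
import Data.Nat.Tactic.RingSolver as ℕ-Tactic
open import Data.Product using (_,_; _×_; ∃; ∃₂; proj₁; proj₂; map₁; map₂)
open import Data.Rational.Base as ℚ using (ℚ; mkℚ; 0ℚ; 1ℚ; ↥_; ↧_)
open import Data.Rational.Literals using (fromℤ)
import Data.Rational.Properties as ℚₚ
import Data.Rational.Unnormalised.Base as ℚᵘ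
import Data.Rational.Unnormalised.Properties as ℚᵘₚ
open import Data.Sum using (_⊎_; inj₁; inj₂; [_,_]′)
open import Function.Base using (_∘_)
open import Induction.WellFounded using (Acc; acc)
open import Relation.Binary.PropositionalEquality
open import Relation.Nullary using (¬_; Dec; yes; no; contradiction)
open import Relation.Nullary.Decidable using (from-yes; from-no; ¬?; _×-dec_; _⊎-dec_)
open import Tactic.RingSolver.Core.AlmostCommutativeRing using (AlmostCommutativeRing; fromCommutativeRing)
open import Tactic.RingSolver.Core.Expression using (Expr) renaming (Κ to con; _⊕_ to _:+_; _⊗_ to _:*_; ⊝_ to :-_)
import Tactic.RingSolver.NonReflective as Solver
open Solver ℤ-ring using () renaming (solve to ℤ-solve)

-- With rank one the curve `H` has infinitely many points over ℚ(i), so rationality of `e` has to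
-- enter. The quartic in `M` and `E` describes points with abscissa x = (M/E)² on y² = x (x² - 9kπ x
-- + 15k²π²), and E/M agrees to first order with the local parameter x/y at the origin. Up to a
-- twist, this curve and its 2-isogenous partner are y² = x (x² + 9x + 15) and y² = x (x² - 18x +
-- 21), since 9² - 4·15 = 21 and 18² - 4·21 = 16·15; this is the origin of the constants below. The
-- two isogenies compose to multiplication by 2, which near the origin raises the valuation of the
-- parameter by v(2) = 2. A descent step is thus a halving, and it preserves the parity of the
-- valuation. That parity comes from π (z₀² e² - z²) = -8 (β + i γ), where β is a rational integer,
-- so of even π-adic valuation, and γ is more divisible by 2 than β. The local conditions at π all
-- rest on one fact: odd squares are ±1 modulo 4π.

infix 4 _:=_
_:=_ : ∀ {A : Set} {n} → Expr A n → Expr A n → Expr A n × Expr A n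
_:=_ = _,_

infixl 6 _:-_
_:-_ : ∀ {A : Set} {n} → Expr A n → Expr A n → Expr A n
x :- y = x :+ :- y

_:² : ∀ {A : Set} {n} → Expr A n → Expr A n
x :² = x :* x

ℤ# : ∀ {n} → ℕ → Expr ℤ n
ℤ# k = con (+ k)

-- Gaussian integers

infix 7.5 _+i_
data ℤ[i] : Set where
  _+i_ : ℤ → ℤ → ℤ[i]

infixl 6 _+_ _-_
infixl 7 _*_
infix 8 -_

_+_ _*_ : ℤ[i] → ℤ[i] → ℤ[i]
(a +i b) + (c +i d) = (a ℤ.+ c) +i (b ℤ.+ d)
(a +i b) * (c +i d) = (a ℤ.* c ℤ.- b ℤ.* d) +i (a ℤ.* d ℤ.+ b ℤ.* c)

-_ : ℤ[i] → ℤ[i]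
-_ (a +i b) = (ℤ.- a) +i (ℤ.- b)

_-_ : ℤ[i] → ℤ[i] → ℤ[i]
x - y = x + - y

0# 1# : ℤ[i]
0# = + 0 +i + 0
1# = + 1 +i + 0

+-assoc : ∀ x y z → (x + y) + z ≡ x + (y + z)
+-assoc (a +i b) (c +i d) (e +i f) = cong₂ _+i_ (ℤₚ.+-assoc a c e) (ℤₚ.+-assoc b d f)

+-comm : ∀ x y → x + y ≡ y + x
+-comm (a +i b) (c +i d) = cong₂ _+i_ (ℤₚ.+-comm a c) (ℤₚ.+-comm b d)

+-identityˡ : ∀ x → 0# + x ≡ x
+-identityˡ (a +i b) = cong₂ _+i_ (ℤₚ.+-identityˡ a) (ℤₚ.+-identityˡ b)

-‿inverseˡ : ∀ x → - x + x ≡ 0#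
-‿inverseˡ (a +i b) = cong₂ _+i_ (ℤₚ.+-inverseˡ a) (ℤₚ.+-inverseˡ b)

*-assoc : ∀ x y z → (x * y) * z ≡ x * (y * z)
*-assoc (a +i b) (c +i d) (e +i f) = cong₂ _+i_ (re a b c d e f) (im a b c d e f)
  where
  re = ℤ-solve 6 (λ a b c d e f → (a :* c :- b :* d) :* e :- (a :* d :+ b :* c) :* f
    := a :* (c :* e :- d :* f) :- b :* (c :* f :+ d :* e)) refl
  im = ℤ-solve 6 (λ a b c d e f → (a :* c :- b :* d) :* f :+ (a :* d :+ b :* c) :* e
    := a :* (c :* f :+ d :* e) :+ b :* (c :* e :- d :* f)) refl

*-comm : ∀ x y → x * y ≡ y * x
*-comm (a +i b) (c +i d) = cong₂ _+i_ (re a b c d) (im a b c d)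
  where
  re = ℤ-solve 4 (λ a b c d → a :* c :- b :* d := c :* a :- d :* b) refl
  im = ℤ-solve 4 (λ a b c d → a :* d :+ b :* c := c :* b :+ d :* a) refl

*-identityˡ : ∀ x → 1# * x ≡ x
*-identityˡ (a +i b) = cong₂ _+i_ (re a b) (im a b)
  where
  re = ℤ-solve 2 (λ a b → ℤ# 1 :* a :- ℤ# 0 :* b := a) refl
  im = ℤ-solve 2 (λ a b → ℤ# 1 :* b :+ ℤ# 0 :* a := b) refl

*-distribˡ-+ : ∀ x y z → x * (y + z) ≡ x * y + x * z
*-distribˡ-+ (a +i b) (c +i d) (e +i f) = cong₂ _+i_ (re a b c d e f) (im a b c d e f)
  where
  re = ℤ-solve 6 (λ a b c d e f → a :* (c :+ e) :- b :* (d :+ f) := a :* c :- b :* d :+ (a :* e :- b :* f)) refl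
  im = ℤ-solve 6 (λ a b c d e f → a :* (d :+ f) :+ b :* (c :+ e) := a :* d :+ b :* c :+ (a :* f :+ b :* e)) refl

isCommutativeRing : IsCommutativeRing _≡_ _+_ _*_ (λ x → - x) 0# 1#
isCommutativeRing = record
  { isRing = record
    { +-isAbelianGroup = record
      { isGroup = record
        { isMonoid = record
          { isSemigroup = record
            { isMagma = record { isEquivalence = isEquivalence ; ∙-cong = cong₂ _+_ }
            ; assoc = +-assoc }
          ; identity = +-identityˡ , λ x → trans (+-comm x 0#) (+-identityˡ x) }
        ; inverse = -‿inverseˡ , λ x → trans (+-comm x (- x)) (-‿inverseˡ x)
        ; ⁻¹-cong = cong (λ x → - x) }
      ; comm = +-comm }
    ; *-cong = cong₂ _*_
    ; *-assoc = *-assoc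
    ; *-identity = *-identityˡ , λ x → trans (*-comm x 1#) (*-identityˡ x)
    ; distrib = *-distribˡ-+ , λ x y z → trans (*-comm (y + z) x)
          (trans (*-distribˡ-+ x y z) (cong₂ _+_ (*-comm x y) (*-comm x z)))
    }
  ; *-comm = *-comm }

-- The zero test lets the solver discard vanishing coefficients; without it identities with
-- cancellation would have different normal forms.
ring : AlmostCommutativeRing _ _
ring = fromCommutativeRing (record { isCommutativeRing = isCommutativeRing }) λ
  { (+ 0 +i + 0) → just refl ; _ → nothing }

# : ℕ → ℤ[i]
# n = + n +i + 0

π I : ℤ[i]
π = + 1 +i + 1
I = + 0 +i + 1

_² : ℤ[i] → ℤ[i]
x ² = x * x

open Solver ring using (solve)

:# : ∀ {n} → ℕ → Expr ℤ[i] n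
:# k = con (# k)

:π :I : ∀ {n} → Expr ℤ[i] n
:π = con π
:I = con I

zeroʳ : ∀ x → x * 0# ≡ 0#
zeroʳ = solve 1 (λ x → x :* :# 0 := :# 0) refl

private
  cancel-diff : ∀ x y → x - y ≡ 0# → x ≡ y
  cancel-diff x y h = trans (eq x y) (trans (cong (_+ y) h) (+-identityˡ y))
    where
    eq = solve 2 (λ x y → x := x :- y :+ y) refl

  diff : ∀ {x y} → x ≡ y → x - y ≡ 0#
  diff {x} refl = eq x
    where
    eq = solve 1 (λ x → x :- x := :# 0) refl

-- Equations are derived as linear combinations of hypotheses; the last argument is left to the ring solver.
lin₁ : ∀ {x y l r} c → l ≡ r → x - y ≡ c * (l - r) → x ≡ y
lin₁ {x} {y} c h e = cancel-diff x y (trans e (trans (cong (c *_) (diff h)) (zeroʳ c)))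

lin₂ : ∀ {x y l r l′ r′} c d → l ≡ r → l′ ≡ r′ → x - y ≡ c * (l - r) + d * (l′ - r′) → x ≡ y
lin₂ {x} {y} c d h h′ e = cancel-diff x y
  (trans e (cong₂ _+_ (trans (cong (c *_) (diff h)) (zeroʳ c)) (trans (cong (d *_) (diff h′)) (zeroʳ d))))

lin₃ : ∀ {x y l r l′ r′ l″ r″} c d f → l ≡ r → l′ ≡ r′ → l″ ≡ r″ →
       x - y ≡ c * (l - r) + d * (l′ - r′) + f * (l″ - r″) → x ≡ y
lin₃ {x} {y} c d f h h′ h″ e = cancel-diff x y
  (trans e (cong₂ _+_ (cong₂ _+_ (trans (cong (c *_) (diff h)) (zeroʳ c)) (trans (cong (d *_) (diff h′)) (zeroʳ d)))
    (trans (cong (f *_) (diff h″)) (zeroʳ f))))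

lin₄ : ∀ {x y l r l′ r′ l″ r″ l‴ r‴} a b c d → l ≡ r → l′ ≡ r′ → l″ ≡ r″ → l‴ ≡ r‴ →
     x - y ≡ a * (l - r) + b * (l′ - r′) + c * (l″ - r″) + d * (l‴ - r‴) → x ≡ y
lin₄ {l‴ = l‴} a b c d p q r refl e′ = lin₃ a b c p q r (trans e′ (eq₄ _ d l‴))
  where
  eq₄ = solve 3 (λ s d l → s :+ d :* (l :- l) := s) refl

-- Norm and Euclidean division

N : ℤ[i] → ℕ
N (a +i b) = ℤ.∣ a ∣ ℕ.* ℤ.∣ a ∣ ℕ.+ ℤ.∣ b ∣ ℕ.* ℤ.∣ b ∣

+∣i∣² : ∀ i → + (ℤ.∣ i ∣ ℕ.* ℤ.∣ i ∣) ≡ i ℤ.* i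
+∣i∣² (+ n)    = ℤₚ.pos-* n n
+∣i∣² -[1+ n ] = refl

+N : ∀ a b → + N (a +i b) ≡ a ℤ.* a ℤ.+ b ℤ.* b
+N a b = trans (ℤₚ.pos-+ (ℤ.∣ a ∣ ℕ.* ℤ.∣ a ∣) (ℤ.∣ b ∣ ℕ.* ℤ.∣ b ∣)) (cong₂ ℤ._+_ (+∣i∣² a) (+∣i∣² b))

N-* : ∀ x y → N (x * y) ≡ N x ℕ.* N y
N-* (a +i b) (c +i d) = ℤₚ.+-injective (begin
  + N ((a +i b) * (c +i d))                               ≡⟨ +N (a ℤ.* c ℤ.- b ℤ.* d) (a ℤ.* d ℤ.+ b ℤ.* c) ⟩
  _                                                       ≡⟨ eq a b c d ⟩
  (a ℤ.* a ℤ.+ b ℤ.* b) ℤ.* (c ℤ.* c ℤ.+ d ℤ.* d)         ≡⟨ cong₂ ℤ._*_ (+N a b) (+N c d) ⟨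
  + N (a +i b) ℤ.* + N (c +i d)                           ≡⟨ ℤₚ.pos-* (N (a +i b)) (N (c +i d)) ⟨
  + (N (a +i b) ℕ.* N (c +i d))                           ∎)
  where
  open ≡-Reasoning
  eq = ℤ-solve 4 (λ a b c d → (a :* c :- b :* d) :² :+ (a :* d :+ b :* c) :²
    := (a :² :+ b :²) :* (c :² :+ d :²)) refl

m*m≡0 : ∀ m → m ℕ.* m ≡ 0 → m ≡ 0
m*m≡0 m h = [ (λ e → e) , (λ e → e) ]′ (ℕₚ.m*n≡0⇒m≡0∨n≡0 m h)

N≡0 : ∀ x → N x ≡ 0 → x ≡ 0#
N≡0 (a +i b) h = cong₂ _+i_
  (ℤₚ.∣i∣≡0⇒i≡0 (m*m≡0 ℤ.∣ a ∣ (ℕₚ.m+n≡0⇒m≡0 (ℤ.∣ a ∣ ℕ.* ℤ.∣ a ∣) h)))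
  (ℤₚ.∣i∣≡0⇒i≡0 (m*m≡0 ℤ.∣ b ∣ (ℕₚ.m+n≡0⇒n≡0 (ℤ.∣ a ∣ ℕ.* ℤ.∣ a ∣) h)))

0≡? : ∀ x → x ≡ 0# ⊎ ¬ x ≡ 0#
0≡? x with N x ℕₚ.≟ 0
... | yes h = inj₁ (N≡0 x h)
... | no  h = inj₂ λ { refl → h refl }

x*y≡0 : ∀ x y → x * y ≡ 0# → x ≡ 0# ⊎ y ≡ 0#
x*y≡0 x y h with ℕₚ.m*n≡0⇒m≡0∨n≡0 (N x) (trans (sym (N-* x y)) (cong N h))
... | inj₁ e = inj₁ (N≡0 x e)
... | inj₂ e = inj₂ (N≡0 y e)

*-cancelˡ : ∀ c {x y} → ¬ c ≡ 0# → c * x ≡ c * y → x ≡ y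
*-cancelˡ c {x} {y} c≢0 h = [ (λ e → contradiction e c≢0) , cancel-diff x y ]′
    (x*y≡0 c (x - y) (lin₁ 1# h (eq c x y)))
  where
  eq = solve 3 (λ c x y → c :* (x :- y) :- :# 0 := :# 1 :* (c :* x :- c :* y)) refl

conj : ℤ[i] → ℤ[i]
conj (a +i b) = a +i (ℤ.- b)

-- Rounding to the nearest multiple: the bound 2 |r| ≤ n in both coordinates gives 4 N(r₁ + i r₂) ≤
-- 2 n², which is what makes the norm Euclidean.
round : ∀ n .{{_ : ℕ.NonZero n}} p → ∃₂ λ q r → p ≡ + n ℤ.* q ℤ.+ r × ℤ.∣ r ∣ ℕ.+ ℤ.∣ r ∣ ℕ.≤ n
round n p = go (p %ℕ n) (p /ℕ n) (n%ℕd<d p n) (a≡a%ℕn+[a/ℕn]*n p n)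
  where
  go : ∀ m q → m ℕ.< n → p ≡ + m ℤ.+ q ℤ.* + n → ∃₂ λ q r → p ≡ + n ℤ.* q ℤ.+ r × ℤ.∣ r ∣ ℕ.+ ℤ.∣ r ∣ ℕ.≤ n
  go m q m<n e with ℕₚ.≤-total (m ℕ.+ m) n
  ... | inj₁ m+m≤n = q , + m , trans e (eq (+ m) q (+ n)) , m+m≤n
    where
    eq = ℤ-solve 3 (λ m q n → m :+ q :* n := n :* q :+ m) refl
  ... | inj₂ n≤m+m = q ℤ.+ + 1 , ℤ.- + l , trans e (trans (eq (+ m) q (+ n) (+ l) m≡n-l) refl)
                   , subst (λ t → t ℕ.+ t ℕ.≤ n) (sym (ℤₚ.∣-i∣≡∣i∣ (+ l))) l+l≤n
    where
    l = n ℕ.∸ m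
    m+l≡n : m ℕ.+ l ≡ n
    m+l≡n = ℕₚ.m+[n∸m]≡n (ℕₚ.<⇒≤ m<n)
    l+l≤n : l ℕ.+ l ℕ.≤ n
    l+l≤n = subst (l ℕ.+ l ℕ.≤_) m+l≡n (ℕₚ.+-monoˡ-≤ l
      (ℕₚ.+-cancelˡ-≤ m l m (subst (ℕ._≤ m ℕ.+ m) (sym m+l≡n) n≤m+m)))
    m≡n-l : + m ℤ.+ + l ≡ + n
    m≡n-l = trans (sym (ℤₚ.pos-+ m l)) (cong +_ m+l≡n)
    eq : ∀ m q n l → m ℤ.+ l ≡ n → m ℤ.+ q ℤ.* n ≡ n ℤ.* (q ℤ.+ + 1) ℤ.+ (ℤ.- l)
    eq m q _ l refl = eq′ m q l
      where
      eq′ = ℤ-solve 3 (λ m q l → m :+ q :* (m :+ l) := (m :+ l) :* (q :+ ℤ# 1) :+ :- l) refl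

*-conj : ∀ x → x * conj x ≡ (+ N x) +i + 0
*-conj (a +i b) = cong₂ _+i_ (trans (re a b) (sym (+N a b))) (im a b)
  where
  re = ℤ-solve 2 (λ a b → a :² :- b :* :- b := a :² :+ b :²) refl
  im = ℤ-solve 2 (λ a b → a :* :- b :+ b :* a := ℤ# 0) refl

N-conj : ∀ x → N (conj x) ≡ N x
N-conj (a +i b) = cong (λ t → ℤ.∣ a ∣ ℕ.* ℤ.∣ a ∣ ℕ.+ t ℕ.* t) (ℤₚ.∣-i∣≡∣i∣ b)

-- Multiplying by `conj y` replaces the divisor by the integer n = N y, so both coordinates can be
-- rounded separately. Then r · conj y = r₁ + i r₂, hence N r · n ≤ n² / 2.
divMod : ∀ x y → ¬ y ≡ 0# → ∃₂ λ q r → x ≡ q * y + r × N r ℕ.< N y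
divMod x y y≢0 = help (N y) refl (x * conj y) refl
  where
  help : ∀ n → N y ≡ n → ∀ p → x * conj y ≡ p → ∃₂ λ q r → x ≡ q * y + r × N r ℕ.< N y
  help zero    Ny≡n _ _ = contradiction (N≡0 y Ny≡n) y≢0
  help n@(suc _) Ny≡n (p₁ +i p₂) h with round n p₁ | round n p₂
  ... | q₁ , r₁ , e₁ , b₁ | q₂ , r₂ , e₂ , b₂ = q , r , x≡ x y q , ℕₚ.≰⇒> Ny≰Nr
    where
    q r : ℤ[i]
    q = q₁ +i q₂
    r = x - q * y
    x≡ = solve 3 (λ x y q → x := q :* y :+ (x :- q :* y)) refl
    y*conj : y * conj y ≡ (+ n) +i + 0
    y*conj = trans (*-conj y) (cong (λ t → (+ t) +i + 0) Ny≡n)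
    r-conj : r * conj y ≡ r₁ +i r₂
    r-conj = begin
      (x - q * y) * conj y                     ≡⟨ eq x q y (conj y) ⟩
      x * conj y - q * (y * conj y)            ≡⟨ cong₂ (λ s t → s - q * t) h y*conj ⟩
      (p₁ +i p₂) - q * ((+ n) +i + 0)          ≡⟨ cong₂ _+i_ (trans (cong (ℤ._+ _) e₁) (re (+ n) q₁ q₂ r₁))
          (trans (cong (ℤ._+ _) e₂) (im (+ n) q₁ q₂ r₂)) ⟩
      r₁ +i r₂                                 ∎
      where
      open ≡-Reasoning
      eq = solve 4 (λ x q y z → (x :- q :* y) :* z := x :* z :- q :* (y :* z)) refl
      re = ℤ-solve 4 (λ n q₁ q₂ r → n :* q₁ :+ r :+ :- (q₁ :* n :- q₂ :* ℤ# 0) := r) refl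
      im = ℤ-solve 4 (λ n q₁ q₂ r → n :* q₂ :+ r :+ :- (q₁ :* ℤ# 0 :+ q₂ :* n) := r) refl
    Nr*n : N r ℕ.* n ≡ N (r₁ +i r₂)
    Nr*n = begin
      N r ℕ.* n            ≡⟨ cong (N r ℕ.*_) (trans (sym Ny≡n) (sym (N-conj y))) ⟩
      N r ℕ.* N (conj y)   ≡⟨ N-* r (conj y) ⟨
      N (r * conj y)       ≡⟨ cong N r-conj ⟩
      N (r₁ +i r₂)         ∎
      where open ≡-Reasoning
    bound : 4 ℕ.* (N r ℕ.* n) ℕ.≤ n ℕ.* n ℕ.+ n ℕ.* n
    bound = subst (ℕ._≤ n ℕ.* n ℕ.+ n ℕ.* n) (trans (eq ℤ.∣ r₁ ∣ ℤ.∣ r₂ ∣) (cong (4 ℕ.*_) (sym Nr*n)))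
      (ℕₚ.+-mono-≤ (ℕₚ.*-mono-≤ b₁ b₁) (ℕₚ.*-mono-≤ b₂ b₂))
      where
      eq : ∀ s t → (s ℕ.+ s) ℕ.* (s ℕ.+ s) ℕ.+ (t ℕ.+ t) ℕ.* (t ℕ.+ t) ≡ 4 ℕ.* (s ℕ.* s ℕ.+ t ℕ.* t)
      eq = ℕ-Tactic.solve-∀
    Ny≰Nr : ¬ N y ℕ.≤ N r
    Ny≰Nr Ny≤Nr = ℕₚ.<⇒≱ (ℕₚ.*-monoˡ-< (n ℕ.* n) {2} {4} (s≤s (s≤s (s≤s z≤n))))
      (subst (4 ℕ.* (n ℕ.* n) ℕ.≤_) (eq (n ℕ.* n))
        (ℕₚ.≤-trans (ℕₚ.*-monoʳ-≤ 4 (ℕₚ.*-monoˡ-≤ n (subst (ℕ._≤ N r) Ny≡n Ny≤Nr))) bound))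
      where
      eq : ∀ s → s ℕ.+ s ≡ 2 ℕ.* s
      eq = ℕ-Tactic.solve-∀

-- Divisibility and coprimality

infix 4 _∣_
_∣_ : ℤ[i] → ℤ[i] → Set
x ∣ y = ∃ λ q → y ≡ q * x

-- In Bézout form the closure properties are polynomial identities, and coprimality over ℤ carries
-- over to ℤ[i] with the same coefficients.
Coprime : ℤ[i] → ℤ[i] → Set
Coprime x y = ∃₂ λ u v → u * x + v * y ≡ 1#

record GCD (x y : ℤ[i]) : Set where
  constructor mkGCD
  field
    g   : ℤ[i]
    g∣x : g ∣ x
    g∣y : g ∣ y
    u v : ℤ[i]
    bézout : u * x + v * y ≡ g

gcd : ∀ x y → GCD x y
gcd x y = go x y (<-wellFounded (N y))
  where
  go : ∀ x y → Acc ℕ._<_ (N y) → GCD x y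
  go x y (acc rec) with 0≡? y
  ... | inj₁ refl = mkGCD x (1# , sym (*-identityˡ x)) (0# , eq₀ x) 1# 0# (eq₁ x)
    where
    eq₀ = solve 1 (λ x → :# 0 := :# 0 :* x) refl
    eq₁ = solve 1 (λ x → :# 1 :* x :+ (:# 0) :² := x) refl
  ... | inj₂ y≢0 with divMod x y y≢0
  ...   | q , r , x≡ , r<y with go y r (rec r<y)
  ...     | mkGCD g (a , y≡) (b , r≡) u v uy+vr = mkGCD g
              (q * a + b , lin₃ 1# q 1# x≡ y≡ r≡ (eq₀ x y q r a b g)) (a , y≡)
              v (u - v * q) (lin₂ 1# v uy+vr x≡ (eq₁ x y q r u v g))
    where
    eq₀ = solve 7 (λ x y q r a b g → x :- (q :* a :+ b) :* g
      := :# 1 :* (x :- (q :* y :+ r)) :+ q :* (y :- a :* g) :+ :# 1 :* (r :- b :* g)) refl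
    eq₁ = solve 7 (λ x y q r u v g → v :* x :+ (u :- v :* q) :* y :- g
      := :# 1 :* (u :* y :+ v :* r :- g) :+ v :* (x :- (q :* y :+ r))) refl

∣-trans : ∀ {x y z} → x ∣ y → y ∣ z → x ∣ z
∣-trans {x} (p , refl) (q , refl) = q * p , sym (*-assoc q p x)

∣-refl : ∀ {x} → x ∣ x
∣-refl {x} = 1# , sym (*-identityˡ x)

∣-* : ∀ {x y} z → x ∣ y → x ∣ z * y
∣-* z x∣y = ∣-trans x∣y (z , refl)

∣-lin : ∀ {x y z} a b → x ∣ y → x ∣ z → x ∣ a * y + b * z
∣-lin {x} a b (p , refl) (q , refl) = a * p + b * q , eq x p q a b
  where
  eq = solve 5 (λ x p q a b → a :* (p :* x) :+ b :* (q :* x) := (a :* p :+ b :* q) :* x) refl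

cop-sym : ∀ {x y} → Coprime x y → Coprime y x
cop-sym {x} {y} (u , v , h) = v , u , trans (+-comm (v * y) (u * x)) h

cop-∣ : ∀ {x y z} → Coprime x y → z ∣ x → Coprime z y
cop-∣ {y = y} {z} (u , v , h) (q , refl) = u * q , v , trans (cong (_+ v * y) (*-assoc u q z)) h

cop-∣₂ : ∀ {x y z w} → Coprime x y → z ∣ x → w ∣ y → Coprime z w
cop-∣₂ c p q = cop-sym (cop-∣ (cop-sym (cop-∣ c p)) q)

cop-* : ∀ {x y z} → Coprime x y → Coprime x z → Coprime x (y * z)
cop-* {x} {y} {z} (u , v , h) (u′ , v′ , h′) = u + v * y * u′ , v * v′ ,
  lin₂ 1# (v * y) h h′ (eq x y z u v u′ v′)
  where
  eq = solve 7 (λ x y z u v u′ v′ → (u :+ v :* y :* u′) :* x :+ v :* v′ :* (y :* z) :- :# 1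
    := :# 1 :* (u :* x :+ v :* y :- :# 1) :+ v :* y :* (u′ :* x :+ v′ :* z :- :# 1)) refl

cop-∣* : ∀ {x y z} → Coprime x y → x ∣ y * z → x ∣ z
cop-∣* {x} {y} {z} (u , v , h) (q , e) = u * z + v * q , lin₂ (- z) v h e (eq x y z u v q)
  where
  eq = solve 6 (λ x y z u v q → z :- (u :* z :+ v :* q) :* x
    := :- z :* (u :* x :+ v :* y :- :# 1) :+ v :* (y :* z :- q :* x)) refl

cop-by-∣ : ∀ {x y} → (∀ g → g ∣ x → g ∣ y → g ∣ 1#) → Coprime x y
cop-by-∣ {x} {y} h with gcd x y
... | mkGCD g g∣x g∣y u v e with h g g∣x g∣y
...   | q , 1≡ = q * u , q * v , lin₂ q (- 1#) e 1≡ (eq x y g u v q)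
  where
  eq = solve 6 (λ x y g u v q → q :* u :* x :+ q :* v :* y :- :# 1
    := q :* (u :* x :+ v :* y :- g) :+ :- :# 1 :* (:# 1 :- q :* g)) refl

cop-gcd : ∀ {x y} → Coprime x y → ∀ g → g ∣ x → g ∣ y → g ∣ 1#
cop-gcd {x} {y} (u , v , h) g g∣x g∣y = subst (g ∣_) h (∣-lin u v g∣x g∣y)

reduce-pair : ∀ x y → ¬ x ≡ 0# → ∃ λ g → ∃₂ λ a b → ¬ g ≡ 0# × x ≡ a * g × y ≡ b * g × Coprime a b
reduce-pair x y x≢0 with gcd x y
... | mkGCD g (a , x≡) (b , y≡) u v e = g , a , b , g≢0 , x≡ , y≡ , u , v ,
      *-cancelˡ g g≢0 (lin₃ 1# (- u) (- v) e x≡ y≡ (eq x y g a b u v))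
  where
  g≢0 : ¬ g ≡ 0#
  g≢0 refl = x≢0 (trans x≡ (zeroʳ a))
  eq = solve 7 (λ x y g a b u v → g :* (u :* a :+ v :* b) :- g :* :# 1
    := :# 1 :* (u :* x :+ v :* y :- g) :+ :- u :* (x :- a :* g) :+ :- v :* (y :- b :* g)) refl

-- Both factors of a square get the same unit h: with g = gcd (a , c), a = a′ g and c = c′ g,
-- a′ divides g = h a′, so a = h a′² and b = h c′².
SquareFactors : ℤ[i] → ℤ[i] → ℤ[i] → Set
SquareFactors a b c = ∃₂ λ h h′ → ∃₂ λ r s → h * h′ ≡ 1# × a ≡ h * r ² × b ≡ h′ * s ² × r * s ≡ c

module CoprimeSquare {a b c : ℤ[i]} (a≢0 : ¬ a ≡ 0#) (a⊥b : Coprime a b) (ab≡c² : a * b ≡ c ²)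
  {g a′ c′ : ℤ[i]} (g≢0 : ¬ g ≡ 0#) (a≡ : a ≡ a′ * g) (c≡ : c ≡ c′ * g) (a′⊥c′ : Coprime a′ c′) where

  eq₁ : a′ * b ≡ c′ * (c′ * g)
  eq₁ = *-cancelˡ g g≢0 (lin₃ 1# (- b) (c + c′ * g) ab≡c² a≡ c≡ (eq a b c g a′ c′))
    where
    eq = solve 6 (λ a b c g a′ c′ → g :* (a′ :* b) :- g :* (c′ :* (c′ :* g))
      := :# 1 :* (a :* b :- c :²) :+ :- b :* (a :- a′ :* g) :+ (c :+ c′ :* g) :* (c :- c′ :* g)) refl

  a′≢0 : ¬ a′ ≡ 0#
  a′≢0 refl = a≢0 (trans a≡ (trans (*-comm 0# g) (zeroʳ g)))

  a′∣g : a′ ∣ g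
  a′∣g = cop-∣* a′⊥c′ (cop-∣* a′⊥c′ (b , trans (sym eq₁) (*-comm a′ b)))

  h : ℤ[i]
  h = proj₁ a′∣g

  g≡ : g ≡ h * a′
  g≡ = proj₂ a′∣g

  b≡ : b ≡ c′ * c′ * h
  b≡ = *-cancelˡ a′ a′≢0 (lin₂ 1# (c′ * c′) eq₁ g≡ (eq a′ b c′ g h))
    where
    eq = solve 5 (λ a b c g h → a :* b :- a :* (c :² :* h)
      := :# 1 :* (a :* b :- c :* (c :* g)) :+ c :² :* (g :- h :* a)) refl

  a≡′ : a ≡ a′ * a′ * h
  a≡′ = lin₂ 1# a′ a≡ g≡ (eq a g a′ h)
    where
    eq = solve 4 (λ a g a′ h → a :- a′ :² :* h := :# 1 :* (a :- a′ :* g) :+ a′ :* (g :- h :* a′)) refl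

  factors : h ∣ 1# → SquareFactors a b c
  factors (h′ , 1≡) = h , h′ , a′ , c′ * h , trans (*-comm h h′) (sym 1≡) , trans a≡′ (*-comm (a′ * a′) h)
    , lin₂ 1# (c′ * c′ * h) b≡ 1≡ (eq₂ b c′ h h′)
    , lin₂ (- 1#) (- c′) c≡ g≡ (eq₃ c g a′ c′ h)
    where
    eq₂ = solve 4 (λ b c h h′ → b :- h′ :* (c :* h) :²
      := :# 1 :* (b :- c :² :* h) :+ c :² :* h :* (:# 1 :- h′ :* h)) refl
    eq₃ = solve 5 (λ c g a′ c′ h → a′ :* (c′ :* h) :- c
      := :- :# 1 :* (c :- c′ :* g) :+ :- c′ :* (g :- h :* a′)) refl

  result : SquareFactors a b c
  result = factors (cop-gcd a⊥b h (a′ * a′ , a≡′) (c′ * c′ , b≡))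

coprime-square : ∀ {a b c} → ¬ a ≡ 0# → Coprime a b → a * b ≡ c ² → SquareFactors a b c
coprime-square {a} {c = c} a≢0 a⊥b ab≡c² =
  let _ , _ , _ , g≢0 , a≡ , c≡ , a′⊥c′ = reduce-pair a c a≢0
  in CoprimeSquare.result a≢0 a⊥b ab≡c² g≢0 a≡ c≡ a′⊥c′

-- Primes and residues

N-∣ : ∀ {x y} → x ∣ y → N x ℕ.∣ N y
N-∣ {x} {y} (q , e) = ℕ.divides (N q) (trans (cong N e) (N-* q x))

-- The residue field at π has two elements, so this is the complement of π ∣ x, given by a witness.
Odd : ℤ[i] → Set
Odd x = ∃ λ y → x ≡ 1# + π * y

-- Maximality of the ideal (p). Units satisfy it as well, which is why `squareFree-*` asks
-- separately that p is not a unit.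
Prime : ℤ[i] → Set
Prime p = ∀ x → p ∣ x ⊎ Coprime p x

ℤ-residue : ∀ m .{{_ : ℕ.NonZero m}} a → ∃₂ λ (r : Fin m) q → a ≡ + toℕ r ℤ.+ q ℤ.* + m
ℤ-residue m a = fromℕ< lt , a /ℕ m , trans (a≡a%ℕn+[a/ℕn]*n a m)
    (cong (λ t → + t ℤ.+ (a /ℕ m) ℤ.* + m) (sym (Finₚ.toℕ-fromℕ< lt)))
  where lt = n%ℕd<d a m

-- Since i ≡ 1 modulo π, the parity of a + b decides. If a + b = 2q then a + b i = π (q + (b - q)
-- i).
parity : ∀ x → π ∣ x ⊎ Odd x
parity (a +i b) = go (ℤ-residue 2 (a ℤ.+ b))
  where
  go : (∃₂ λ (r : Fin 2) q → a ℤ.+ b ≡ + toℕ r ℤ.+ q ℤ.* + 2) → _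
  go (Fin.zero , q , e) = inj₁ (q +i (b ℤ.- q) , cong₂ _+i_
      (trans (eq₁ a b) (trans (cong (ℤ._- b) e) (eq₂ b q))) (eq₃ b q))
    where
    eq₁ = ℤ-solve 2 (λ a b → a := a :+ b :- b) refl
    eq₂ = ℤ-solve 2 (λ b q → ℤ# 0 :+ q :* ℤ# 2 :- b := q :* ℤ# 1 :- (b :- q) :* ℤ# 1) refl
    eq₃ = ℤ-solve 2 (λ b q → b := q :* ℤ# 1 :+ (b :- q) :* ℤ# 1) refl
  go (Fin.suc Fin.zero , q , e) = inj₂ (q +i (b ℤ.- q) , cong₂ _+i_
      (trans (eq₁ a b) (trans (cong (ℤ._- b) e) (eq₂ b q))) (eq₃ b q))
    where
    eq₁ = ℤ-solve 2 (λ a b → a := a :+ b :- b) refl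
    eq₂ = ℤ-solve 2 (λ b q → ℤ# 1 :+ q :* ℤ# 2 :- b := ℤ# 1 :+ (ℤ# 1 :* q :- ℤ# 1 :* (b :- q))) refl
    eq₃ = ℤ-solve 2 (λ b q → b := ℤ# 0 :+ (ℤ# 1 :* (b :- q) :+ ℤ# 1 :* q)) refl

odd⇒cop : ∀ {x} → Odd x → Coprime π x
odd⇒cop (y , refl) = - y , 1# , eq y
  where
  eq = solve 1 (λ y → :- y :* :π :+ :# 1 :* (:# 1 :+ :π :* y) := :# 1) refl

π-prime : Prime π
π-prime x = [ inj₁ , inj₂ ∘ odd⇒cop ]′ (parity x)

¬π∣1 : ¬ π ∣ 1#
¬π∣1 d = from-no (2 ℕ.∣? 1) (N-∣ d)

¬even×odd : ∀ {x} → π ∣ x → ¬ Odd x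
¬even×odd (q , x≡) (y , x≡′) = ¬π∣1 (q - y , lin₂ (- 1#) 1# x≡′ x≡ (eq _ q y))
  where
  eq = solve 3 (λ x q y → :# 1 :- (q :- y) :* :π
    := :- :# 1 :* (x :- (:# 1 :+ :π :* y)) :+ :# 1 :* (x :- q :* :π)) refl

odd≢0 : ∀ {x} → Odd x → ¬ x ≡ 0#
odd≢0 o refl = ¬even×odd (0# , refl) o

odd-∣ : ∀ {x y} → x ∣ y → Odd y → Odd x
odd-∣ {x} x∣y o = [ (λ e → contradiction o (¬even×odd (∣-trans e x∣y))) , (λ z → z) ]′ (parity x)

odd-* : ∀ {x y} → Odd x → Odd y → Odd (x * y)
odd-* (a , refl) (b , refl) = a + b + π * a * b , eq a b
  where
  eq = solve 2 (λ a b → (:# 1 :+ :π :* a) :* (:# 1 :+ :π :* b) := :# 1 :+ :π :* (a :+ b :+ :π :* a :* b)) refl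

odd+even : ∀ {x y} → Odd x → π ∣ y → Odd (x + y)
odd+even (a , refl) (b , refl) = a + b , eq a b
  where
  eq = solve 2 (λ a b → :# 1 :+ :π :* a :+ b :* :π := :# 1 :+ :π :* (a :+ b)) refl

prime-∣* : ∀ {p} → Prime p → ∀ x y → p ∣ x * y → p ∣ x ⊎ p ∣ y
prime-∣* P x y d = [ inj₁ , (λ c → inj₂ (cop-∣* c d)) ]′ (P x)

prime-∣² : ∀ {p} → Prime p → ∀ x → p ∣ x ² → p ∣ x
prime-∣² P x d = [ (λ z → z) , (λ z → z) ]′ (prime-∣* P x x d)

-- A residue r + s i modulo m is zero or has an inverse k (r - s i).
NormInvertible : ∀ m .{{_ : ℕ.NonZero m}} → Set
NormInvertible m = (r s : Fin m) → (toℕ r ≡ 0 × toℕ s ≡ 0) ⊎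
  (∃ λ (k : Fin m) → (toℕ k ℕ.* (toℕ r ℕ.* toℕ r ℕ.+ toℕ s ℕ.* toℕ s)) ℕ.% m ≡ 1)

normInvertible? : ∀ m .{{_ : ℕ.NonZero m}} → Dec (NormInvertible m)
normInvertible? m = Finₚ.all? λ r → Finₚ.all? λ s → (_ ℕₚ.≟ _ ×-dec _ ℕₚ.≟ _) ⊎-dec Finₚ.any? λ k → _ ℕₚ.≟ _

#-+ : ∀ a b → # (a ℕ.+ b) ≡ # a + # b
#-+ a b = cong (_+i + 0) (ℤₚ.pos-+ a b)

#-* : ∀ a b → # (a ℕ.* b) ≡ # a * # b
#-* a b = cong₂ _+i_ (trans (ℤₚ.pos-* a b) (re (+ a) (+ b))) (im (+ a) (+ b))
  where
  re = ℤ-solve 2 (λ a b → a :* b := a :* b :- (ℤ# 0) :²) refl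
  im = ℤ-solve 2 (λ a b → ℤ# 0 := a :* ℤ# 0 :+ ℤ# 0 :* b) refl

#-mod : ∀ n m .{{_ : ℕ.NonZero m}} → n ℕ.% m ≡ 1 → # n ≡ 1# + # (n ℕ./ m) * # m
#-mod n m h = begin
  # n                                   ≡⟨ cong # (ℕ.m≡m%n+[m/n]*n n m) ⟩
  # (n ℕ.% m ℕ.+ (n ℕ./ m) ℕ.* m)       ≡⟨ cong (λ t → # (t ℕ.+ (n ℕ./ m) ℕ.* m)) h ⟩
  # (1 ℕ.+ (n ℕ./ m) ℕ.* m)             ≡⟨ #-+ 1 ((n ℕ./ m) ℕ.* m) ⟩
  1# + # ((n ℕ./ m) ℕ.* m)              ≡⟨ cong (λ t → 1# + t) (#-* (n ℕ./ m) m) ⟩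
  1# + # (n ℕ./ m) * # m                ∎
  where open ≡-Reasoning

inverse⇒cop : ∀ {x p ρ u n w q} → x ≡ ρ + w * p → u * ρ ≡ n → n ≡ 1# + q * p → Coprime p x
inverse⇒cop {x} {p} {ρ} {u} {n} {w} {q} e₁ e₂ e₃ =
  - (u * w) - q , u , lin₃ u 1# 1# e₁ e₂ e₃ (eq x p ρ u n w q)
  where
  eq = solve 7 (λ x p ρ u n w q → (:- (u :* w) :- q) :* p :+ u :* x :- :# 1
    := u :* (x :- (ρ :+ w :* p)) :+ :# 1 :* (u :* ρ :- n) :+ :# 1 :* (n :- (:# 1 :+ q :* p))) refl

inert-residue : ∀ m .{{_ : ℕ.NonZero m}} x → ∃₂ λ (r s : Fin m) → ∃ λ w → x ≡ (+ toℕ r) +i (+ toℕ s) + w * # m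
inert-residue m (a +i b) =
  let r , q , e = ℤ-residue m a
      s , q′ , e′ = ℤ-residue m b
  in r , s , q +i q′ , cong₂ _+i_ (trans e (re (+ toℕ r) q q′ (+ m))) (trans e′ (im (+ toℕ s) q q′ (+ m)))
  where
  re = ℤ-solve 4 (λ r q q′ m → r :+ q :* m := r :+ (q :* m :- q′ :* ℤ# 0)) refl
  im = ℤ-solve 4 (λ s q q′ m → s :+ q′ :* m := s :+ (q :* ℤ# 0 :+ q′ :* m)) refl

inert-prime : ∀ m .{{_ : ℕ.NonZero m}} → NormInvertible m → Prime (# m)
inert-prime m inv x =
  let r , s , w , x≡ = inert-residue m x
  in [ zero-residue r s w x≡ , unit-residue r s w x≡ ]′ (inv r s)
  where
  zero-residue : ∀ (r s : Fin m) w → x ≡ (+ toℕ r) +i (+ toℕ s) + w * # m → toℕ r ≡ 0 × toℕ s ≡ 0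
      → # m ∣ x ⊎ Coprime (# m) x
  zero-residue r s w x≡ (r≡0 , s≡0) = inj₁ (w , trans x≡ (trans
    (cong₂ (λ r s → (+ r) +i (+ s) + w * # m) r≡0 s≡0) (+-identityˡ (w * # m))))
  unit-residue : ∀ (r s : Fin m) w → x ≡ (+ toℕ r) +i (+ toℕ s) + w * # m
      → (∃ λ (k : Fin m) → (toℕ k ℕ.* (toℕ r ℕ.* toℕ r ℕ.+ toℕ s ℕ.* toℕ s)) ℕ.% m ≡ 1) → # m ∣ x ⊎ Coprime (# m) x
  unit-residue r s w x≡ (k , h) = inj₂ (inverse⇒cop {ρ = ρ} {u = # (toℕ k) * conj ρ} {w = w} {q = # (n ℕ./ m)} x≡
      uρ≡ (#-mod n m h))
    where
    ρ = (+ toℕ r) +i (+ toℕ s)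
    n = toℕ k ℕ.* (toℕ r ℕ.* toℕ r ℕ.+ toℕ s ℕ.* toℕ s)
    uρ≡ : # (toℕ k) * conj ρ * ρ ≡ # n
    uρ≡ = trans (eq (# (toℕ k)) (conj ρ) ρ) (trans (cong (# (toℕ k) *_) (*-conj ρ)) (sym (#-* (toℕ k) _)))
      where
      eq = solve 3 (λ k c r → k :* c :* r := k :* (r :* c)) refl

module Split (m ρ : ℕ) .{{_ : ℕ.NonZero m}} {ℓ ν μ : ℤ[i]} (m≡νℓ : # m ≡ ν * ℓ) (I≡ρ : I ≡ # ρ + μ * ℓ) where

  -- As i ≡ ρ modulo ℓ, a + b i is congruent to the integer a + ρ b, which may then be reduced
  -- modulo m, a multiple of ℓ.
  residue : ∀ x → ∃₂ λ (r : Fin m) w → x ≡ # (toℕ r) + w * ℓ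
  residue (a +i b) with ℤ-residue m (a ℤ.+ + ρ ℤ.* b)
  ... | r , q , e = r , (q +i + 0) * ν + (b +i + 0) * μ ,
    lin₃ (b +i + 0) (q +i + 0) 1# I≡ρ m≡νℓ (cong₂ _+i_ e (refl {x = + 0}))
      (trans (cong (λ t → t - (# (toℕ r) + ((q +i + 0) * ν + (b +i + 0) * μ) * ℓ)) (split a b))
          (eq (a +i + 0) (b +i + 0) (# (toℕ r)) (q +i + 0) (# m) (# ρ) μ ν ℓ I _ _ (re a (+ ρ) b)
          (re′ (+ toℕ r) q (+ m))))
    where
    split : ∀ a b → (a +i b) ≡ (a +i + 0) + I * (b +i + 0)
    split a b = cong₂ _+i_ (s₁ a b) (s₂ a b)
      where
      s₁ = ℤ-solve 2 (λ a b → a := a :+ (ℤ# 0 :* b :- ℤ# 1 :* ℤ# 0)) refl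
      s₂ = ℤ-solve 2 (λ a b → b := ℤ# 0 :+ ((ℤ# 0) :² :+ ℤ# 1 :* b)) refl
    re : ∀ a ρ b → (a ℤ.+ ρ ℤ.* b) +i + 0 ≡ (a +i + 0) + (ρ +i + 0) * (b +i + 0)
    re a ρ b = cong₂ _+i_ (s₁ a ρ b) (s₂ ρ b)
      where
      s₁ = ℤ-solve 3 (λ a ρ b → a :+ ρ :* b := a :+ (ρ :* b :- (ℤ# 0) :²)) refl
      s₂ = ℤ-solve 2 (λ ρ b → ℤ# 0 := ℤ# 0 :+ (ρ :* ℤ# 0 :+ ℤ# 0 :* b)) refl
    re′ : ∀ r q m → (r ℤ.+ q ℤ.* m) +i + 0 ≡ (r +i + 0) + (q +i + 0) * (m +i + 0)
    re′ r q m = trans (cong (λ t → (r ℤ.+ t) +i + 0) (ℤₚ.*-comm q m))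
        (trans (re r m q) (cong (λ t → (r +i + 0) + t) (*-comm (m +i + 0) (q +i + 0))))
    eq : ∀ a b r q m ρ μ ν ℓ i s t → s ≡ a + ρ * b → t ≡ r + q * m →
         a + i * b - (r + (q * ν + b * μ) * ℓ) ≡ b * (i - (ρ + μ * ℓ)) + q * (m - ν * ℓ) + 1# * (s - t)
    eq a b r q m ρ μ ν ℓ i _ _ refl refl = eq′ a b r q m ρ μ ν ℓ i
      where
      eq′ = solve 10 (λ a b r q m ρ μ ν ℓ i → a :+ i :* b :- (r :+ (q :* ν :+ b :* μ) :* ℓ)
        := b :* (i :- (ρ :+ μ :* ℓ)) :+ q :* (m :- ν :* ℓ) :+ :# 1 :* (a :+ ρ :* b :- (r :+ q :* m))) refl

  prime : ((r : Fin m) → toℕ r ≡ 0 ⊎ (∃ λ (k : Fin m) → (toℕ k ℕ.* toℕ r) ℕ.% m ≡ 1)) → Prime ℓ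
  prime inv x with residue x
  ... | r , w , x≡ = [ zero-residue , (λ (k , h) → inj₂ (unit-residue k h)) ]′ (inv r)
    where
    zero-residue : toℕ r ≡ 0 → _
    zero-residue r≡0 = inj₁ (w , trans x≡ (trans (cong (λ t → # t + w * ℓ) r≡0) (+-identityˡ (w * ℓ))))
    unit-residue : ∀ k → _ → Coprime ℓ x
    unit-residue k h = inverse⇒cop {ρ = # (toℕ r)} {u = # (toℕ k)} {w = w} {q = # (n ℕ./ m) * ν} x≡
        (sym (#-* (toℕ k) (toℕ r)))
      (trans (#-mod n m h) (cong (λ t → 1# + t) (trans (cong (# (n ℕ./ m) *_) m≡νℓ)
          (sym (*-assoc (# (n ℕ./ m)) ν ℓ)))))
      where n = toℕ k ℕ.* toℕ r

3-prime : Prime (# 3)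
3-prime = inert-prime 3 (from-yes (normInvertible? 3))

7-prime : Prime (# 7)
7-prime = inert-prime 7 (from-yes (normInvertible? 7))

λ₁ λ₂ : ℤ[i]
λ₁ = + 2 +i + 1
λ₂ = + 2 +i -[1+ 0 ]

-- i ≡ 3 modulo 2 + i and i ≡ 2 modulo 2 - i; the last implicit argument is the quotient (i - ρ) /
-- ℓ.
module Mod-λ₁ = Split 5 3 {λ₁} {λ₂} { -[1+ 0 ] +i + 1 } refl refl
module Mod-λ₂ = Split 5 2 {λ₂} {λ₁} { -[1+ 0 ] +i + 0} refl refl

invertible-5? : Dec ((r : Fin 5) → toℕ r ≡ 0 ⊎ (∃ λ (k : Fin 5) → (toℕ k ℕ.* toℕ r) ℕ.% 5 ≡ 1))
invertible-5? = Finₚ.all? λ r → _ ℕₚ.≟ _ ⊎-dec Finₚ.any? λ k → _ ℕₚ.≟ _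

λ₁-prime : Prime λ₁
λ₁-prime = Mod-λ₁.prime (from-yes invertible-5?)

λ₂-prime : Prime λ₂
λ₂-prime = Mod-λ₂.prime (from-yes invertible-5?)

-- Factoring a squarefree constant times a square

Factor : ℤ[i] → Set
Factor p = Prime p × ¬ p ≡ 0#

Pair : Set
Pair = ℤ[i] × ℤ[i]

product : List ℤ[i] → ℤ[i]
product []       = 1#
product (p ∷ ps) = p * product ps

-- Kept as a list so that the case distinctions over descent classes become pattern matches on
-- membership, with concrete Gaussian integers in each case.
splittings : List ℤ[i] → List Pair
splittings []       = (1# , 1#) ∷ []
splittings (p ∷ ps) = map (map₁ (p *_)) (splittings ps) ++ map (map₂ (p *_)) (splittings ps)

Splitting : List ℤ[i] → ℤ[i] → ℤ[i] → ℤ[i] → Set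
Splitting ps a b c = ∃₂ λ d d′ → ((d , d′) ∈ splittings ps) × ∃₂ λ a′ b′ → a ≡ d * a′ × b ≡ d′ * b′ × a′ * b′ ≡ c

∣-cancel : ∀ {p a b c} → ¬ p ≡ 0# → p ∣ a → a * b ≡ p * c → ∃ λ a′ → a ≡ p * a′ × a′ * b ≡ c
∣-cancel {p} {a} {b} {c} p≢0 (q , a≡) h = q , trans a≡ (*-comm q p) ,
  *-cancelˡ p p≢0 (lin₂ 1# (- b) h a≡ (eq p a b c q))
  where
  eq = solve 5 (λ p a b c q → p :* (q :* b) :- p :* c
    := :# 1 :* (a :* b :- p :* c) :+ :- b :* (a :- q :* p)) refl

split : ∀ {ps} → All Factor ps → ∀ {a b c} → a * b ≡ product ps * c → Splitting ps a b c
split []                          {a} {b} {c} h =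
  1# , 1# , here refl , a , b , sym (*-identityˡ a) , sym (*-identityˡ b) , trans h (*-identityˡ c)
split {p ∷ ps} ((P , p≢0) ∷ Fs) {a} {b} {c} h = [ left , right ]′ (prime-∣* P a b (product ps * c , eq₀))
  where
  eq₀ : a * b ≡ product ps * c * p
  eq₀ = trans h (eq p (product ps) c)
    where
    eq = solve 3 (λ p m c → p :* m :* c := m :* c :* p) refl
  left : p ∣ a → Splitting (p ∷ ps) a b c
  left p∣a =
    let _ , a≡ , h′ = ∣-cancel p≢0 p∣a (trans h (*-assoc p (product ps) c))
        d , d′ , m , a′ , b′ , e₁ , e₂ , e₃ = split Fs h′
    in p * d , d′ , ∈-++⁺ˡ (∈-map⁺ (map₁ (p *_)) m) , a′ , b′ ,
       trans a≡ (trans (cong (p *_) e₁) (sym (*-assoc p d a′))) , e₂ , e₃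
  right : p ∣ b → Splitting (p ∷ ps) a b c
  right p∣b =
    let _ , b≡ , h′ = ∣-cancel p≢0 p∣b (trans (*-comm b a) (trans h (*-assoc p (product ps) c)))
        d , d′ , m , a′ , b′ , e₁ , e₂ , e₃ = split Fs (trans (*-comm a _) h′)
    in d , p * d′ , ∈-++⁺ʳ (map (map₁ (p *_)) (splittings ps)) (∈-map⁺ (map₂ (p *_)) m) , a′ , b′ ,
       e₁ , trans b≡ (trans (cong (p *_) e₂) (sym (*-assoc p d′ b′))) , e₃

SquareSplitting : List ℤ[i] → ℤ[i] → ℤ[i] → ℤ[i] → Set
SquareSplitting ps a b c = ∃₂ λ d d′ → ((d , d′) ∈ splittings ps) × ∃₂ λ h h′ → ∃₂ λ r s →
  h * h′ ≡ 1# × a ≡ d * (h * r ²) × b ≡ d′ * (h′ * s ²) × r * s ≡ c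

-- Once the primes of the constant are distributed, the cofactors are still coprime and their
-- product is a square, so `coprime-square` applies. The pair d, h records the class of a modulo
-- squares.
square-split : ∀ {ps} → All Factor ps → ∀ {a b c} → ¬ a ≡ 0# → Coprime a b → a * b ≡ product ps * c ² →
               SquareSplitting ps a b c
square-split Fs {a} {b} a≢0 a⊥b e =
  let d , d′ , m , a′ , b′ , a≡ , b≡ , a′b′≡ = split Fs e
      h , h′ , r , s , hh′ , a′≡ , b′≡ , rs≡ = coprime-square
        (λ a′≡0 → a≢0 (trans a≡ (trans (cong (d *_) a′≡0) (zeroʳ d))))
        (cop-∣₂ a⊥b (d , a≡) (d′ , b≡)) a′b′≡
  in d , d′ , m , h , h′ , r , s , hh′ , trans a≡ (cong (d *_) a′≡) , trans b≡ (cong (d′ *_) b′≡) , rs≡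

SquareFree : ℤ[i] → Set
SquareFree m = ∀ x → x ² ∣ m → x ∣ 1#

∣1-factor : ∀ {x y} → x * y ∣ 1# → x ∣ 1#
∣1-factor {x} {y} (q , e) = q * y , trans e (eq x y q)
  where
  eq = solve 3 (λ x y q → q :* (x :* y) := q :* y :* x) refl

squareFree-1 : SquareFree 1#
squareFree-1 x d = ∣1-factor d

-- If p ∣ x, then x² ∣ p m gives p ∣ m, against p ⊥ m. Otherwise x² is coprime to p and divides m.
squareFree-* : ∀ {p m} → Factor p → ¬ p ∣ 1# → Coprime p m → SquareFree m → SquareFree (p * m)
squareFree-* {p} {m} (P , p≢0) p∤1 p⊥m sf x x²∣pm = [ (λ p∣x → contradiction (p-twice p∣x x²∣pm) p∤1) ,
    (λ c → sf x (cop-∣* (cop-sym (cop-* c c)) x²∣pm)) ]′ (P x)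
  where
  p-twice : p ∣ x → x ² ∣ p * m → p ∣ 1#
  p-twice (q , x≡) (k , e) = cop-gcd p⊥m p ∣-refl (k * q * q , *-cancelˡ p p≢0
    (lin₂ 1# (k * (x + q * p)) e x≡ (eq p m x q k)))
    where
    eq = solve 5 (λ p m x q k → p :* m :- p :* (k :* q :* q :* p)
      := :# 1 :* (p :* m :- k :* x :²) :+ k :* (x :+ q :* p) :* (x :- q :* p)) refl

-- After division by gcd(g , t), the square of g′ is coprime to that of t′ and so divides m; hence
-- g′ is a unit. With m = 1 this extracts roots from divisibility of squares.
squareFree-∣ : ∀ {m g t} → SquareFree m → ¬ g ≡ 0# → g ² ∣ m * t ² → g ∣ t
squareFree-∣ {m} {g} {t} sf g≢0 (q , e) =
  let w , g′ , t′ , w≢0 , g≡ , t≡ , g′⊥t′ = reduce-pair g t g≢0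
  in finish w g′ t′ g≡ t≡ (sf g′ (cop-∣* (cop-∣t² g′ t′ g′⊥t′) (q , reduced w g′ t′ w≢0 g≡ t≡)))
  where
  reduced : ∀ w g′ t′ → ¬ w ≡ 0# → g ≡ g′ * w → t ≡ t′ * w → t′ ² * m ≡ q * g′ ²
  reduced w g′ t′ w≢0 refl refl = *-cancelˡ w w≢0 (*-cancelˡ w w≢0 (lin₁ 1# e (eq w g′ t′ m q)))
    where
    eq = solve 5 (λ w g t m q → w :* (w :* (t :² :* m)) :- w :* (w :* (q :* g :²))
      := :# 1 :* (m :* (t :* w) :² :- q :* (g :* w) :²)) refl
  cop-∣t² : ∀ g′ t′ → Coprime g′ t′ → Coprime (g′ ²) (t′ ²)
  cop-∣t² g′ t′ c = cop-sym (cop-* c′ c′)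
    where c′ = cop-sym (cop-* c c)
  finish : ∀ w g′ t′ → g ≡ g′ * w → t ≡ t′ * w → g′ ∣ 1# → g ∣ t
  finish w g′ t′ refl refl (u , 1≡) = t′ * u , lin₁ (t′ * w) 1≡ (eq w g′ t′ u)
    where
    eq = solve 4 (λ w g t u → t :* w :- t :* u :* (g :* w) := t :* w :* (:# 1 :- u :* g)) refl

3-7 3-λ-λ : List ℤ[i]
3-7   = # 3 ∷ # 7 ∷ []
3-λ-λ = # 3 ∷ λ₁ ∷ λ₂ ∷ []

3-factor : Factor (# 3)
3-factor = 3-prime , λ ()

7-factor : Factor (# 7)
7-factor = 7-prime , λ ()

λ₁-factor : Factor λ₁
λ₁-factor = λ₁-prime , λ ()

λ₂-factor : Factor λ₂
λ₂-factor = λ₂-prime , λ ()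

squareFree-3 : SquareFree (# 3)
squareFree-3 = squareFree-* 3-factor (from-no (9 ℕ.∣? 1) ∘ N-∣) (0# , 1# , refl) squareFree-1

squareFree-21 : SquareFree (# 21)
squareFree-21 = squareFree-* 3-factor (from-no (9 ℕ.∣? 1) ∘ N-∣) (- # 2 , 1# , refl)
  (squareFree-* 7-factor (from-no (49 ℕ.∣? 1) ∘ N-∣) (0# , 1# , refl) squareFree-1)

squareFree-15 : SquareFree (# 15)
squareFree-15 = squareFree-* 3-factor (from-no (9 ℕ.∣? 1) ∘ N-∣) (# 2 , - 1# , refl)
  (squareFree-* λ₁-factor (from-no (5 ℕ.∣? 1) ∘ N-∣) (- 1# + λ₂ , - 1# , refl)
  (squareFree-* λ₂-factor (from-no (5 ℕ.∣? 1) ∘ N-∣) (0# , 1# , refl) squareFree-1))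

*-∣-* : ∀ {x y z w} → x ∣ y → z ∣ w → x * z ∣ y * w
*-∣-* {x} {z = z} (p , refl) (q , refl) = p * q , eq x z p q
  where
  eq = solve 4 (λ x z p q → p :* x :* (q :* z) := p :* q :* (x :* z)) refl

∣-≡ : ∀ {x y z} → x ∣ y → y ≡ z → x ∣ z
∣-≡ d refl = d

∣-+ : ∀ {x y z} → x ∣ y → x ∣ z → x ∣ y + z
∣-+ {x} (p , refl) (q , refl) = p + q , eq x p q
  where
  eq = solve 3 (λ x p q → p :* x :+ q :* x := (p :+ q) :* x) refl

∣-scaled-square : ∀ {a d h r} → a ≡ d * (h * r ²) → r ∣ a
∣-scaled-square {d = d} {h} {r} a≡ = d * h * r , trans a≡ (eq d h r)
  where
  eq = solve 3 (λ d h r → d :* (h :* r :²) := d :* h :* r :* r) refl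

halving : ∀ x y z → x * (x + # 2 * y) ≡ # 4 * z → # 2 ∣ x
halving x y z h = step (prime-∣² π-prime x ((1# - I) * # 2 * z - (1# - I) * y * x , lin₁ 1# h (eq x y z)))
  where
  eq = solve 3 (λ x y z → x :² :- ((:# 1 :- :I) :* :# 2 :* z :- (:# 1 :- :I) :* y :* x) :* :π
    := :# 1 :* (x :* (x :+ :# 2 :* y) :- :# 4 :* z)) refl
  step : π ∣ x → # 2 ∣ x
  step (q , refl) = step₂ (prime-∣² π-prime q (- I * (1# - I) * z + I * y * q
    , *-cancelˡ (# 2 * I) (λ ()) (lin₁ 1# h (eq₂ q y z))))
    where
    eq₂ = solve 3 (λ q y z → :# 2 :* :I :* q :²
        :- :# 2 :* :I :* ((:- :I :* (:# 1 :- :I) :* z :+ :I :* y :* q) :* :π)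
      := :# 1 :* (q :* :π :* (q :* :π :+ :# 2 :* y) :- :# 4 :* z)) refl
    step₂ : π ∣ q → # 2 ∣ q * π
    step₂ (w , refl) = I * w , eq₃ w
      where
      eq₃ = solve 1 (λ w → w :* :π :* :π := :I :* w :* :# 2) refl

DifferenceFactors : ℤ[i] → ℤ[i] → Set
DifferenceFactors S z = ∃₂ λ a b → Odd a × a * b ≡ z × a + b ≡ S

-- S - n and S + n differ by an even number and their product is divisible by 4, so both are even.
-- Their halves have the odd sum S; the odd one is called a.
difference-of-squares : ∀ {S n z} → Odd S → S ² - n ² ≡ # 4 * z → DifferenceFactors S z
difference-of-squares {S} {n} {z} S-odd h = factors (halving (S - n) n z (lin₁ 1# h (eq S n z)))
  where
  eq = solve 3 (λ S n z → (S :- n) :* (S :- n :+ :# 2 :* n) :- :# 4 :* z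
    := :# 1 :* (S :² :- n :² :- :# 4 :* z)) refl
  factors : # 2 ∣ S - n → DifferenceFactors S z
  factors (b , S-n≡) = by-parity (parity a)
    where
    a : ℤ[i]
    a = b + n
    ab≡ : a * b ≡ z
    ab≡ = *-cancelˡ (# 4) (λ ()) (lin₂ 1# (- (S + n + # 2 * b)) h S-n≡ (eq′ S n z b))
      where
      eq′ = solve 4 (λ S n z b → :# 4 :* ((b :+ n) :* b) :- :# 4 :* z
        := :# 1 :* (S :² :- n :² :- :# 4 :* z) :+ :- (S :+ n :+ :# 2 :* b) :* (S :- n :- b :* :# 2)) refl
    a+b≡ : a + b ≡ S
    a+b≡ = lin₁ (- 1#) S-n≡ (eq′ S n b)
      where
      eq′ = solve 3 (λ S n b → b :+ n :+ b :- S := :- :# 1 :* (S :- n :- b :* :# 2)) refl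
    by-parity : π ∣ a ⊎ Odd a → DifferenceFactors S z
    by-parity (inj₂ a-odd) = a , b , a-odd , ab≡ , a+b≡
    by-parity (inj₁ π∣a)   = b , a , b-odd , trans (*-comm b a) ab≡ , trans (+-comm b a) a+b≡
      where
      b-odd : Odd b
      b-odd = [ (λ π∣b → contradiction S-odd (¬even×odd (∣-≡ (∣-+ π∣a π∣b) a+b≡))) , (λ o → o) ]′ (parity b)

-- Units and odd squares modulo powers of π

units signs : List ℤ[i]
units = 1# ∷ - 1# ∷ I ∷ - I ∷ []
signs = 1# ∷ - 1# ∷ []

unit-∈ : ∀ {x} → x ∣ 1# → x ∈ units
unit-∈ {x} d = N≡1 x (ℕ.∣1⇒≡1 (N-∣ d))
  where
  N≡1 : ∀ x → N x ≡ 1 → x ∈ units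
  N≡1 ((+ 1) +i (+ 0)) h = here refl
  N≡1 ( -[1+ 0 ] +i (+ 0)) h = there (here refl)
  N≡1 ((+ 0) +i (+ 1)) h = there (there (here refl))
  N≡1 ((+ 0) +i -[1+ 0 ]) h = there (there (there (here refl)))
  N≡1 ((+ suc (suc _)) +i _) ()
  N≡1 ( -[1+ suc _ ] +i _) ()
  N≡1 ((+ 0) +i (+ suc (suc _))) ()
  N≡1 ((+ 0) +i -[1+ suc _ ]) ()
  N≡1 ((+ 1) +i (+ suc _)) ()
  N≡1 ((+ 1) +i -[1+ _ ]) ()
  N≡1 ( -[1+ 0 ] +i (+ suc _)) ()
  N≡1 ( -[1+ 0 ] +i -[1+ _ ]) ()

-- The group of invertible residues modulo 2π has order 4, and the four units represent it. Three
-- successive parity tests find the representative.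
odd-unit : ∀ {z} → Odd z → ∃₂ λ u y → u ∈ units × z ≡ u + # 2 * π * y
odd-unit (x , refl) = go (parity x)
  where
  e₁ = solve 1 (λ q → :# 1 :+ :π :* (q :* :π :* :π) := :# 1 :+ :# 2 :* :π :* (:I :* q)) refl
  e₂ = solve 1 (λ q → :# 1 :+ :π :* ((:# 1 :+ :π :* q) :* :π)
    := :- :# 1 :+ :# 2 :* :π :* (:# 1 :+ :I :* q)) refl
  e₃ = solve 1 (λ q → :# 1 :+ :π :* (:# 1 :+ :π :* (q :* :π)) := :- :I :+ :# 2 :* :π :* (:# 1 :+ :I :* q)) refl
  e₄ = solve 1 (λ q → :# 1 :+ :π :* (:# 1 :+ :π :* (:# 1 :+ :π :* q))
    := :I :+ :# 2 :* :π :* (:# 1 :+ :I :* q)) refl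
  go : _ → ∃₂ λ u y → u ∈ units × 1# + π * x ≡ u + # 2 * π * y
  go (inj₁ (x′ , refl)) = [ (λ { (q , refl) → 1# , I * q , here refl , e₁ q })
                          , (λ { (q , refl) → - 1# , 1# + I * q , there (here refl) , e₂ q }) ]′ (parity x′)
  go (inj₂ (x′ , refl)) = [ (λ { (q , refl) → - I , 1# + I * q , there (there (there (here refl))) , e₃ q })
                          , (λ { (q , refl) → I , 1# + I * q , there (there (here refl)) , e₄ q }) ]′ (parity x′)

unit-square : ∀ {u} → u ∈ units → u ² ∈ signs
unit-square = All.lookup {P = λ u → u ² ∈ signs} (here refl ∷ here refl ∷ there (here refl) ∷ there (here refl) ∷
    [])

-- Squaring u + 2πy gains two more factors π: (u + 2πy)² = u² + 4π (u y + π y²), and u² = ±1.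
odd-square : ∀ {z} → Odd z → ∃₂ λ ε y → ε ∈ signs × z ² ≡ ε + # 4 * π * y
odd-square o =
  let u , y , m , z≡ = odd-unit o
  in u ² , u * y + π * y * y , unit-square m , trans (cong _² z≡) (eq u y)
  where
  eq = solve 2 (λ u y → (u :+ :# 2 :* :π :* y) :² := u :² :+ :# 4 :* :π :* (u :* y :+ :π :* y :* y)) refl

odd-squares-mod : ∀ {z w m} c → Odd z → Odd w → m ∣ # 4 * π → m ∣ z ² - c * w ² →
                  ∃₂ λ ε ε′ → ε ∈ signs × ε′ ∈ signs × m ∣ ε - c * ε′
odd-squares-mod {z} {w} c oz ow (k , e) (q , h) =
  let ε , y , m , e₁ = odd-square oz
      ε′ , y′ , m′ , e₂ = odd-square ow
  in ε , ε′ , m , m′ , q - k * y + c * k * y′ , sub ε ε′ y y′ e₁ e₂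
  where
  eq = solve 11 (λ s t m c k q y y′ ε ε′ π → ε :- c :* ε′ :- (q :- k :* y :+ c :* k :* y′) :* m
    := :# 1 :* (s :- c :* t :- q :* m)
      :+ :- :# 1 :* (s :- (ε :+ π :* y)) :+ c :* (t :- (ε′ :+ π :* y′)) :+ (c :* y′ :- y) :* (π :- k :* m)) refl
  sub : ∀ ε ε′ y y′ → z ² ≡ ε + # 4 * π * y → w ² ≡ ε′ + # 4 * π * y′ → ε - c * ε′ ≡ (q - k * y + c * k * y′) * _
  sub ε ε′ y y′ e₁ e₂ = lin₄ 1# (- 1#) c (c * y′ - y) h e₁ e₂ e (eq (z ²) (w ²) _ c k q y y′ ε ε′ (# 4 * π))

-- 32 is the norm of 4π, so the condition refutes d h ε′ ≡ ε modulo 4π: d h is not, modulo 4π, a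
-- quotient of odd squares.
Excluded : List ℤ[i] → ℤ[i] → Set
Excluded hs d = All (λ h → All (λ ε → All (λ ε′ → ¬ 32 ℕ.∣ N (ε - d * h * ε′)) signs) signs) hs

excluded? : ∀ hs d → Dec (Excluded hs d)
excluded? hs d = All.all? (λ h → All.all? (λ ε → All.all? (λ ε′ → ¬? (_ ℕ.∣? _)) signs) signs) hs

-- The 2-descent

data Scale : ℤ[i] → Set where
  one   : Scale 1#
  three : Scale (# 3)

scale-odd : ∀ {k} → Scale k → Odd k
scale-odd one   = 0# , refl
scale-odd three = 1# - I , refl

-- Counts the valuation in steps of 2, the step of the descent; `Q j` is a unit times 2^j.
Q : ℕ → ℤ[i]
Q zero    = 1#
Q (suc j) = π * π * Q j

cop-1 : ∀ {x} → Coprime x 1#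
cop-1 {x} = 0# , 1# , eq x
  where
  eq = solve 1 (λ x → :# 0 :* x :+ (:# 1) :² := :# 1) refl

cop-Q : ∀ {x} j → Odd x → Coprime x (Q j)
cop-Q zero    o = cop-1
cop-Q (suc j) o = cop-* (cop-* π⊥ π⊥) (cop-Q j o)
  where π⊥ = cop-sym (odd⇒cop o)

-- The equation n² = M⁴ - 9kπ M²E² + 15k²π² E⁴ with E = 2iπ (Q j) e: the factor i changes the sign
-- of the middle term, and -9kπE² = 36κ, 15k²π²E⁴ = 240κ². The valuation of E is 2j + 3.
record Quartic (k : ℤ[i]) (j : ℕ) : Set where
  field
    {M e n κ} : ℤ[i]
    M-odd    : Odd M
    e-odd    : Odd e
    M⊥e      : Coprime M e
    κ≡       : κ ≡ k * π * (π * (Q j * e)) ²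
    equation : n ² ≡ M ² ² + # 36 * κ * M ² + # 240 * κ ²

-- The trivial class on the isogenous curve, whose coefficients are -18 and 21. The product r s
-- keeps the shape of κ, with the same j.
record Form₂₁ (k : ℤ[i]) (j : ℕ) : Set where
  field
    {r s m e} : ℤ[i]
    r-odd    : Odd r
    e-odd    : Odd e
    r⊥s      : Coprime r s
    rs≡      : r * s ≡ k * π * (π * (Q j * e)) ²
    equation : m ² ≡ r ² - # 18 * (r * s) + # 21 * s ²

7h-Nonresidue : ℤ[i] → Set
7h-Nonresidue h = (m y : Fin 5) →
  (toℕ m ≡ 0 × toℕ y ≡ 0) ⊎ ¬ 5 ℕ.∣ N (# 7 * h * # (toℕ m) * # (toℕ m) - # (toℕ y) * # (toℕ y))

7h-nonresidue? : Dec (All 7h-Nonresidue signs)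
7h-nonresidue? = All.all? (λ h → Finₚ.all? λ m → Finₚ.all? λ y → (_ ℕₚ.≟ _ ×-dec _ ℕₚ.≟ _) ⊎-dec ¬? (_ ℕ.∣? _))
    signs

module _ {k : ℤ[i]} {j : ℕ} (sc : Scale k) (q : Quartic k j) where
  open Quartic q

  private
    κ₁ : ℤ[i]
    κ₁ = π * (π * (Q j * e)) ²

    M⊥κ₁ : Coprime M κ₁
    M⊥κ₁ = cop-* π⊥ (cop-* πQe⊥ πQe⊥)
      where
      π⊥ = cop-sym (odd⇒cop M-odd)
      πQe⊥ = cop-* π⊥ (cop-* (cop-Q j M-odd) M⊥e)

    κ≡kκ₁ : κ ≡ k * κ₁
    κ≡kκ₁ = trans κ≡ (*-assoc k π _)

  -- For k = 3, a factor 3 of M would give 3 ∣ n and then 9 ∣ n. The term 240κ² = 27 · 80κ₁² is then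
  -- divisible by 81, so 3 ∣ κ₁, against M ⊥ κ₁.
  M⊥scale : Coprime M k
  M⊥scale = go sc κ≡kκ₁
    where
    go : ∀ {k} → Scale k → κ ≡ k * κ₁ → Coprime M k
    go one   _ = cop-1
    go three h = [ (λ d → ⊥-elim (absurd d)) , cop-sym ]′ (3-prime M)
      where
      eq₁ = solve 4 (λ M n κ c → n :²
          :- (:# 27 :* M :* M :* M :* M :+ :# 324 :* c :* M :* M :+ :# 720 :* c :* c) :* :# 3
        := :# 1 :* (n :² :- ((M :* :# 3) :² :² :+ :# 36 :* κ :* (M :* :# 3) :² :+ :# 240 :* κ :²))
          :+ (:# 324 :* M :* M :+ :# 240 :* (κ :+ :# 3 :* c)) :* (κ :- :# 3 :* c)) refl
      eq₂ = solve 4 (λ M n κ c → :# 9 :* n :²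
          :- :# 9 :* ((:# 3 :* M :* M :* M :* M :+ :# 36 :* c :* M :* M :+ :# 80 :* c :* c) :* :# 3)
        := :# 1 :* ((n :* :# 3) :² :- ((M :* :# 3) :² :² :+ :# 36 :* κ :* (M :* :# 3) :² :+ :# 240 :* κ :²))
          :+ (:# 324 :* M :* M :+ :# 240 :* (κ :+ :# 3 :* c)) :* (κ :- :# 3 :* c)) refl
      eq₃ = solve 4 (λ M n κ c → :# 27 :* (:# 80 :* c :²)
          :- :# 27 :* ((n :² :- M :² :* M :* M :- :# 12 :* c :* M :* M) :* :# 3)
        := :- :# 1 :* ((n :* :# 3 :* :# 3) :² :- ((M :* :# 3) :² :² :+ :# 36 :* κ :* (M :* :# 3) :² :+ :# 240
              :* κ :²)) :+ :- (:# 324 :* M :* M :+ :# 240 :* (κ :+ :# 3 :* c)) :* (κ :- :# 3 :* c)) refl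
      step₂ : ∀ {M′ n′} → M ≡ M′ * # 3 → n ≡ n′ * # 3 → # 3 ∣ n′ → # 3 ∣ κ₁
      step₂ {M′} refl refl (n″ , refl) = prime-∣² 3-prime κ₁ (cop-∣* {# 3} {# 80} (# 27 , - 1# , refl)
        (_ , *-cancelˡ (# 27) (λ ()) (lin₂ (- 1#) (- (# 324 * M′ * M′ + # 240 * (κ + # 3 * κ₁))) equation h
            (eq₃ M′ n″ κ κ₁))))
      step₁ : ∀ {M′} → M ≡ M′ * # 3 → # 3 ∣ n → # 3 ∣ κ₁
      step₁ {M′} refl (n′ , refl) = step₂ refl refl (prime-∣² 3-prime n′
        (_ , *-cancelˡ (# 9) (λ ()) (lin₂ 1# (# 324 * M′ * M′ + # 240 * (κ + # 3 * κ₁)) equation h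
            (eq₂ M′ n′ κ κ₁))))
      absurd : # 3 ∣ M → ⊥
      absurd d@(M′ , refl) = from-no (9 ℕ.∣? 1) (N-∣ (cop-gcd M⊥κ₁ (# 3) d (step₁ refl (prime-∣² 3-prime n
        (_ , lin₂ 1# (# 324 * M′ * M′ + # 240 * (κ + # 3 * κ₁)) equation h (eq₁ M′ n κ κ₁))))))

  M⊥κ : Coprime M κ
  M⊥κ = subst (Coprime M) (sym κ≡kκ₁) (cop-* M⊥scale M⊥κ₁)

  π³∣κ : π * π * π ∣ κ
  π³∣κ = k * (Q j * e) ² , trans κ≡ (eq k (Q j * e))
    where
    eq = solve 2 (λ k y → k :* :π :* (:π :* y) :² := k :* y :² :* (:π :² :* :π)) refl

  π∣κ : π ∣ κ
  π∣κ = ∣-trans (π * π , refl) π³∣κ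

  Conclusion : ℤ[i] → ℤ[i] → ℤ[i] → ℤ[i] → ℤ[i] → Set
  Conclusion d d′ h r s = Coprime r s → Odd r → r * s ≡ κ → M ² ≡ d * h * r ² + d′ * h * s ² - # 18 * (r * s)
      → Form₂₁ k j

  -- 7 h M² ≡ (7 r - 9 h s)² (mod 2 + i), while 7 h is not a square.
  module _ {h : ℤ[i]} (h∈ : h ∈ signs) where

    h²≡1 : h ² ≡ 1#
    h²≡1 = All.lookup {P = λ h → h ² ≡ 1#} (refl ∷ refl ∷ []) h∈

    exclude-7 : ∀ {r s} → Coprime r s → M ² ≡ # 7 * h * r ² + # 3 * h * s ² - # 18 * (r * s) → ⊥
    exclude-7 {r} {s} r⊥s eqn = go (Mod-λ₁.residue M) (Mod-λ₁.residue Y)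
      where
      Y = # 7 * r - # 9 * h * s
      key : # 7 * h * M ² ≡ Y ² - # 60 * s ²
      key = lin₂ (# 7 * h) (# 49 * r * r + # 21 * s * s - # 81 * s * s) eqn h²≡1 (eq M h r s)
        where
        eq = solve 4 (λ M h r s → :# 7 :* h :* M :² :- ((:# 7 :* r :- :# 9 :* h :* s) :² :- :# 60 :* s :²)
          := :# 7 :* h :* (M :² :- (:# 7 :* h :* r :² :+ :# 3 :* h :* s :² :- :# 18 :* (r :* s)))
            :+ (:# 49 :* r :* r :+ :# 21 :* s :* s :- :# 81 :* s :* s) :* (h :² :- :# 1)) refl
      -- If both vanish modulo λ₁, then λ₁² divides 60 s² = 12 λ₁ λ₂ s², so λ₁ divides s and then r,
      -- which are coprime.
      both : ∀ w v → M ≡ w * λ₁ → Y ≡ v * λ₁ → ⊥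
      both w v M≡ Y≡ = from-no (5 ℕ.∣? 1) (N-∣ (cop-gcd r⊥s λ₁ λ₁∣r λ₁∣s))
        where
        λ₁∣s : λ₁ ∣ s
        λ₁∣s = prime-∣² λ₁-prime s (cop-∣* {λ₁} {# 12 * λ₂} (# 24 - # 19 * λ₂ , # 2 , refl)
          (v ² - # 7 * h * w ² , *-cancelˡ λ₁ (λ ()) (lin₃ 1# (- # 7 * h * (M + w * λ₁)) (Y + v * λ₁) key M≡ Y≡
              (eq M Y w v h s))))
          where
          eq = solve 6 (λ M Y w v h s → con λ₁ :* (:# 12 :* con λ₂ :* s :²)
              :- con λ₁ :* ((v :² :- :# 7 :* h :* w :²) :* con λ₁)
            := :# 1 :* (:# 7 :* h :* M :² :- (Y :² :- :# 60 :* s :²)) :+ :- :# 7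
              :* h :* (M :+ w :* con λ₁) :* (M :- w :* con λ₁) :+ (Y :+ v :* con λ₁) :* (Y :- v :* con λ₁)) refl
        λ₁∣r : λ₁ ∣ r
        λ₁∣r = cop-∣* {λ₁} {# 7} (- # 4 * λ₂ , # 3 , refl)
          (∣-≡ (∣-lin 1# (# 9 * h) (v , Y≡) λ₁∣s) (eq r h s))
          where
          eq = solve 3 (λ r h s → :# 1 :* (:# 7 :* r :- :# 9 :* h :* s) :+ :# 9 :* h :* s := :# 7 :* r) refl
      go : (∃₂ λ (m : Fin 5) w → M ≡ # (toℕ m) + w * λ₁) → (∃₂ λ (y : Fin 5) v → Y ≡ # (toℕ y) + v * λ₁) → ⊥
      go (m , w , M≡) (y , v , Y≡) = [ zero-residues , (λ ¬d → ¬d (N-∣ λ₁∣)) ]′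
          (All.lookup (from-yes 7h-nonresidue?) h∈ m y)
        where
        zero-residues : toℕ m ≡ 0 × toℕ y ≡ 0 → ⊥
        zero-residues (m≡0 , y≡0) = both w v
          (trans M≡ (trans (cong (λ t → # t + w * λ₁) m≡0) (+-identityˡ (w * λ₁))))
          (trans Y≡ (trans (cong (λ t → # t + v * λ₁) y≡0) (+-identityˡ (v * λ₁))))
        λ₁∣ : λ₁ ∣ # 7 * h * # (toℕ m) * # (toℕ m) - # (toℕ y) * # (toℕ y)
        λ₁∣ = - (# 7 * h * w * (M + # (toℕ m))) + v * (Y + # (toℕ y)) - # 12 * λ₂ * s ² ,
          lin₃ 1# (- # 7 * h * (M + # (toℕ m))) (Y + # (toℕ y)) key M≡ Y≡ (eq M Y w v h s (# (toℕ m)) (# (toℕ y)))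
          where
          eq = solve 8 (λ M Y w v h s m y → :# 7 :* h :* m :* m
              :- y :² :- (:- (:# 7 :* h :* w :* (M :+ m)) :+ v :* (Y :+ y) :- :# 12 :* con λ₂ :* s :²) :* con λ₁
            := :# 1 :* (:# 7 :* h :* M :² :- (Y :² :- :# 60 :* s :²)) :+ :- :# 7
              :* h :* (M :+ m) :* (M :- (m :+ w :* con λ₁)) :+ (Y :+ y) :* (Y :- (y :+ v :* con λ₁))) refl

  form₂₁ : ∀ {h} → h ∈ signs → ∀ {r s} → Conclusion 1# (# 21) h r s
  form₂₁ (here refl) {r} {s} r⊥s r-odd rs≡ eqn = record
    { r-odd = r-odd ; e-odd = e-odd ; r⊥s = r⊥s ; rs≡ = trans rs≡ κ≡ ; equation = trans eqn (eq r s) }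
    where
    eq = solve 2 (λ r s → (:# 1) :² :* r :² :+ :# 21 :* :# 1 :* s :² :- :# 18 :* (r :* s)
      := r :² :- :# 18 :* (r :* s) :+ :# 21 :* s :²) refl
  -- For h = -1 the equation is multiplied by -1 = i². This becomes m = iM, and s ↦ -s restores the
  -- cross term; e ↦ ie keeps the formula for r s.
  form₂₁ (there (here refl)) {r} {s} r⊥s r-odd rs≡ eqn = record
    { r = r ; s = - s ; m = I * M ; e = I * e
    ; r-odd = r-odd ; e-odd = odd-* I-odd e-odd ; r⊥s = cop-sym (cop-∣ (cop-sym r⊥s) (- 1# , eq₃ s))
    ; rs≡ = lin₂ (- 1#) (- 1#) rs≡ κ≡ (eq₁ r s k (Q j) e κ) ; equation = lin₁ (- 1#) eqn (eq₂ M r s) }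
    where
    I-odd : Odd I
    I-odd = I , refl
    eq₁ = solve 6 (λ r s k P e κ → r :* :- s :- k :* :π :* (:π :* (P :* (:I :* e))) :²
      := :- :# 1 :* (r :* s :- κ) :+ :- :# 1 :* (κ :- k :* :π :* (:π :* (P :* e)) :²)) refl
    eq₂ = solve 3 (λ M r s → (:I :* M) :² :- (r :² :- :# 18 :* (r :* :- s) :+ :# 21 :* (:- s) :²)
      := :- :# 1 :* (M :² :- (:# 1 :* :- :# 1 :* r :² :+ :# 21 :* :- :# 1 :* s :² :- :# 18 :* (r :* s)))) refl
    eq₃ = solve 1 (λ s → s := :- :# 1 :* :- s) refl

  Conclusion′ : ℤ[i] → ℤ[i] → ℤ[i] → ℤ[i] → Set
  Conclusion′ d d′ h h′ = h * h′ ≡ 1# → ∀ {r s} → Coprime r s → Odd r → r * s ≡ κ →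
    M ² ≡ d * (h * r ²) + d′ * (h′ * s ²) - # 18 * (r * s) → Form₂₁ k j

  same-sign : ∀ {d d′ h h′} → h ∈ signs → (∀ {r s} → Conclusion d d′ h r s) → Conclusion′ d d′ h h′
  same-sign {d} {d′} {h} {h′} h∈ c hh′ {r} {s} r⊥s o e eqn =
    c r⊥s o e (lin₃ 1# (d′ * h * s ²) (- (d′ * h′ * s ²)) eqn hh′ (h²≡1 h∈) (eq M d d′ h h′ r s))
    where
    eq = solve 7 (λ M d d′ h h′ r s → M :² :- (d :* h :* r :² :+ d′ :* h :* s :² :- :# 18 :* (r :* s))
      := :# 1 :* (M :² :- (d :* (h :* r :²) :+ d′ :* (h′ :* s :²) :- :# 18 :* (r :* s)))
        :+ d′ :* h :* s :² :* (h :* h′ :- :# 1) :+ :- (d′ :* h′ :* s :²) :* (h :² :- :# 1)) refl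

  -- The list runs through d = 21, 3, 7, 1. Modulo 4π only d h = ±7 and d h = ±1 survive; as 7 ≡ -1
  -- modulo 8, the class 7 needs the argument at 2 + i.
  select : ∀ {d d′} → (d , d′) ∈ splittings 3-7 → ∀ {h h′} → h ∈ units → ∀ {ε ε′} → ε ∈ signs → ε′ ∈ signs →
    # 4 * π ∣ ε - d * h * ε′ → Conclusion′ d d′ h h′
  select (here refl) h∈ ε∈ ε′∈ d = ⊥-elim (All.lookup (All.lookup
      (All.lookup (from-yes (excluded? units (# 21))) h∈) ε∈) ε′∈ (N-∣ d))
  select (there (here refl)) h∈ ε∈ ε′∈ d = ⊥-elim (All.lookup
      (All.lookup (All.lookup (from-yes (excluded? units (# 3))) h∈) ε∈) ε′∈ (N-∣ d))
  select (there (there (here refl))) (here refl) _ _ _ = same-sign (here refl) λ r⊥s _ _ e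
      → ⊥-elim (exclude-7 (here refl) r⊥s e)
  select (there (there (here refl))) (there (here refl)) _ _ _ = same-sign (there (here refl)) λ r⊥s _ _ e
      → ⊥-elim (exclude-7 (there (here refl)) r⊥s e)
  select (there (there (here refl))) (there (there h∈)) ε∈ ε′∈ d =
    ⊥-elim (All.lookup (All.lookup (All.lookup (from-yes (excluded? (I ∷ - I ∷ []) (# 7))) h∈) ε∈) ε′∈ (N-∣ d))
  select (there (there (there (here refl)))) (here refl) _ _ _ = same-sign (here refl) (form₂₁ (here refl))
  select (there (there (there (here refl)))) (there (here refl)) _ _ _ = same-sign (there (here refl))
      (form₂₁ (there (here refl)))
  select (there (there (there (here refl)))) (there (there h∈)) ε∈ ε′∈ d =
    ⊥-elim (All.lookup (All.lookup (All.lookup (from-yes (excluded? (I ∷ - I ∷ []) 1#)) h∈) ε∈) ε′∈ (N-∣ d))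

  -- A common divisor g has g² ∣ 21κ², so g ∣ κ and then g ∣ M², hence g is a unit. In r s = κ the
  -- factor r is odd, so π³ ∣ s. Then s² and 18 r s vanish modulo 4π and M² ≡ d h r².
  from-factors : ∀ {a b} → Odd a → a * b ≡ # 21 * κ ² → a + b ≡ M ² + # 18 * κ → Form₂₁ k j
  from-factors {a} {b} a-odd ab≡ a+b≡ = go (square-split (3-factor ∷ 7-factor ∷ []) (odd≢0 a-odd) a⊥b ab≡)
    where
    a⊥b : Coprime a b
    a⊥b = cop-by-∣ λ g g∣a g∣b →
      let g∣κ = squareFree-∣ squareFree-21 (odd≢0 (odd-∣ g∣a a-odd)) (∣-≡ (*-∣-* g∣a g∣b) ab≡)
          g∣M² = ∣-≡ (∣-lin 1# (- # 18) (∣-≡ (∣-+ g∣a g∣b) a+b≡) g∣κ) (eq₁ M κ)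
      in cop-gcd (cop-sym (cop-* (cop-sym M⊥κ) (cop-sym M⊥κ))) g g∣M² g∣κ
      where
      eq₁ = solve 2 (λ M κ → :# 1 :* (M :² :+ :# 18 :* κ) :+ :- :# 18 :* κ := M :²) refl
    go : SquareSplitting 3-7 a b κ → Form₂₁ k j
    go (d , d′ , d∈ , h , h′ , r , s , hh′ , a≡ , b≡ , rs≡) =
      finish (odd-squares-mod (d * h) M-odd r-odd (1# , sym (*-identityˡ _))
          (4π∣ (cop-∣* π³⊥r (∣-≡ π³∣κ (sym rs≡)))))
      where
      r∣a : r ∣ a
      r∣a = ∣-scaled-square {d = d} {h} a≡
      s∣b : s ∣ b
      s∣b = ∣-scaled-square {d = d′} {h′} b≡
      r-odd : Odd r
      r-odd = odd-∣ r∣a a-odd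
      π³⊥r : Coprime (π * π * π) r
      π³⊥r = cop-sym (cop-* (cop-* π⊥ π⊥) π⊥)
        where π⊥ = cop-sym (odd⇒cop r-odd)
      M²≡ : M ² ≡ d * (h * r ²) + d′ * (h′ * s ²) - # 18 * (r * s)
      M²≡ = trans (lin₃ (- 1#) 1# 1# a+b≡ a≡ b≡ (eq M κ a b _ _))
          (cong (λ t → d * (h * r ²) + d′ * (h′ * s ²) - # 18 * t) (sym rs≡))
        where
        eq = solve 6 (λ M κ a b s t → M :² :- (s :+ t :- :# 18 :* κ)
          := :- :# 1 :* (a :+ b :- (M :² :+ :# 18 :* κ)) :+ :# 1 :* (a :- s) :+ :# 1 :* (b :- t)) refl
      4π∣ : π * π * π ∣ s → # 4 * π ∣ M ² - d * h * r ²
      4π∣ (w , refl) = - (1# + I) * d′ * h′ * w * w - # 9 * I * r * w , lin₁ 1# M²≡ (eq M d h d′ h′ r w)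
        where
        eq = solve 7 (λ M d h d′ h′ r w → M :²
            :- d :* h :* r :² :- (:- (:# 1 :+ :I) :* d′ :* h′ :* w :* w :- :# 9 :* :I :* r :* w) :* (:# 4 :* :π)
          := :# 1 :* (M :² :- (d :* (h :* r :²)
                :+ d′ :* (h′ :* (w :* (:π :² :* :π)) :²) :- :# 18 :* (r :* (w :* (:π :² :* :π)))))) refl
      finish : (∃₂ λ ε ε′ → ε ∈ signs × ε′ ∈ signs × # 4 * π ∣ ε - d * h * ε′) → Form₂₁ k j
      finish (_ , _ , ε∈ , ε′∈ , 4π∣′) = select d∈ (unit-∈ (h′ , trans (sym hh′) (*-comm h h′))) ε∈ ε′∈ 4π∣′ hh′
          (cop-∣₂ a⊥b r∣a s∣b) r-odd rs≡ M²≡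

  -- Completing the square: (M² + 18κ)² - n² = (18² - 240) κ² = 4 · 21κ².
  quartic⇒form₂₁ : Form₂₁ k j
  quartic⇒form₂₁ = go (difference-of-squares (odd+even (odd-* M-odd M-odd) (∣-* (# 18) π∣κ))
      (lin₁ (- 1#) equation (eq M κ n)))
    where
    eq = solve 3 (λ M κ n → (M :² :+ :# 18 :* κ) :² :- n :² :- :# 4 :* (:# 21 :* κ :²)
      := :- :# 1 :* (n :² :- (M :² :² :+ :# 36 :* κ :* M :² :+ :# 240 :* κ :²))) refl
    go : DifferenceFactors (M ² + # 18 * κ) (# 21 * κ ²) → Form₂₁ k j
    go (_ , _ , a-odd , ab≡ , a+b≡) = from-factors a-odd ab≡ a+b≡

-- The second isogeny

Q≢0 : ∀ j → ¬ Q j ≡ 0#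
Q≢0 zero    ()
Q≢0 (suc j) h = [ (λ ()) , Q≢0 j ]′ (x*y≡0 (π * π) (Q j) h)

πQ≢0 : ∀ j → ¬ π * Q j ≡ 0#
πQ≢0 j h = [ (λ ()) , Q≢0 j ]′ (x*y≡0 π (Q j) h)

-- A torsor of the curve with coefficients 9 and 15: d d′ = 15 for the pairs of `splittings 3-λ-λ`,
-- and d U is the class modulo squares.
record Form₁₅ (k : ℤ[i]) (j : ℕ) (d d′ : ℤ[i]) : Set where
  field
    {t w m n U U′} : ℤ[i]
    t-odd    : Odd t
    n-odd    : Odd n
    t⊥w      : Coprime t w
    UU′≡1    : U * U′ ≡ 1#
    tw≡      : t * w ≡ k * π * (π * (Q j * n)) ²
    equation : m ² ≡ d * U * t ² + # 9 * (t * w) + d′ * U′ * w ²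

module _ {k : ℤ[i]} {j : ℕ} (sc : Scale k) (f : Form₂₁ k j) where
  open Form₂₁ f

  private
    y : ℤ[i]
    y = π * (π * (Q j * e)) ²

    rs≡ky : r * s ≡ k * y
    rs≡ky = trans rs≡ (*-assoc k π _)

    π∣s : π ∣ s
    π∣s = cop-∣* (odd⇒cop r-odd) (k * (π * (Q j * e)) ² , trans rs≡ (eq k _))
      where
      eq = solve 2 (λ k z → k :* :π :* z := k :* z :* :π) refl

  -- For k = 3, suppose 3 ∣ r. The equation gives 3 ∣ m, and then 21 s² is divisible by 9, so 3 ∣ s,
  -- against r ⊥ s. Hence the factor 3 of r s lies in s.
  scale∣s : ∃ λ s₁ → s ≡ s₁ * k × r * s₁ ≡ y
  scale∣s = go sc rs≡ky
    where
    go : ∀ {k} → Scale k → r * s ≡ k * y → ∃ λ s₁ → s ≡ s₁ * k × r * s₁ ≡ y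
    go one   h = s , eq s , trans h (*-identityˡ y)
      where
      eq = solve 1 (λ s → s := s :* :# 1) refl
    go three h = [ (λ d → ⊥-elim (absurd d)) , (λ c → quotient (cop-∣* c (y , trans h (*-comm (# 3) y)))) ]′
        (3-prime r)
      where
      quotient : # 3 ∣ s → _
      quotient (s₁ , s≡) = s₁ , s≡ , *-cancelˡ (# 3) (λ ()) (lin₂ 1# (- r) h s≡ (eq r s y s₁))
        where
        eq = solve 4 (λ r s y s₁ → :# 3 :* (r :* s₁) :- :# 3 :* y
          := :# 1 :* (r :* s :- :# 3 :* y) :+ :- r :* (s :- s₁ :* :# 3)) refl
      3∣s : ∀ {r′} → r ≡ r′ * # 3 → # 3 ∣ m → # 3 ∣ s
      3∣s {r′} refl (m′ , refl) = prime-∣² 3-prime s (cop-∣* {# 3} {# 7} (- # 2 , 1# , refl)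
        (m′ ² - r′ ² + # 6 * r′ * s , *-cancelˡ (# 3) (λ ()) (lin₁ (- 1#) equation (eq r′ s m′))))
        where
        eq = solve 3 (λ r s m → :# 3 :* (:# 7 :* s :²) :- :# 3 :* ((m :² :- r :² :+ :# 6 :* r :* s) :* :# 3)
          := :- :# 1 :* ((m :* :# 3) :² :- ((r :* :# 3) :² :- :# 18 :* (r :* :# 3 :* s) :+ :# 21 :* s :²))) refl
      absurd : # 3 ∣ r → ⊥
      absurd d@(r′ , refl) = from-no (9 ℕ.∣? 1) (N-∣ (cop-gcd r⊥s (# 3) d (3∣s refl (prime-∣² 3-prime m
        (_ , lin₁ 1# equation (eq r′ s m))))))
        where
        eq = solve 3 (λ r s m → m :² :- (:# 3 :* r :* r :- :# 18 :* r :* s :+ :# 7 :* s :* s) :* :# 3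
          := :# 1 :* (m :² :- ((r :* :# 3) :² :- :# 18 :* (r :* :# 3 :* s) :+ :# 21 :* s :²))) refl

  -- Once k and π are removed from s, the coprime factors r and s₂ have the square product (π Q e)².
  -- Since r is odd, all powers of π stay in s. That r is a unit times a square turns r = a + b + 9s
  -- into a quartic equation.
  s-shape : ∃₂ λ v v′ → ∃₂ λ ρ n → v * v′ ≡ 1# × r ≡ v * ρ ² × s ≡ v′ * (k * π * (π * (Q j * n)) ²) × Odd n
  s-shape =
    let s₁ , s≡ , rs₁≡ = scale∣s
        π∣s₁ = cop-∣* (odd⇒cop r-odd) ((π * (Q j * e)) ² , trans rs₁≡ (*-comm π _))
    in go s₁ s≡ rs₁≡ π∣s₁
    where
    go : ∀ s₁ → s ≡ s₁ * k → r * s₁ ≡ y → π ∣ s₁ → _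
    go _ s≡ rs₁≡ (s₂ , refl) = go₂ (coprime-square (odd≢0 r-odd) (cop-∣₂ r⊥s ∣-refl (k * π , trans s≡ (eq₁ s₂ k)))
        (*-cancelˡ π (λ ()) (lin₁ 1# rs₁≡ (eq₂ r s₂ (π * (Q j * e))))))
      where
      eq₁ = solve 2 (λ s k → s :* :π :* k := k :* :π :* s) refl
      eq₂ = solve 3 (λ r s z → :π :* (r :* s) :- :π :* z :² := :# 1 :* (r :* (s :* :π) :- :π :* z :²)) refl
      go₂ : SquareFactors r s₂ (π * (Q j * e)) → _
      go₂ (v , v′ , ρ , σ , vv′ , r≡ , s₂≡ , ρσ≡) = go₃ (cop-∣* πQ⊥ρ (e , trans ρσ≡ (eq₃ (Q j) e)))
        where
        eq₃ = solve 2 (λ q e → :π :* (q :* e) := e :* (:π :* q)) refl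
        ρ-odd : Odd ρ
        ρ-odd = odd-∣ (v * ρ , trans r≡ (sym (*-assoc v ρ ρ))) r-odd
        πQ⊥ρ : Coprime (π * Q j) ρ
        πQ⊥ρ = cop-sym (cop-* (cop-sym (odd⇒cop ρ-odd)) (cop-Q j ρ-odd))
        go₃ : π * Q j ∣ σ → _
        go₃ (n , σ≡) = v , v′ , ρ , n , vv′ , r≡ , lin₃ 1# (k * π) (v′ * k * π * (σ + n * (π * Q j))) s≡ s₂≡ σ≡
            (eq₄ s s₂ k v′ σ n (Q j))
          , odd-∣ (ρ , sym ρn≡e) e-odd
          where
          eq₄ = solve 7 (λ s s₂ k v σ n q → s :- v :* (k :* :π :* (:π :* (q :* n)) :²)
            := :# 1 :* (s :- s₂ :* :π :* k) :+ k :* :π :* (s₂ :- v :* σ :²)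
              :+ v :* k :* :π :* (σ :+ n :* (:π :* q)) :* (σ :- n :* (:π :* q))) refl
          ρn≡e : ρ * n ≡ e
          ρn≡e = *-cancelˡ (π * Q j) (πQ≢0 j) (lin₂ 1# (- ρ) ρσ≡ σ≡ (eq₅ (Q j) ρ n e σ))
            where
            eq₅ = solve 5 (λ q ρ n e σ → :π :* q :* (ρ :* n) :- :π :* q :* e
              := :# 1 :* (ρ :* σ :- :π :* (q :* e)) :+ :- ρ :* (σ :- n :* (:π :* q))) refl

  Forms₁₅ : Set
  Forms₁₅ = ∃₂ λ d d′ → ((d , d′) ∈ splittings 3-λ-λ) × Form₁₅ k j d d′

  from-factors₁₅ : ∀ {a b} → Odd a → a * b ≡ # 15 * s ² → a + b ≡ r - # 9 * s → Forms₁₅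
  from-factors₁₅ {a} {b} a-odd ab≡ a+b≡ = go (square-split (3-factor ∷ λ₁-factor ∷ λ₂-factor ∷ []) (odd≢0 a-odd)
      a⊥b ab≡) s-shape
    where
    a⊥b : Coprime a b
    a⊥b = cop-by-∣ λ g g∣a g∣b →
      let g∣s = squareFree-∣ squareFree-15 (odd≢0 (odd-∣ g∣a a-odd)) (∣-≡ (*-∣-* g∣a g∣b) ab≡)
          g∣r = ∣-≡ (∣-lin 1# (# 9) (∣-≡ (∣-+ g∣a g∣b) a+b≡) g∣s) (eq₁ r s)
      in cop-gcd r⊥s g g∣r g∣s
      where
      eq₁ = solve 2 (λ r s → :# 1 :* (r :- :# 9 :* s) :+ :# 9 :* s := r) refl
    go : SquareSplitting 3-λ-λ a b s → _ → Forms₁₅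
    go (d , d′ , d∈ , h , h′ , t , w , hh′ , a≡ , b≡ , tw≡s) (v , v′ , ρ , n , vv′ , r≡ , s≡ , n-odd) = d , d′ , d∈
        , record
      { t = t ; w = v′ * w ; m = ρ ; n = v′ * n ; U = v′ * h ; U′ = v * h′
      ; t-odd = odd-∣ t∣a a-odd
      ; n-odd = odd-* (odd-∣ v′∣1 (0# , refl)) n-odd
      ; t⊥w = cop-* (cop-sym (cop-∣ (cop-sym cop-1) v′∣1)) (cop-∣₂ a⊥b t∣a w∣b)
      ; UU′≡1 = lin₂ (h * h′) 1# vv′ hh′ (eq₁ v v′ h h′)
      ; tw≡ = lin₂ v′ v′ tw≡s s≡ (eq₂ t w s v′ k (Q j) n)
      ; equation = equation′ }
      where
      t∣a : t ∣ a
      t∣a = ∣-scaled-square {d = d} {h} a≡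
      w∣b : w ∣ b
      w∣b = ∣-scaled-square {d = d′} {h′} b≡
      v′∣1 : v′ ∣ 1#
      v′∣1 = v , sym vv′
      eq₁ = solve 4 (λ v v′ h h′ → v′ :* h :* (v :* h′) :- :# 1
        := h :* h′ :* (v :* v′ :- :# 1) :+ :# 1 :* (h :* h′ :- :# 1)) refl
      eq₂ = solve 7 (λ t w s v k q n → t :* (v :* w) :- k :* :π :* (:π :* (q :* (v :* n))) :²
        := v :* (t :* w :- s) :+ v :* (s :- v :* (k :* :π :* (:π :* (q :* n)) :²))) refl
      equation′ : ρ ² ≡ d * (v′ * h) * t ² + # 9 * (t * (v′ * w)) + d′ * (v * h′) * (v′ * w) ²
      equation′ = lin₂ v′ (- (ρ ² + v′ * (d′ * (h′ * w ²)))) step vv′ (eq₃ ρ d v v′ h h′ t w d′)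
        where
        A B : ℤ[i]
        A = d * (h * t ²)
        B = d′ * (h′ * w ²)
        step : v * ρ ² ≡ A + B + # 9 * (t * w)
        step = trans (trans (sym r≡) (lin₃ (- 1#) 1# 1# a+b≡ a≡ b≡ (eq a b r s A B)))
            (cong (λ z → A + B + # 9 * z) (sym tw≡s))
          where
          eq = solve 6 (λ a b r s A B → r :- (A :+ B :+ :# 9 :* s)
            := :- :# 1 :* (a :+ b :- (r :- :# 9 :* s)) :+ :# 1 :* (a :- A) :+ :# 1 :* (b :- B)) refl
        eq₃ = solve 9 (λ ρ d v v′ h h′ t w d′ → ρ :²
            :- (d :* (v′ :* h) :* t :² :+ :# 9 :* (t :* (v′ :* w)) :+ d′ :* (v :* h′) :* (v′ :* w) :²)
          := v′ :* (v :* ρ :² :- (d :* (h :* t :²) :+ d′ :* (h′ :* w :²) :+ :# 9 :* (t :* w)))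
            :+ :- (ρ :² :+ v′ :* (d′ :* (h′ :* w :²))) :* (v :* v′ :- :# 1)) refl

  -- Again by completing the square: (r - 9s)² - m² = (81 - 21) s² = 4 · 15 s².
  form₂₁⇒form₁₅ : Forms₁₅
  form₂₁⇒form₁₅ = go (difference-of-squares (odd+even r-odd (∣-neg (∣-* (# 9) π∣s)))
      (lin₁ (- 1#) equation (eq r s m)))
    where
    eq = solve 3 (λ r s m → (r :- :# 9 :* s) :² :- m :² :- :# 4 :* (:# 15 :* s :²)
      := :- :# 1 :* (m :² :- (r :² :- :# 18 :* (r :* s) :+ :# 21 :* s :²))) refl
    ∣-neg : ∀ {x} → π ∣ x → π ∣ - x
    ∣-neg (q , refl) = - q , eq′ q
      where
      eq′ = solve 1 (λ q → :- (q :* :π) := :- q :* :π) refl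
    go : DifferenceFactors (r - # 9 * s) (# 15 * s ²) → Forms₁₅
    go (_ , _ , a-odd , ab≡ , a+b≡) = from-factors₁₅ a-odd ab≡ a+b≡

-- Local conditions at 3 and at π

¬3∣1 : ¬ # 3 ∣ 1#
¬3∣1 d = from-no (9 ℕ.∣? 1) (N-∣ d)

⟨_,_⟩ : ∀ {m} → Fin m → Fin m → ℤ[i]
⟨ r , s ⟩ = (+ toℕ r) +i (+ toℕ s)

-- The form x² - D y² is anisotropic modulo 3; 9 is the norm of 3. The nonzero squares of 𝔽₉ are the
-- elements of norm 1, whereas a unit times λ₁ or λ₂ has norm 5 ≡ -1.
NonresidueMod3 : ℤ[i] → Set
NonresidueMod3 D = (r s r′ s′ : Fin 3) → ((toℕ r ≡ 0 × toℕ s ≡ 0) × (toℕ r′ ≡ 0 × toℕ s′ ≡ 0)) ⊎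
  ¬ 9 ℕ.∣ N (⟨ r , s ⟩ ² - D * ⟨ r′ , s′ ⟩ ²)

λs : List ℤ[i]
λs = λ₁ ∷ λ₂ ∷ []

nonresidueMod3? : Dec (All (λ ℓ → All (λ U → NonresidueMod3 (ℓ * U)) units) λs)
nonresidueMod3? = All.all? (λ ℓ → All.all? (λ U → Finₚ.all? λ r → Finₚ.all? λ s → Finₚ.all? λ r′ → Finₚ.all? λ s′ →
  ((_ ℕₚ.≟ _ ×-dec _ ℕₚ.≟ _) ×-dec (_ ℕₚ.≟ _ ×-dec _ ℕₚ.≟ _)) ⊎-dec ¬? (_ ℕ.∣? _)) units) λs

nonresidue-mod-3 : ∀ {D m t y} → NonresidueMod3 D → m ² ≡ D * t ² + y * # 3 → # 3 ∣ m × # 3 ∣ t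
nonresidue-mod-3 {D} {m} {t} {y} P h =
  let r , s , w , m≡ = inert-residue 3 m
      r′ , s′ , w′ , t≡ = inert-residue 3 t
  in [ (λ (z , z′) → to-∣ m≡ z , to-∣ t≡ z′)
     , (λ ¬d → ⊥-elim (¬d (N-∣ (- (w * (m + ⟨ r , s ⟩)) + D * w′ * (t + ⟨ r′ , s′ ⟩) + y ,
         lin₃ 1# (- (m + ⟨ r , s ⟩)) (D * (t + ⟨ r′ , s′ ⟩)) h m≡ t≡ (eq m t w w′ D y ⟨ r , s ⟩ ⟨ r′ , s′ ⟩))))) ]′
             (P r s r′ s′)
  where
  eq = solve 8 (λ m t w w′ D y a b → a :² :- D :* b :²
      :- (:- (w :* (m :+ a)) :+ D :* w′ :* (t :+ b) :+ y) :* :# 3 := :# 1 :* (m :² :- (D :* t :² :+ y :* :# 3))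
      :+ :- (m :+ a) :* (m :- (a :+ w :* :# 3)) :+ D :* (t :+ b) :* (t :- (b :+ w′ :* :# 3))) refl
  to-∣ : ∀ {r s : Fin 3} {w x} → x ≡ ⟨ r , s ⟩ + w * # 3 → toℕ r ≡ 0 × toℕ s ≡ 0 → # 3 ∣ x
  to-∣ {w = w} e (r≡0 , s≡0) = w , trans e (trans (cong₂ (λ r s → (+ r) +i (+ s) + w * # 3) r≡0 s≡0)
      (+-identityˡ (w * # 3)))

3⊥λU : ∀ {ℓ U} → ℓ ∈ λs → U ∈ units → Coprime (# 3) (ℓ * U)
3⊥λU {ℓ} {U} ℓ∈ U∈ = [ (λ d → ⊥-elim (All.lookup (All.lookup (from-yes table?) ℓ∈) U∈ (N-∣ d))) , (λ c → c) ]′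
    (3-prime (ℓ * U))
  where
  table? : Dec (All (λ ℓ → All (λ U → ¬ 9 ℕ.∣ N (ℓ * U)) units) λs)
  table? = All.all? (λ ℓ → All.all? (λ U → ¬? (_ ℕ.∣? _)) units) λs

-- Modulo 3 the equation reads m² ≡ ℓ U t² with a nonsquare factor, so 3 divides m and t. Then 3 ℓ′
-- U′ w² is divisible by 9, so 3 ∣ w as well.
exclude-λ : ∀ {ℓ ℓ′ U U′ m t w} → ℓ ∈ λs → ℓ′ ∈ λs → U ∈ units → U′ ∈ units → Coprime t w →
            m ² ≡ ℓ * U * t ² + # 9 * (t * w) + # 3 * ℓ′ * U′ * w ² → ⊥
exclude-λ {ℓ} {ℓ′} {U} {U′} {m} {t} {w} ℓ∈ ℓ′∈ U∈ U′∈ t⊥w h =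
  let 3∣m , 3∣t = nonresidue-mod-3 (All.lookup (All.lookup (from-yes nonresidueMod3?) ℓ∈) U∈)
                    (trans h (eq (ℓ * U) t w ℓ′ U′))
  in ¬3∣1 (cop-gcd t⊥w (# 3) 3∣t (3∣w 3∣m 3∣t))
  where
  eq = solve 5 (λ D t w ℓ U → D :* t :² :+ :# 9 :* (t :* w) :+ :# 3 :* ℓ :* U :* w :²
    := D :* t :² :+ (:# 3 :* (t :* w) :+ ℓ :* U :* w :²) :* :# 3) refl
  3∣w : # 3 ∣ m → # 3 ∣ t → # 3 ∣ w
  3∣w (m′ , refl) (t′ , refl) = prime-∣² 3-prime w (cop-∣* (3⊥λU ℓ′∈ U′∈) (m′ ² - ℓ * U * t′ ² - # 3 * t′ * w
    , *-cancelˡ (# 3) (λ ()) (lin₁ (- 1#) h (eq′ (ℓ * U) t′ w ℓ′ U′ m′))))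
    where
    eq′ = solve 6 (λ D t w ℓ U m → :# 3 :* (ℓ :* U :* w :²)
        :- :# 3 :* ((m :² :- D :* t :² :- :# 3 :* t :* w) :* :# 3) := :- :# 1
        :* ((m :* :# 3) :² :- (D :* (t :* :# 3) :² :+ :# 9 :* (t :* :# 3 :* w) :+ :# 3 :* ℓ :* U :* w :²))) refl

-- The last term is divisible by π⁶. In the middle term 9 t w is odd, so it is a unit u modulo 2π
-- and contributes π³ u modulo 4π.
shallow-residues : ∀ {m t w D D′} → Odd m → Odd t → Odd w →
  m ² ≡ D * t ² + # 9 * (t * (w * (π * π * π))) + D′ * (w * (π * π * π)) ² →
  ∃₂ λ ε ε′ → ∃ λ u → ε ∈ signs × ε′ ∈ signs × u ∈ units × # 4 * π ∣ ε - D * ε′ - π * π * π * u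
shallow-residues {m} {t} {w} {D} {D′} m-odd t-odd w-odd h =
  let ε , y , ε∈ , e₁ = odd-square m-odd
      ε′ , y′ , ε′∈ , e₂ = odd-square t-odd
      u , v , u∈ , e₃ = odd-unit (odd-* (odd-* {# 9} (# 4 * (1# - I) , refl) t-odd) w-odd)
  in ε , ε′ , u , ε∈ , ε′∈ , u∈ , - (1# + I) * D′ * w * w - y + D * y′ + (I - 1#) * v ,
     lin₄ 1# (- 1#) D (π * π * π) h e₁ e₂ e₃ (eq m t w D D′ ε ε′ u y y′ v)
  where
  eq = solve 11 (λ m t w D D′ ε ε′ u y y′ v → ε :- D :* ε′ :- :π :² :* :π :* u
      :- (:- (:# 1 :+ :I) :* D′ :* w :* w :- y :+ D :* y′ :+ (:I :- :# 1) :* v) :* (:# 4 :* :π)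
    := :# 1 :* (m :² :- (D :* t :² :+ :# 9 :* (t :* (w :* (:π :² :* :π))) :+ D′ :* (w :* (:π :² :* :π)) :²))
      :+ :- :# 1 :* (m :² :- (ε :+ :# 4 :* :π :* y)) :+ D :* (t :² :- (ε′ :+ :# 4 :* :π :* y′))
      :+ :π :² :* :π :* (:# 9 :* t :* w :- (u :+ :# 2 :* :π :* v))) refl

module _ {k : ℤ[i]} {j : ℕ} {d d′ : ℤ[i]} (sc : Scale k) (f : Form₁₅ k j d d′) where
  open Form₁₅ f

  U∈ : U ∈ units
  U∈ = unit-∈ (U′ , trans (sym UU′≡1) (*-comm U U′))

  U′∈ : U′ ∈ units
  U′∈ = unit-∈ (U , sym UU′≡1)

  -- As t is odd, w carries all 3 + 4j factors π of t w, and no more because k and n are odd.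
  w-shape : ∃ λ w₀ → w ≡ w₀ * (π * π * π * (Q j * Q j)) × t * w₀ ≡ k * n ² × Odd w₀
  w-shape = go (cop-∣* (cop-sym (cop-* (cop-* (cop-* π⊥ π⊥) π⊥) (cop-* Q⊥ Q⊥)))
      (k * n ² , trans tw≡ (eq k (Q j) n)))
    where
    π⊥ = cop-sym (odd⇒cop t-odd)
    Q⊥ = cop-Q j t-odd
    eq = solve 3 (λ k q n → k :* :π :* (:π :* (q :* n)) :² := k :* n :² :* (:π :² :* :π :* q :²)) refl
    go : π * π * π * (Q j * Q j) ∣ w → _
    go (w₀ , w≡) = w₀ , w≡ , tw₀≡ , odd-∣ (t , sym tw₀≡) (odd-* (scale-odd sc) (odd-* n-odd n-odd))
      where
      eq′ = solve 6 (λ t w w₀ k q n → :π :² :* :π :* (t :* w₀) :* q :² :- :π :² :* :π :* (k :* n :²) :* q :²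
        := :# 1 :* (t :* w :- k :* :π :* (:π :* (q :* n)) :²)
          :+ :- t :* (w :- w₀ :* (:π :² :* :π :* q :²))) refl
      Q²≢0 : ¬ Q j * Q j ≡ 0#
      Q²≢0 h = [ Q≢0 j , Q≢0 j ]′ (x*y≡0 (Q j) (Q j) h)
      tw₀≡ : t * w₀ ≡ k * n ²
      tw₀≡ = *-cancelˡ (π * π * π) (λ ()) (*-cancelˡ (Q j * Q j) Q²≢0
        (trans (*-comm (Q j * Q j) _) (trans (lin₂ 1# (- t) tw≡ w≡ (eq′ t w w₀ k (Q j) n)) (*-comm _ (Q j * Q j)))))

  π∣w : π ∣ w
  π∣w = let w₀ , w≡ , _ = w-shape in w₀ * (π * π * (Q j * Q j)) , trans w≡ (eq w₀ (Q j * Q j))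
    where
    eq = solve 2 (λ w q → w :* (:π :² :* :π :* q) := w :* (:π :² :* q) :* :π) refl

  m-odd : Odd d → Odd m
  m-odd d-odd = odd-∣ (m , refl) (subst Odd (sym equation) (subst Odd (eq d U t w d′ U′)
      (odd+even (odd-* (odd-* d-odd U-odd) (odd-* t-odd t-odd)) (∣-* (# 9 * t + d′ * U′ * w) π∣w))))
    where
    U-odd : Odd U
    U-odd = odd-∣ (U′ , trans (sym UU′≡1) (*-comm U U′)) (0# , refl)
    eq = solve 6 (λ d U t w d′ U′ → d :* U :* t :² :+ (:# 9 :* t :+ d′ :* U′ :* w) :* w
      := d :* U :* t :² :+ :# 9 :* (t :* w) :+ d′ :* U′ :* w :²) refl

  residues-mod-4π : Odd d → # 4 * π ∣ w → ∃₂ λ ε ε′ → ε ∈ signs × ε′ ∈ signs × # 4 * π ∣ ε - d * U * ε′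
  residues-mod-4π d-odd (z , w≡) = odd-squares-mod (d * U) (m-odd d-odd) t-odd (1# , sym (*-identityˡ _))
    ((# 9 * t + d′ * U′ * w) * z , lin₂ 1# (# 9 * t + d′ * U′ * w) equation w≡ (eq m d U t w d′ U′ z))
    where
    eq = solve 8 (λ m d U t w d′ U′ z → m :²
        :- d :* U :* t :² :- (:# 9 :* t :+ d′ :* U′ :* w) :* z :* (:# 4 :* :π)
      := :# 1 :* (m :² :- (d :* U :* t :² :+ :# 9 :* (t :* w) :+ d′ :* U′ :* w :²))
        :+ (:# 9 :* t :+ d′ :* U′ :* w) :* (w :- z :* (:# 4 :* :π))) refl

record Deep (k : ℤ[i]) (j : ℕ) (d d′ : ℤ[i]) : Set where
  field
    {t w m n} : ℤ[i]
    t-odd    : Odd t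
    n-odd    : Odd n
    t⊥w      : Coprime t w
    tw≡      : t * w ≡ k * π * (π * (Q j * n)) ²
    equation : m ² ≡ d * t ² + # 9 * (t * w) + d′ * w ²

-- For U = -1 the equation is multiplied by -1 = i², with m ↦ im, w ↦ -w and n ↦ in.
normalise : ∀ {k j d d′} (f : Form₁₅ k j d d′) → Form₁₅.U f ∈ signs → Deep k j d d′
normalise {k} {j} {d} {d′} f U∈ = go U∈ refl
  where
  open Form₁₅ f
  go : ∀ {u} → u ∈ signs → U ≡ u → Deep k j d d′
  go (here refl) U≡ = record
    { t-odd = t-odd ; n-odd = n-odd ; t⊥w = t⊥w ; tw≡ = tw≡
    ; equation = lin₃ 1# (d * t ² - d′ * U′ * w ²) (d′ * w ²) equation U≡ UU′≡1 (eq m d U t w d′ U′) }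
    where
    eq = solve 7 (λ m d U t w d′ U′ → m :² :- (d :* t :² :+ :# 9 :* (t :* w) :+ d′ :* w :²)
      := :# 1 :* (m :² :- (d :* U :* t :² :+ :# 9 :* (t :* w) :+ d′ :* U′ :* w :²))
        :+ (d :* t :² :- d′ :* U′ :* w :²) :* (U :- :# 1) :+ d′ :* w :² :* (U :* U′ :- :# 1)) refl
  go (there (here refl)) U≡ = record
    { t = t ; w = - w ; m = I * m ; n = I * n ; t-odd = t-odd ; n-odd = odd-* (I , refl) n-odd
    ; t⊥w = cop-sym (cop-∣ (cop-sym t⊥w) (- 1# , eq₁ w))
    ; tw≡ = lin₁ (- 1#) tw≡ (eq₂ t w k (Q j) n)
    ; equation = lin₃ (- 1#) (- (d * t ²) - d′ * U′ * w ²) (d′ * w ²) equation U≡ UU′≡1 (eq₃ m d U t w d′ U′) }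
    where
    eq₁ = solve 1 (λ w → w := :- :# 1 :* :- w) refl
    eq₂ = solve 5 (λ t w k q n → t :* :- w :- k :* :π :* (:π :* (q :* (:I :* n))) :²
      := :- :# 1 :* (t :* w :- k :* :π :* (:π :* (q :* n)) :²)) refl
    eq₃ = solve 7 (λ m d U t w d′ U′ → (:I :* m) :² :- (d :* t :² :+ :# 9 :* (t :* :- w) :+ d′ :* (:- w) :²)
      := :- :# 1 :* (m :² :- (d :* U :* t :² :+ :# 9 :* (t :* w) :+ d′ :* U′ :* w :²))
        :+ (:- (d :* t :²) :- d′ :* U′ :* w :²) :* (U :- :- :# 1) :+ d′ :* w :² :* (U :* U′ :- :# 1)) refl

module _ {k : ℤ[i]} {j : ℕ} {d d′ : ℤ[i]} (x : Deep k j d d′) where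
  open Deep x

  3∣tw : k ≡ # 3 → # 3 ∣ t * w
  3∣tw refl = π * (π * (Q j * n)) ² , trans tw≡ (eq _)
    where
    eq = solve 1 (λ y → :# 3 :* :π :* y := :π :* y :* :# 3) refl

-- The coefficient 15 decides where the factor 3 goes: 3 ∣ w would give 3 ∣ m, then 9 ∣ 15 t² and 3
-- ∣ t, against t ⊥ w. In `scale∣w` the roles are exchanged.
scale∣t : ∀ {k j} → Scale k → (x : Deep k j (# 15) 1#) → k ∣ Deep.t x
scale∣t one   x = Deep.t x , eq (Deep.t x)
  where
  eq = solve 1 (λ t → t := t :* :# 1) refl
scale∣t three x = [ (λ d → d) , (λ d → ⊥-elim (¬3∣1 (cop-gcd t⊥w (# 3) (3∣t d) d))) ]′
    (prime-∣* 3-prime t w (3∣tw x refl))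
  where
  open Deep x
  3∣t : # 3 ∣ w → # 3 ∣ t
  3∣t (w′ , e) = go (prime-∣² 3-prime m (# 5 * t ² + # 3 * t * w + w * w′ , lin₂ 1# w equation e (eq m t w w′)))
    where
    eq = solve 4 (λ m t w w′ → m :² :- (:# 5 :* t :² :+ :# 3 :* t :* w :+ w :* w′) :* :# 3
      := :# 1 :* (m :² :- (:# 15 :* t :² :+ :# 9 :* (t :* w) :+ :# 1 :* w :²)) :+ w :* (w :- w′ :* :# 3)) refl
    go : # 3 ∣ m → # 3 ∣ t
    go (m′ , e′) = prime-∣² 3-prime t (cop-∣* {# 3} {# 5} (# 2 , - 1# , refl) (m′ ² - # 3 * t * w′ - w′ ² ,
      *-cancelˡ (# 3) (λ ()) (lin₃ (- 1#) (m + m′ * # 3) (- # 9 * t - (w + w′ * # 3)) equation e′ e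
          (eq′ m t w m′ w′))))
      where
      eq′ = solve 5 (λ m t w m′ w′ → :# 3 :* (:# 5 :* t :²)
          :- :# 3 :* ((m′ :² :- :# 3 :* t :* w′ :- w′ :²) :* :# 3)
        := :- :# 1 :* (m :² :- (:# 15 :* t :² :+ :# 9 :* (t :* w) :+ :# 1 :* w :²)) :+ (m :+ m′ :* :# 3)
          :* (m :- m′ :* :# 3) :+ (:- :# 9 :* t :- (w :+ w′ :* :# 3)) :* (w :- w′ :* :# 3)) refl

scale∣w : ∀ {k j} → Scale k → (x : Deep k j 1# (# 15)) → k ∣ Deep.w x
scale∣w one   x = Deep.w x , eq (Deep.w x)
  where
  eq = solve 1 (λ t → t := t :* :# 1) refl
scale∣w three x = [ (λ d → ⊥-elim (¬3∣1 (cop-gcd t⊥w (# 3) d (3∣w d)))) , (λ d → d) ]′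
    (prime-∣* 3-prime t w (3∣tw x refl))
  where
  open Deep x
  3∣w : # 3 ∣ t → # 3 ∣ w
  3∣w (t′ , e) = go (prime-∣² 3-prime m (t * t′ + # 3 * t * w + # 5 * w ² , lin₂ 1# t equation e (eq m t w t′)))
    where
    eq = solve 4 (λ m t w t′ → m :² :- (t :* t′ :+ :# 3 :* t :* w :+ :# 5 :* w :²) :* :# 3
      := :# 1 :* (m :² :- (:# 1 :* t :² :+ :# 9 :* (t :* w) :+ :# 15 :* w :²)) :+ t :* (t :- t′ :* :# 3)) refl
    go : # 3 ∣ m → # 3 ∣ w
    go (m′ , e′) = prime-∣² 3-prime w (cop-∣* {# 3} {# 5} (# 2 , - 1# , refl) (m′ ² - # 3 * t′ * w - t′ ² ,
      *-cancelˡ (# 3) (λ ()) (lin₃ (- 1#) (m + m′ * # 3) (- # 9 * w - (t + t′ * # 3)) equation e′ e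
          (eq′ m t w m′ t′))))
      where
      eq′ = solve 5 (λ m t w m′ t′ → :# 3 :* (:# 5 :* w :²)
          :- :# 3 :* ((m′ :² :- :# 3 :* t′ :* w :- t′ :²) :* :# 3)
        := :- :# 1 :* (m :² :- (:# 1 :* t :² :+ :# 9 :* (t :* w) :+ :# 15 :* w :²)) :+ (m :+ m′ :* :# 3)
          :* (m :- m′ :* :# 3) :+ (:- :# 9 :* w :- (t :+ t′ :* :# 3)) :* (t :- t′ :* :# 3)) refl

-- t is odd and t w = k π (π Q n)², so π⁵ divides w.
deep-w : ∀ {k j d d′} (x : Deep k (suc j) d d′) → ∃ λ w₁ → Deep.w x ≡ w₁ * # 4 × π ∣ w₁
deep-w {k} {j} x = go (cop-∣* {π * π * π * π * π} (cop-sym (cop-* (cop-* (cop-* (cop-* π⊥ π⊥) π⊥) π⊥) π⊥))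
    (k * π * π * (Q j * n) ² , trans tw≡ (eq k (Q j) n)))
  where
  open Deep x
  π⊥ = cop-sym (odd⇒cop t-odd)
  eq = solve 3 (λ k q n → k :* :π :* (:π :* (:π :² :* q :* n)) :²
    := k :* :π :* :π :* (q :* n) :² :* (:π :² :* :π :* :π :* :π)) refl
  go : π * π * π * π * π ∣ w → ∃ λ w₁ → w ≡ w₁ * # 4 × π ∣ w₁
  go (v , w≡) = - v * π , trans w≡ (eq′ v) , (- v , refl)
    where
    eq′ = solve 1 (λ v → v :* (:π :² :* :π :* :π :* :π) := :- v :* :π :* :# 4) refl

-- The two congruences modulo 4 to which `Exclude-15` leads; 16 is the norm of 4. The units stand
-- for h v ε and for the residues of κ and q.
4∤combination : List (ℤ[i] × ℤ[i]) → Set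
4∤combination = All λ (c , _) → All (λ k → All (λ x → All (λ u → All (λ v →
  ¬ 16 ℕ.∣ N (u * u + v * v) ⊎ ¬ 16 ℕ.∣ N (c * k * x - # 9 * v * v - # 2 * u * v)) units) units) units)
      (1# ∷ # 3 ∷ [])

4∤combination? : Dec (4∤combination (splittings 3-7))
4∤combination? = All.all? (λ (c , _) → All.all? (λ k → All.all? (λ x → All.all? (λ u → All.all? (λ v →
  ¬? (_ ℕ.∣? _) ⊎-dec ¬? (_ ℕ.∣? _)) units) units) units) (1# ∷ # 3 ∷ [])) (splittings 3-7)

scale-∈ : ∀ {k} → Scale k → k ∈ (1# ∷ # 3 ∷ [])
scale-∈ one   = here refl
scale-∈ three = there (here refl)

cc′≡21 : ∀ {c c′} → (c , c′) ∈ splittings 3-7 → c * c′ ≡ # 21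
cc′≡21 = All.lookup {P = λ (c , c′) → c * c′ ≡ # 21} (refl ∷ refl ∷ refl ∷ refl ∷ [])

sign-∣1 : ∀ {ε} → ε ∈ signs → ε ∣ 1#
sign-∣1 (here refl)         = 1# , refl
sign-∣1 (there (here refl)) = - 1# , refl

-- Since 15 ≡ -1 modulo 16, this class survives the test modulo 4π. A further factorisation excludes
-- it: 21 t² = (2w + 9t)² - 4m², together with the fact that t is k times a unit times a square.
module Exclude-15 {k : ℤ[i]} {j : ℕ} (sc : Scale k) (x : Deep k (suc j) (# 15) 1#) where
  open Deep x

  -- After division by k and π, the coprime cofactors of t and w have a square product.
  t-shape : ∃₂ λ v g → v ∣ 1# × t ≡ k * (v * g ²)
  t-shape = go (scale∣t sc x)
    where
    k≢0 : ¬ k ≡ 0#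
    k≢0 = odd≢0 (scale-odd sc)
    go : k ∣ t → ∃₂ λ v g → v ∣ 1# × t ≡ k * (v * g ²)
    go (t₁ , t≡) = go₂ (cop-∣* (odd⇒cop t₁-odd) (z , trans t₁w≡ (*-comm π z)))
      where
      z = (π * (Q (suc j) * n)) ²
      t₁-odd : Odd t₁
      t₁-odd = odd-∣ (k , trans t≡ (*-comm t₁ k)) t-odd
      t₁w≡ : t₁ * w ≡ π * z
      t₁w≡ = *-cancelˡ k k≢0 (lin₂ 1# (- w) tw≡ t≡ (eq k t₁ w t z))
        where
        eq = solve 5 (λ k t₁ w t z → k :* (t₁ :* w) :- k :* (:π :* z)
          := :# 1 :* (t :* w :- k :* :π :* z) :+ :- w :* (t :- t₁ :* k)) refl
      go₂ : π ∣ w → ∃₂ λ v g → v ∣ 1# × t ≡ k * (v * g ²)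
      go₂ (w₂ , w≡) = go₃ (coprime-square (odd≢0 t₁-odd)
          (cop-∣₂ t⊥w (k , trans t≡ (*-comm t₁ k)) (π , trans w≡ (*-comm w₂ π)))
          (*-cancelˡ π (λ ()) (lin₂ 1# (- t₁) t₁w≡ w≡ (eq t₁ w₂ w (π * (Q (suc j) * n))))))
        where
        eq = solve 4 (λ t w₂ w y → :π :* (t :* w₂) :- :π :* y :²
          := :# 1 :* (t :* w :- :π :* y :²) :+ :- t :* (w :- w₂ :* :π)) refl
        go₃ : SquareFactors t₁ w₂ (π * (Q (suc j) * n)) → ∃₂ λ v g → v ∣ 1# × t ≡ k * (v * g ²)
        go₃ (v , v′ , g , _ , vv′ , t₁≡ , _) = v , g , (v′ , trans (sym vv′) (*-comm v v′)) , trans t≡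
            (trans (*-comm t₁ k) (cong (k *_) t₁≡))

  F⁺ F⁻ : ℤ[i]
  F⁺ = # 2 * w + # 9 * t + # 2 * m
  F⁻ = # 2 * w + # 9 * t - # 2 * m

  F⁺-odd : Odd F⁺
  F⁺-odd = subst Odd (eq w t m) (odd+even (odd-* {# 9} (# 4 * (1# - I) , refl) t-odd) ((1# - I) * (w + m) , refl))
    where
    eq = solve 3 (λ w t m → :# 9 :* t :+ (:# 1 :- :I) :* (w :+ m) :* :π
      := :# 2 :* w :+ :# 9 :* t :+ :# 2 :* m) refl

  F⁺F⁻≡ : F⁺ * F⁻ ≡ # 21 * t ²
  F⁺F⁻≡ = lin₁ (- # 4) equation (eq w t m)
    where
    eq = solve 3 (λ w t m → (:# 2 :* w :+ :# 9 :* t :+ :# 2 :* m) :* (:# 2 :* w :+ :# 9 :* t :- :# 2 :* m)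
        :- :# 21 :* t :² := :- :# 4 :* (m :² :- (:# 15 :* t :² :+ :# 9 :* (t :* w) :+ :# 1 :* w :²))) refl

  F⁺⊥F⁻ : Coprime F⁺ F⁻
  F⁺⊥F⁻ = cop-by-∣ λ g g∣F⁺ g∣F⁻ →
    let g-odd = odd-∣ g∣F⁺ F⁺-odd
        π⊥ = cop-sym (odd⇒cop g-odd)
        g∣t = squareFree-∣ squareFree-21 (odd≢0 g-odd) (∣-≡ (*-∣-* g∣F⁺ g∣F⁻) F⁺F⁻≡)
        g∣4w = ∣-≡ (∣-lin 1# (- # 18) (∣-lin 1# 1# g∣F⁺ g∣F⁻) g∣t) (eq w t m)
    in cop-gcd t⊥w g g∣t (cop-∣* (cop-* (cop-* π⊥ π⊥) (cop-* π⊥ π⊥)) (∣-trans g∣4w (- 1# , eq′ w)))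
    where
    eq = solve 3 (λ w t m → :# 1 :* (:# 1 :* (:# 2 :* w :+ :# 9 :* t :+ :# 2 :* m)
          :+ :# 1 :* (:# 2 :* w :+ :# 9 :* t :- :# 2 :* m)) :+ :- :# 18 :* t := :# 4 :* w) refl
    eq′ = solve 1 (λ w → :π :² :² :* w := :- :# 1 :* (:# 4 :* w)) refl

  exclude : ⊥
  exclude = go (square-split (3-factor ∷ 7-factor ∷ []) (odd≢0 F⁺-odd) F⁺⊥F⁻ F⁺F⁻≡) t-shape (deep-w x)
    where
    go : SquareSplitting 3-7 F⁺ F⁻ t → _ → (∃ λ w₁ → w ≡ w₁ * # 4 × π ∣ w₁) → ⊥
    go (c , c′ , c∈ , h , h′ , p , q , hh′ , F⁺≡ , F⁻≡ , pq≡) (v , g , v∣1 , t≡) (w₁ , w≡ , π∣w₁) =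
      finish (squareFree-∣ {g = # 2} squareFree-1 (λ ()) (# 15 * q ² + h * c * w , Y²≡))
      where
      -- Completes the square in c h p² - 18 p q + c′ h′ q² = 4w after multiplication by h c: as 81
      -- - 21 = 60, Y² = 4 (15 q² + h c w).
      Y : ℤ[i]
      Y = h * c * p - # 9 * q
      sum≡ : c * (h * p ²) + c′ * (h′ * q ²) ≡ # 4 * w + # 18 * (p * q)
      sum≡ = lin₃ (- 1#) (- 1#) (- # 18) F⁺≡ F⁻≡ pq≡ (eq w t m _ _ (p * q))
        where
        eq = solve 6 (λ w t m a b z → a :+ b :- (:# 4 :* w :+ :# 18 :* z)
          := :- :# 1 :* (:# 2 :* w :+ :# 9 :* t :+ :# 2 :* m :- a)
            :+ :- :# 1 :* (:# 2 :* w :+ :# 9 :* t :- :# 2 :* m :- b) :+ :- :# 18 :* (z :- t)) refl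
      Y²≡ : 1# * Y ² ≡ (# 15 * q ² + h * c * w) * # 2 ²
      Y²≡ = lin₃ (h * c) (- (c * c′ * q ²)) (- (q ²)) sum≡ hh′ (cc′≡21 c∈) (eq h c p q c′ h′ w)
        where
        eq = solve 7 (λ h c p q c′ h′ w → :# 1 :* (h :* c :* p :- :# 9 :* q) :²
            :- (:# 15 :* q :² :+ h :* c :* w) :* (:# 2) :²
          := h :* c :* (c :* (h :* p :²) :+ c′ :* (h′ :* q :²) :- (:# 4 :* w :+ :# 18 :* (p :* q)))
            :+ :- (c :* c′ :* q :²) :* (h :* h′ :- :# 1) :+ :- q :² :* (c :* c′ :- :# 21)) refl
      finish : # 2 ∣ Y → ⊥
      finish (κ , Y≡) = contra (odd-unit κ-odd) (odd-unit q-odd) (odd-square g-odd)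
        where
        q-odd : Odd q
        q-odd = odd-∣ (p , sym pq≡) t-odd
        g-odd : Odd g
        g-odd = odd-∣ (k * v * g , trans t≡ (eq k v g)) t-odd
          where
          eq = solve 3 (λ k v g → k :* (v :* g :²) := k :* v :* g :* g) refl
        κ²≡ : κ ² ≡ # 15 * q ² + h * c * w
        κ²≡ = *-cancelˡ (# 4) (λ ()) (lin₂ 1# (- (Y + κ * # 2)) Y²≡ Y≡ (eq κ (h * c) w q Y))
          where
          eq = solve 5 (λ κ a w q Y → :# 4 :* κ :² :- :# 4 :* (:# 15 :* q :² :+ a :* w)
            := :# 1 :* (:# 1 :* Y :² :- (:# 15 :* q :² :+ a :* w) :* (:# 2) :²)
              :+ :- (Y :+ κ :* :# 2) :* (Y :- κ :* :# 2)) refl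
        κ-odd : Odd κ
        κ-odd = odd-∣ (κ , refl) (subst Odd (sym κ²≡) (odd+even
            (odd-* {# 15} (# 7 * (1# - I) , refl) (odd-* q-odd q-odd))
          (∣-* (h * c) (∣-trans π∣w₁ (# 4 , trans w≡ (*-comm w₁ (# 4)))))))
        -- Modulo 4 the term w vanishes. So κ² ≡ 15 q² ≡ -q², and h c t = (9q + 2κ) q with t = k v
        -- g² and g² ≡ ε. Replacing κ and q by units leaves finitely many cases.
        contra : (∃₂ λ u y → u ∈ units × κ ≡ u + # 2 * π * y) → (∃₂ λ u y → u ∈ units × q ≡ u + # 2 * π * y) →
                 (∃₂ λ ε y → ε ∈ signs × g ² ≡ ε + # 4 * π * y) → ⊥
        contra (u , y , u∈ , κ≡) (u′ , y′ , u′∈ , q≡) (ε , y″ , ε∈ , g²≡) =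
          [ (λ ¬d → ¬d (N-∣ 4∣₁)) , (λ ¬d → ¬d (N-∣ 4∣₂)) ]′
            (All.lookup (All.lookup (All.lookup (All.lookup (All.lookup (from-yes 4∤combination?) c∈) (scale-∈ sc))
                hvε∈) u∈) u′∈)
          where
          h∣1 : h ∣ 1#
          h∣1 = h′ , trans (sym hh′) (*-comm h h′)
          hvε∈ : h * v * ε ∈ units
          hvε∈ = unit-∈ (∣-trans (*-∣-* (*-∣-* h∣1 v∣1) (sign-∣1 ε∈)) (1# , refl))
          4∣₁ : # 4 ∣ u * u + u′ * u′
          4∣₁ = # 4 * u′ * u′ + # 15 * (π * y′ * u′ + π * π * y′ * y′) - (π * y * u + π * π * y * y) + h * c * w₁ ,
            lin₄ 1# (- (κ + u + # 2 * π * y)) (# 15 * (q + u′ + # 2 * π * y′)) (h * c) κ²≡ κ≡ q≡ w≡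
                (eq κ q u u′ y y′ (h * c) w w₁)
            where
            eq = solve 9 (λ κ q u u′ y y′ a w w₁ → u :² :+ u′ :² :- (:# 4 :* u′ :* u′ :+ :# 15 :* (:π
                    :* y′ :* u′ :+ :π :² :* y′ :* y′) :- (:π :* y :* u :+ :π :² :* y :* y) :+ a :* w₁) :* :# 4
              := :# 1 :* (κ :² :- (:# 15 :* q :² :+ a :* w))
                :+ :- (κ :+ u :+ :# 2 :* :π :* y) :* (κ :- (u :+ :# 2 :* :π :* y)) :+ :# 15 :* (q
                  :+ u′ :+ :# 2 :* :π :* y′) :* (q :- (u′ :+ :# 2 :* :π :* y′)) :+ a :* (w :- w₁ :* :# 4)) refl
          key : h * c * (k * (v * g ²)) ≡ (# 9 * q + # 2 * κ) * q
          key = trans (cong (h * c *_) (sym (trans pq≡ t≡))) (lin₁ q Y≡ (eq (h * c) p q κ))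
            where
            eq = solve 4 (λ a p q κ → a :* (p :* q) :- (:# 9 :* q :+ :# 2 :* κ) :* q
              := q :* (a :* p :- :# 9 :* q :- κ :* :# 2)) refl
          A = h * c * k * v
          4∣₂ : # 4 ∣ c * k * (h * v * ε) - # 9 * u′ * u′ - # 2 * u * u′
          4∣₂ = subst (λ z → # 4 ∣ z - # 9 * u′ * u′ - # 2 * u * u′) (eq₁ h c k v ε)
            (# 9 * (π * y′ * u′ + π * π * y′ * y′) + π * y * u′ + π * y′ * u + # 2 * π * π * y * y′ - A * π * y″ ,
            lin₄ 1# (- A) (# 2 * q) (# 9 * (q + u′ + # 2 * π * y′) + # 2 * (u + # 2 * π * y))
                (trans (eq₂ h c k v (g ²)) key) g²≡ κ≡ q≡ (eq A (g ²) q κ ε u u′ y y′ y″))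
            where
            eq₁ = solve 5 (λ h c k v ε → h :* c :* k :* v :* ε := c :* k :* (h :* v :* ε)) refl
            eq₂ = solve 5 (λ h c k v g → h :* c :* k :* v :* g := h :* c :* (k :* (v :* g))) refl
            eq = solve 10 (λ A g² q κ ε u u′ y y′ y″ → A :* ε
                :- :# 9 :* u′ :* u′ :- :# 2 :* u :* u′ :- (:# 9 :* (:π :* y′ :* u′ :+ :π :² :* y′ :* y′)
                  :+ :π :* y :* u′ :+ :π :* y′ :* u :+ :# 2 :* :π :* :π :* y :* y′ :- A :* :π :* y″) :* :# 4
              := :# 1 :* (A :* g² :- (:# 9 :* q :+ :# 2 :* κ) :* q) :+ :- A :* (g² :- (ε :+ :# 4 :* :π :* y″))
                :+ :# 2 :* q :* (κ :- (u :+ :# 2 :* :π :* y)) :+ (:# 9 :* (q :+ u′ :+ :# 2 :* :π :* y′)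
                  :+ :# 2 :* (u :+ :# 2 :* :π :* y)) :* (q :- (u′ :+ :# 2 :* :π :* y′))) refl

module _ {k : ℤ[i]} {j : ℕ} (sc : Scale k) (x : Deep k (suc j) 1# (# 15)) where
  open Deep x

  private
    y : ℤ[i]
    y = π * (Q (suc j) * n)

    -- With t = v g² and w = v′ k π h², the form t² + 9 t w + 15 w² is again a quartic in g and h,
    -- and g becomes the new M.
    quartic : ∀ {w₂} → w ≡ w₂ * π * k → SquareFactors t w₂ y → Quartic k j
    quartic {w₂ = w₂} w≡ (v , v′ , g , h , vv′ , t≡ , w₂≡ , gh≡) =
      go (cop-∣* (cop-sym (cop-* (cop-sym (odd⇒cop g-odd)) (cop-Q (suc j) g-odd)))
          (n , trans gh≡ (eq₀ (Q (suc j)) n)))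
      where
      eq₀ = solve 2 (λ q n → :π :* (q :* n) := n :* (:π :* q)) refl
      g-odd : Odd g
      g-odd = odd-∣ (v * g , trans t≡ (sym (*-assoc v g g))) t-odd
      Z : ℤ[i]
      Z = k * π * h ²
      w≡v′Z : w ≡ v′ * Z
      w≡v′Z = lin₂ 1# (π * k) w≡ w₂≡ (eq w w₂ k v′ h)
        where
        eq = solve 5 (λ w w₂ k v h → w :- v :* (k :* :π :* h :²)
          := :# 1 :* (w :- w₂ :* :π :* k) :+ :π :* k :* (w₂ :- v :* h :²)) refl
      m²≡ : m ² ≡ v ² * g ² ² + # 9 * (g ² * Z) + # 15 * (v′ ² * Z ²)
      m²≡ = lin₄ 1# (t + v * g ² + # 9 * w) (# 9 * v * g ² + # 15 * (w + v′ * Z)) (# 9 * g ² * Z) equation t≡ w≡v′Z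
          vv′ (eq m t w v v′ (g ²) Z)
        where
        eq = solve 7 (λ m t w v v′ G Z → m :² :- (v :² :* G :² :+ :# 9 :* (G :* Z) :+ :# 15 :* (v′ :² :* Z :²))
          := :# 1 :* (m :² :- (:# 1 :* t :² :+ :# 9 :* (t :* w) :+ :# 15 :* w :²))
            :+ (t :+ v :* G :+ :# 9 :* w) :* (t :- v :* G) :+ (:# 9 :* v :* G :+ :# 15 :* (w :+ v′ :* Z))
            :* (w :- v′ :* Z) :+ :# 9 :* G :* Z :* (v :* v′ :- :# 1)) refl
      v′²v²≡1 : v ² * v′ ² ≡ 1#
      v′²v²≡1 = lin₁ (v * v′ + 1#) vv′ (eq v v′)
        where
        eq = solve 2 (λ v v′ → v :² :* v′ :² :- :# 1 := (v :* v′ :+ :# 1) :* (v :* v′ :- :# 1)) refl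
      w₂∣w : w₂ ∣ w
      w₂∣w = π * k , trans w≡ (eq w₂ k)
        where
        eq = solve 2 (λ w k → w :* :π :* k := :π :* k :* w) refl
      go : π * Q (suc j) ∣ h → Quartic k j
      go (z , h≡) = by-sign (unit-square (unit-∈ (v′ , trans (sym vv′) (*-comm v v′)))) refl
        where
        gz≡n : g * z ≡ n
        gz≡n = *-cancelˡ (π * Q (suc j)) (πQ≢0 (suc j)) (lin₂ 1# (- g) gh≡ h≡ (eq (Q (suc j)) g z n h))
          where
          eq = solve 5 (λ q g z n h → :π :* q :* (g :* z) :- :π :* q :* n
            := :# 1 :* (g :* h :- :π :* (q :* n)) :+ :- g :* (h :- z :* (:π :* q))) refl
        z-odd : Odd z
        z-odd = odd-∣ (g , sym gz≡n) n-odd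
        g⊥z : Coprime g z
        g⊥z = cop-∣₂ t⊥w (v * g , trans t≡ (sym (*-assoc v g g)))
          (∣-trans (π * Q (suc j) , trans h≡ (*-comm z _))
              (∣-trans (v′ * h , trans w₂≡ (sym (*-assoc v′ h h))) w₂∣w))
        κ : ℤ[i]
        κ = k * π * (π * (Q j * z)) ²
        -- Here h = z π³ (Q j) and π⁴ = -4, so h² = -4 (π (Q j) z)². This factor turns 9 and 15 into
        -- 36 and 240, and it is the source of the drop from `suc j` to `j`.
        Z≡ : Z ≡ - # 4 * κ
        Z≡ = lin₁ (k * π * (h + z * (π * Q (suc j)))) h≡ (eq k h z (Q j))
          where
          eq = solve 4 (λ k h z q → k :* :π :* h :² :- :- :# 4 :* (k :* :π :* (:π :* (q :* z)) :²)
            := k :* :π :* (h :+ z :* (:π :* (:π :² :* q))) :* (h :- z :* (:π :* (:π :² :* q)))) refl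
        -- Only the sign of v² matters. For v² = 1 the middle term has the wrong sign and κ ↦ -κ,
        -- that is e = iz, repairs it; for v² = -1 the whole equation is multiplied by -1 = i².
        by-sign : ∀ {σ} → σ ∈ signs → v ² ≡ σ → Quartic k j
        by-sign (here refl) v²≡ = record
          { M = g ; e = I * z ; n = m ; κ = - κ ; M-odd = g-odd ; e-odd = odd-* (I , refl) z-odd
          ; M⊥e = cop-* (cop-sym (cop-∣ (cop-sym cop-1) (- I , refl))) g⊥z
          ; κ≡ = eq₁ k (Q j) z
          ; equation = lin₄ 1# (g ² ² - # 15 * v′ ² * Z ²) (# 9 * g ² + # 15 * (Z + - # 4 * κ)) (# 15 * Z ²) m²≡
                v²≡ Z≡ v′²v²≡1 (eq₂ m (v ²) (v′ ²) (g ²) Z κ) }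
          where
          eq₁ = solve 3 (λ k q z → :- (k :* :π :* (:π :* (q :* z)) :²)
            := k :* :π :* (:π :* (q :* (:I :* z))) :²) refl
          eq₂ = solve 6 (λ m V V′ G Z κ → m :² :- (G :² :+ :# 36 :* :- κ :* G :+ :# 240 :* (:- κ) :²)
            := :# 1 :* (m :² :- (V :* G :² :+ :# 9 :* (G :* Z) :+ :# 15 :* (V′ :* Z :²)))
              :+ (G :² :- :# 15 :* V′ :* Z :²) :* (V :- :# 1) :+ (:# 9 :* G :+ :# 15 :* (Z :+ :- :# 4 :* κ))
              :* (Z :- :- :# 4 :* κ) :+ :# 15 :* Z :² :* (V :* V′ :- :# 1)) refl
        by-sign (there (here refl)) v²≡ = record
          { M = g ; e = z ; n = I * m ; κ = κ ; M-odd = g-odd ; e-odd = z-odd ; M⊥e = g⊥z ; κ≡ = refl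
          ; equation = lin₄ (- 1#) (- g ² ² - # 15 * v′ ² * Z ²) (- # 9 * g ² + # 15 * (Z + - # 4 * κ))
                (# 15 * Z ²) m²≡ v²≡ Z≡ v′²v²≡1 (eq₂ m (v ²) (v′ ²) (g ²) Z κ) }
          where
          eq₂ = solve 6 (λ m V V′ G Z κ → (:I :* m) :² :- (G :² :+ :# 36 :* κ :* G :+ :# 240 :* κ :²)
            := :- :# 1 :* (m :² :- (V :* G :² :+ :# 9 :* (G :* Z) :+ :# 15 :* (V′ :* Z :²)))
              :+ (:- G :² :- :# 15 :* V′ :* Z :²) :* (V :- :- :# 1) :+ (:- :# 9 :* G :+ :# 15
                :* (Z :+ :- :# 4 :* κ)) :* (Z :- :- :# 4 :* κ) :+ :# 15 :* Z :² :* (V :* V′ :- :# 1)) refl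

  deep⇒quartic : Quartic k j
  deep⇒quartic = from-scale (scale∣w sc x)
    where
    from-scale : k ∣ w → Quartic k j
    from-scale (w₁ , w≡) = from-π (cop-∣* (odd⇒cop t-odd) (y ² , trans tw₁≡ (*-comm π _)))
      where
      tw₁≡ : t * w₁ ≡ π * y ²
      tw₁≡ = *-cancelˡ k (odd≢0 (scale-odd sc)) (lin₂ 1# (- t) tw≡ w≡ (eq k w₁ w t (y ²)))
        where
        eq = solve 5 (λ k w₁ w t z → k :* (t :* w₁) :- k :* (:π :* z)
          := :# 1 :* (t :* w :- k :* :π :* z) :+ :- t :* (w :- w₁ :* k)) refl
      from-π : π ∣ w₁ → Quartic k j
      from-π (w₂ , w₁≡) = quartic w≡′ (coprime-square (odd≢0 t-odd)
          (cop-∣₂ t⊥w ∣-refl (π * k , trans w≡′ (eq₂ w₂ k)))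
        (*-cancelˡ π (λ ()) (lin₂ 1# (- t) tw₁≡ w₁≡ (eq₁ t w₂ w₁ y))))
        where
        eq₁ = solve 4 (λ t w₂ w y → :π :* (t :* w₂) :- :π :* y :²
          := :# 1 :* (t :* w :- :π :* y :²) :+ :- t :* (w :- w₂ :* :π)) refl
        eq₂ = solve 2 (λ w k → w :* :π :* k := :π :* k :* w) refl
        w≡′ : w ≡ w₂ * π * k
        w≡′ = trans w≡ (cong (_* k) w₁≡)

-- d U is congruent to a quotient of odd squares modulo 4 π, so d U = ± 1 or ± 15.
module _ {k : ℤ[i]} {j : ℕ} (sc : Scale k) where

  exclude-deep : ∀ {d d′} (f : Form₁₅ k (suc j) d d′) → Odd d → ∀ us → Excluded us d → ¬ Form₁₅.U f ∈ us
  exclude-deep f d-odd us ex U∈us = go (residues-mod-4π sc f d-odd 4π∣w)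
    where
    open Form₁₅ f
    4π∣w : # 4 * π ∣ w
    4π∣w = let w₀ , w≡ , _ = w-shape sc f in w₀ * (- # 2 * I * (Q j * Q j)) , trans w≡ (eq w₀ (Q j))
      where
      eq = solve 2 (λ w q → w :* (:π :² :* :π :* (:π :² :* q) :²)
        := w :* (:- :# 2 :* :I :* q :²) :* (:# 4 :* :π)) refl
    go : (∃₂ λ ε ε′ → ε ∈ signs × ε′ ∈ signs × # 4 * π ∣ ε - _ * U * ε′) → ⊥
    go (_ , _ , ε∈ , ε′∈ , 4π∣) = All.lookup (All.lookup (All.lookup ex U∈us) ε∈) ε′∈ (N-∣ 4π∣)

  deep-15-or-1 : ∀ {d d′} → Odd d → Excluded (I ∷ - I ∷ []) d → (f : Form₁₅ k (suc j) d d′) → Deep k (suc j) d d′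
  deep-15-or-1 {d} {d′} d-odd ex f = go (U∈ sc f) refl
    where
    go : ∀ {u} → u ∈ units → Form₁₅.U f ≡ u → Deep k (suc j) d d′
    go (here refl) U≡ = normalise f (subst (_∈ signs) (sym U≡) (here refl))
    go (there (here refl)) U≡ = normalise f (subst (_∈ signs) (sym U≡) (there (here refl)))
    go (there (there u∈)) U≡ = contradiction (subst (_∈ _) (sym U≡) u∈) (exclude-deep f d-odd _ ex)

-- The base case and the descent step

Excluded-shallow : ℤ[i] → Set
Excluded-shallow d = All (λ U → All (λ ε → All (λ ε′ → All (λ u → ¬ 32 ℕ.∣ N (ε - d * U * ε′ - π * π * π * u))
    units) signs) signs) units

excluded-shallow? : Dec (All Excluded-shallow (# 15 ∷ # 3 ∷ # 5 ∷ 1# ∷ []))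
excluded-shallow? = All.all? (λ d → All.all? (λ U → All.all?
    (λ ε → All.all? (λ ε′ → All.all? (λ u → ¬? (_ ℕ.∣? _)) units) signs) signs) units) _

exclude-shallow : ∀ {k d d′} → Scale k → Odd d → d ∈ (# 15 ∷ # 3 ∷ # 5 ∷ 1# ∷ []) → ¬ Form₁₅ k 0 d d′
exclude-shallow {d = d} sc d-odd d∈ f =
  let w₀ , w≡ , _ , w₀-odd = w-shape sc f
      w≡′ = trans w≡ (cong (w₀ *_) refl)
      ε , ε′ , u , ε∈ , ε′∈ , u∈ , 4π∣ = shallow-residues {w = w₀} {D′ = _} (m-odd sc f d-odd) t-odd w₀-odd
          (trans equation (cong (λ w → _ * t ² + # 9 * (t * w) + _ * w ²) w≡′))
  in All.lookup (All.lookup (All.lookup (All.lookup (All.lookup (from-yes excluded-shallow?) d∈) (U∈ sc f)) ε∈)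
      ε′∈) u∈ (N-∣ 4π∣)
  where open Form₁₅ f

1-odd : Odd 1#
1-odd = 0# , refl

5-odd : Odd (# 5)
5-odd = # 2 * (1# - I) , refl

15-odd : Odd (# 15)
15-odd = # 7 * (1# - I) , refl

exclude-λ-form : ∀ {k j d d′ ℓ ℓ′} (sc : Scale k) (f : Form₁₅ k j d d′) → ℓ ∈ λs → ℓ′ ∈ λs
    → (d ≡ ℓ × d′ ≡ # 3 * ℓ′) ⊎ (d ≡ # 3 * ℓ × d′ ≡ ℓ′) → ⊥
exclude-λ-form sc f ℓ∈ ℓ′∈ (inj₁ (refl , refl)) = exclude-λ ℓ∈ ℓ′∈ (U∈ sc f) (U′∈ sc f) t⊥w equation
  where open Form₁₅ f
exclude-λ-form {ℓ = ℓ} {ℓ′} sc f ℓ∈ ℓ′∈ (inj₂ (refl , refl)) = exclude-λ ℓ′∈ ℓ∈ (U′∈ sc f) (U∈ sc f) (cop-sym t⊥w)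
    (trans equation (eq ℓ U t w ℓ′ U′))
  where
  open Form₁₅ f
  eq = solve 6 (λ ℓ U t w ℓ′ U′ → :# 3 :* ℓ :* U :* t :² :+ :# 9 :* (t :* w) :+ ℓ′ :* U′ :* w :²
    := ℓ′ :* U′ :* w :² :+ :# 9 :* (w :* t) :+ :# 3 :* ℓ :* U :* t :²) refl

λ₁∈ : λ₁ ∈ λs
λ₁∈ = here refl

λ₂∈ : λ₂ ∈ λs
λ₂∈ = there (here refl)

-- The eight classes d occur in the order 15, 3λ₁, 3λ₂, 3, 5, λ₁, λ₂, 1. The four with a single λ
-- fail modulo 3, 3 and 5 fail modulo 4π, 15 fails by its further factorisation, and 1 continues the
-- descent.
descend : ∀ {k j} (sc : Scale k) → ∀ {d d′} → (d , d′) ∈ splittings 3-λ-λ → Form₁₅ k (suc j) d d′ → Quartic k j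
descend sc (here refl) f = ⊥-elim (Exclude-15.exclude sc (deep-15-or-1 sc 15-odd
    (from-yes (excluded? (I ∷ - I ∷ []) (# 15))) f))
descend sc (there (here refl)) f = ⊥-elim (exclude-λ-form sc f λ₁∈ λ₂∈ (inj₂ (refl , refl)))
descend sc (there (there (here refl))) f = ⊥-elim (exclude-λ-form sc f λ₂∈ λ₁∈ (inj₂ (refl , refl)))
descend sc (there (there (there (here refl)))) f = contradiction (U∈ sc f)
    (exclude-deep sc f (scale-odd three) units (from-yes (excluded? units (# 3))))
descend sc (there (there (there (there (here refl))))) f = contradiction (U∈ sc f)
    (exclude-deep sc f 5-odd units (from-yes (excluded? units (# 5))))
descend sc (there (there (there (there (there (here refl)))))) f = ⊥-elim
    (exclude-λ-form sc f λ₁∈ λ₂∈ (inj₁ (refl , refl)))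
descend sc (there (there (there (there (there (there (here refl))))))) f = ⊥-elim
    (exclude-λ-form sc f λ₂∈ λ₁∈ (inj₁ (refl , refl)))
descend sc (there (there (there (there (there (there (there (here refl)))))))) f = deep⇒quartic sc
    (deep-15-or-1 sc 1-odd (from-yes (excluded? (I ∷ - I ∷ []) 1#)) f)

-- For j = 0 the middle term of the form contributes π³ u modulo 4π, and this extra term rules out
-- even the classes 1 and 15. This is why the descent stops at valuation 3.
exclude-zero : ∀ {k} (sc : Scale k) → ∀ {d d′} → (d , d′) ∈ splittings 3-λ-λ → ¬ Form₁₅ k 0 d d′
exclude-zero sc (here refl) = exclude-shallow sc 15-odd (here refl)
exclude-zero sc (there (here refl)) f = exclude-λ-form sc f λ₁∈ λ₂∈ (inj₂ (refl , refl))
exclude-zero sc (there (there (here refl))) f = exclude-λ-form sc f λ₂∈ λ₁∈ (inj₂ (refl , refl))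
exclude-zero sc (there (there (there (here refl)))) = exclude-shallow sc (scale-odd three) (there (here refl))
exclude-zero sc (there (there (there (there (here refl))))) = exclude-shallow sc 5-odd (there (there (here refl)))
exclude-zero sc (there (there (there (there (there (here refl)))))) f = exclude-λ-form sc f λ₁∈ λ₂∈
    (inj₁ (refl , refl))
exclude-zero sc (there (there (there (there (there (there (here refl))))))) f = exclude-λ-form sc f λ₂∈ λ₁∈
    (inj₁ (refl , refl))
exclude-zero sc (there (there (there (there (there (there (there (here refl)))))))) = exclude-shallow sc 1-odd
    (there (there (there (here refl))))

¬quartic : ∀ {k} → Scale k → ∀ j → ¬ Quartic k j
¬quartic sc zero    q = let _ , _ , d∈ , f = form₂₁⇒form₁₅ sc (quartic⇒form₂₁ sc q) in exclude-zero sc d∈ f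
¬quartic sc (suc j) q = let _ , _ , d∈ , f = form₂₁⇒form₁₅ sc (quartic⇒form₂₁ sc q) in ¬quartic sc j (descend sc d∈ f)

-- The genus one curve H

OnH : (k e z W : ℤ[i]) → Set
OnH k e z W = W ² ≡ # 6 * k ² * e ² ² - # 9 * π * k * e ² * z ² + # 5 * I * z ² ²

-- Addition of the points (1 , z₀ , W₀) and (e , z , W) of H: with n = e z W₀ + z₀ W and D = z₀² e² - z²,
-- the sum corresponds to ρ = n / D, on ρ⁴ - 9 k π ρ² + 15 k² π² = σ².
module Sum {k z₀ W₀ e z W : ℤ[i]} (base : OnH k 1# z₀ W₀) (point : OnH k e z W) where

  n D σ : ℤ[i]
  n = e * z * W₀ + z₀ * W
  D = z₀ ² * e ² - z ²
  σ = e * z * z₀ * (# 12 * k ² * e ² - # 9 * π * k * (e ² * z₀ ² + z ²) + # 10 * I * z ² * z₀ ²) +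
      (z₀ ² * e ² + z ²) * (W * W₀)

  private
    V₀ V X : ℤ[i]
    V₀ = # 6 * k ² - # 9 * π * k * z₀ ² + # 5 * I * z₀ ² ²
    V = # 6 * k ² * e ² ² - # 9 * π * k * e ² * z ² + # 5 * I * z ² ²
    X = e ² * z ² * V₀ + z₀ ² * V

    base′ : W₀ ² ≡ V₀
    base′ = trans base (eq k z₀)
      where
      eq = solve 2 (λ k z₀ → :# 6 :* k :² :* (:# 1) :² :² :- :# 9 :* :π :* k :* (:# 1) :² :* z₀ :²
          :+ :# 5 :* :I :* z₀ :² :² := :# 6 :* k :² :- :# 9 :* :π :* k :* z₀ :² :+ :# 5 :* :I :* z₀ :² :²) refl

    n²≡ : n ² ≡ X + # 2 * e * z * z₀ * (W * W₀)
    n²≡ = lin₂ (e ² * z ²) (z₀ ²) base′ point (eq e z W z₀ W₀ V₀ V)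
      where
      eq = solve 7 (λ e z W z₀ W₀ V₀ V → (e :* z :* W₀ :+ z₀ :* W) :²
          :- (e :² :* z :² :* V₀ :+ z₀ :² :* V :+ :# 2 :* e :* z :* z₀ :* (W :* W₀))
        := e :² :* z :² :* (W₀ :² :- V₀) :+ z₀ :² :* (W :² :- V)) refl

    WW₀²≡ : (W * W₀) ² ≡ V * V₀
    WW₀²≡ = trans (eq W W₀) (cong₂ _*_ point base′)
      where
      eq = solve 2 (λ W W₀ → (W :* W₀) :² := W :² :* W₀ :²) refl

  -- Both n² and (W W₀)² are polynomials in e, z, z₀, k and W W₀ by the equations of the two points;
  -- modulo these two relations only a polynomial identity is left.
  σ²≡ : σ ² ≡ n ² ² - # 9 * k * π * n ² * D ² + # 15 * k ² * π ² * D ² ²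
  σ²≡ = lin₂ ((z₀ ² * e ² + z ²) ² - (# 2 * e * z * z₀) ²)
      (- (n ² + X + # 2 * e * z * z₀ * (W * W₀) - # 9 * k * π * D ²)) WW₀²≡ n²≡
    (eq e z z₀ k (W * W₀) (n ²))
    where
    eq = solve 6 (λ e z z₀ k q n² → (e :* z :* z₀ :* (:# 12 :* k :² :* e :² :- :# 9 :* :π
            :* k :* (e :² :* z₀ :² :+ z :²) :+ :# 10 :* :I :* z :² :* z₀ :²) :+ (z₀ :² :* e :² :+ z :²) :* q) :²
        :- (n² :² :- :# 9 :* k :* :π :* n² :* (z₀ :² :* e :² :- z :²) :²
          :+ :# 15 :* k :² :* :π :² :* (z₀ :² :* e :² :- z :²) :² :²)
      := ((z₀ :² :* e :² :+ z :²) :² :- (:# 2 :* e :* z :* z₀) :²)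
        :* (q :² :- (:# 6 :* k :² :* e :² :² :- :# 9 :* :π :* k :* e :² :* z :² :+ :# 5 :* :I :* z :² :²)
          :* (:# 6 :* k :² :- :# 9 :* :π :* k :* z₀ :² :+ :# 5 :* :I :* z₀ :² :²))
        :+ :- (n² :+ (e :² :* z :² :* (:# 6 :* k :² :- :# 9 :* :π :* k :* z₀ :² :+ :# 5 :* :I :* z₀ :² :²)
            :+ z₀ :² :* (:# 6 :* k :² :* e :² :² :- :# 9 :* :π :* k :* e :² :* z :² :+ :# 5 :* :I :* z :² :²))
          :+ :# 2 :* e :* z :* z₀ :* q :- :# 9 :* k :* :π :* (z₀ :² :* e :² :- z :²) :²)
        :* (n² :- (e :² :* z :² :* (:# 6 :* k :² :- :# 9 :* :π :* k :* z₀ :² :+ :# 5 :* :I :* z₀ :² :²)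
            :+ z₀ :² :* (:# 6 :* k :² :* e :² :² :- :# 9 :* :π :* k :* e :² :* z :² :+ :# 5 :* :I :* z :² :²)
            :+ :# 2 :* e :* z :* z₀ :* q))) refl

  -- The product of n with its conjugate under W ↦ -W. It transfers divisibility by 4 from D to this
  -- product, the input of `halving`.
  product≡ : n * (e * z * W₀ - z₀ * W) ≡ D * (# 5 * I * z₀ ² * z ² - # 6 * k ² * e ²)
  product≡ = lin₂ (e ² * z ²) (- z₀ ²) base′ point (eq e z W z₀ W₀ k)
    where
    eq = solve 6 (λ e z W z₀ W₀ k → (e :* z :* W₀ :+ z₀ :* W) :* (e :* z :* W₀ :- z₀ :* W)
        :- (z₀ :² :* e :² :- z :²) :* (:# 5 :* :I :* z₀ :² :* z :² :- :# 6 :* k :² :* e :²)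
      := e :² :* z :² :* (W₀ :² :- (:# 6 :* k :² :- :# 9 :* :π :* k :* z₀ :² :+ :# 5 :* :I :* z₀ :² :²))
        :+ :- z₀ :²
        :* (W :² :- (:# 6 :* k :² :* e :² :² :- :# 9 :* :π :* k :* e :² :* z :² :+ :# 5 :* :I :* z :² :²))) refl

  -- Substituting n and D makes σ² divisible by 16, and removing gcd(n₁ , o) makes it divisible by a
  -- fourth power; both are squares and can be cancelled.
  sum-quartic : ∀ {j n₁ o} → n ≡ # 2 * n₁ → D ≡ # 4 * (π * Q j * o) → Odd n₁ → Odd o → Quartic k j
  sum-quartic {j} {n₁} {o} n≡ D≡ n₁-odd o-odd = clear-4 (squareFree-∣ {g = # 4} squareFree-1 (λ ())
      (R , trans (*-identityˡ _) σ²≡16))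
    where
    Y R : ℤ[i]
    Y = π * Q j * o
    R = n₁ ² ² - # 36 * k * π * n₁ ² * Y ² + # 240 * k ² * π ² * Y ² ²
    σ²≡16 : σ ² ≡ R * (# 4) ²
    σ²≡16 = trans σ²≡ (trans (cong₂ (λ n D → n ² ² - # 9 * k * π * n ² * D ² + # 15 * k ² * π ² * D ² ²) n≡ D≡)
        (eq k n₁ Y))
      where
      eq = solve 3 (λ k n Y → (:# 2 :* n) :² :² :- :# 9 :* k :* :π :* (:# 2 :* n) :² :* (:# 4 :* Y) :²
          :+ :# 15 :* k :² :* :π :² :* (:# 4 :* Y) :² :² := (n :² :²
            :- :# 36 :* k :* :π :* n :² :* Y :² :+ :# 240 :* k :² :* :π :² :* Y :² :²) :* (:# 4) :²) refl
    clear-4 : # 4 ∣ σ → Quartic k j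
    clear-4 (σ₁ , σ≡) = clear-gcd (reduce-pair n₁ o (odd≢0 n₁-odd))
      where
      σ₁²≡ : σ₁ ² ≡ R
      σ₁²≡ = *-cancelˡ (# 16) (λ ()) (lin₂ 1# (- (σ + σ₁ * # 4)) σ²≡16 σ≡ (eq σ σ₁ R))
        where
        eq = solve 3 (λ s t R → :# 16 :* t :² :- :# 16 :* R
          := :# 1 :* (s :² :- R :* (:# 4) :²) :+ :- (s :+ t :* :# 4) :* (s :- t :* :# 4)) refl
      clear-gcd : (∃ λ g → ∃₂ λ M e → ¬ g ≡ 0# × n₁ ≡ M * g × o ≡ e * g × Coprime M e) → Quartic k j
      clear-gcd (g , M , f , g≢0 , n₁≡ , o≡ , M⊥f) = clear-g
          (squareFree-∣ {g = g ²} squareFree-1 g²≢0 (R′ , trans (*-identityˡ _) σ₁²≡′))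
        where
        g²≢0 : ¬ g ² ≡ 0#
        g²≢0 h = [ g≢0 , g≢0 ]′ (x*y≡0 g g h)
        -- The factor i turns the coefficient -36 into the +36 of `Quartic`.
        κ : ℤ[i]
        κ = k * π * (π * (Q j * (I * f))) ²
        R′ : ℤ[i]
        R′ = M ² ² + # 36 * κ * M ² + # 240 * κ ²
        σ₁²≡′ : σ₁ ² ≡ R′ * g ² ²
        σ₁²≡′ = trans σ₁²≡ (trans (cong₂ (λ n o → n ² ² - # 36 * k * π * n ² * (π * Q j * o) ² + # 240 * k ² * π ²
            * (π * Q j * o) ² ²) n₁≡ o≡) (eq k M g (Q j) f))
          where
          eq = solve 5 (λ k M g q f → (M :* g) :² :² :- :# 36 :* k :* :π :* (M :* g) :²
              :* (:π :* q :* (f :* g)) :² :+ :# 240 :* k :² :* :π :² :* (:π :* q :* (f :* g)) :² :²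
            := (M :² :² :+ :# 36 :* (k :* :π :* (:π :* (q :* (:I :* f))) :²) :* M :²
                :+ :# 240 :* (k :* :π :* (:π :* (q :* (:I :* f))) :²) :²) :* g :² :²) refl
        clear-g : g ² ∣ σ₁ → Quartic k j
        clear-g (s , σ₁≡) = record
          { M-odd = odd-∣ (g , trans n₁≡ (*-comm M g)) n₁-odd
          ; e-odd = odd-* (I , refl) (odd-∣ (g , trans o≡ (*-comm f g)) o-odd)
          ; M⊥e = cop-* (cop-sym (cop-∣ (cop-sym cop-1) (- I , refl))) M⊥f
          ; κ≡ = refl
          ; equation = *-cancelˡ (g ² ²) (λ h → [ g²≢0 , g²≢0 ]′ (x*y≡0 (g ²) (g ²) h))
              (lin₂ 1# (- (σ₁ + s * g ²)) σ₁²≡′ σ₁≡ (eq s σ₁ (g ²) R′)) }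
          where
          eq = solve 4 (λ s t g R → g :² :* s :² :- g :² :* R
            := :# 1 :* (t :² :- R :* g :²) :+ :- (t :+ s :* g) :* (t :- s :* g)) refl

-- The values of n for W and for -W are both even, and their halves have the odd sum e z W₀, so
-- exactly one half is odd. After a choice of sign n has valuation 2; D has valuation 5 + 2j, and
-- the quotient has valuation 3 + 2j.
¬OnH-near-base : ∀ {k z₀ W₀ e z W j o} → Scale k → OnH k 1# z₀ W₀ → OnH k e z W → Odd W₀ → Odd e → Odd z → Odd o →
  z₀ ² * e ² - z ² ≡ # 4 * (π * Q j * o) → ⊥
¬OnH-near-base {k} {z₀} {W₀} {e} {z} {W} {j} {o} sc base point W₀-odd e-odd z-odd o-odd D≡ =
  go (halving n (- (z₀ * W)) (π * Q j * o * R) (trans (cong (n *_) (eq₁ e z W₀ z₀ W))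
      (trans product≡ (trans (cong (_* R) D≡) (*-assoc (# 4) _ R)))))
  where
  open Sum base point
  R : ℤ[i]
  R = # 5 * I * z₀ ² * z ² - # 6 * k ² * e ²
  eq₁ = solve 5 (λ e z W₀ z₀ W → e :* z :* W₀ :+ z₀ :* W :+ :# 2 :* :- (z₀ :* W)
    := e :* z :* W₀ :- z₀ :* W) refl
  point⁻ : OnH k e z (- W)
  point⁻ = trans (eq W) point
    where
    eq = solve 1 (λ W → (:- W) :² := W :²) refl
  go : # 2 ∣ n → ⊥
  go (n₁ , n≡) = [ (λ π∣n₁ → ¬quartic sc j (Sum.sum-quartic base point⁻ n⁻≡ D≡ (n₂-odd π∣n₁) o-odd))
                 , (λ o₁ → ¬quartic sc j (sum-quartic (trans n≡ (*-comm n₁ (# 2))) D≡ o₁ o-odd)) ]′ (parity n₁)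
    where
    n₂ : ℤ[i]
    n₂ = n₁ - z₀ * W
    n⁻≡ : e * z * W₀ + z₀ * - W ≡ # 2 * n₂
    n⁻≡ = lin₁ 1# n≡ (eq e z W₀ z₀ W n₁)
      where
      eq = solve 6 (λ e z W₀ z₀ W n₁ → e :* z :* W₀ :+ z₀ :* :- W :- :# 2 :* (n₁ :- z₀ :* W)
        := :# 1 :* (e :* z :* W₀ :+ z₀ :* W :- n₁ :* :# 2)) refl
    n₁+n₂≡ : n₁ + n₂ ≡ e * z * W₀
    n₁+n₂≡ = *-cancelˡ (# 2) (λ ()) (lin₁ (- # 2) n≡ (eq e z W₀ z₀ W n₁))
      where
      eq = solve 6 (λ e z W₀ z₀ W n₁ → :# 2 :* (n₁ :+ (n₁ :- z₀ :* W)) :- :# 2 :* (e :* z :* W₀)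
        := :- :# 2 :* (e :* z :* W₀ :+ z₀ :* W :- n₁ :* :# 2)) refl
    n₂-odd : π ∣ n₁ → Odd n₂
    n₂-odd π∣n₁ = [ (λ π∣n₂ → contradiction (odd-* (odd-* e-odd z-odd) W₀-odd)
                      (¬even×odd (∣-≡ (∣-+ π∣n₁ π∣n₂) n₁+n₂≡))) , (λ o → o) ]′ (parity n₂)

2^ : ℕ → ℤ[i]
2^ zero    = 1#
2^ (suc j) = # 2 * 2^ j

Q-2^ : ∀ j → ∃ λ u → Odd u × 2^ j ≡ u * Q j
Q-2^ zero = 1# , (0# , refl) , refl
Q-2^ (suc j) = let u , u-odd , h = Q-2^ j in - I * u , odd-* (- 1# , refl) u-odd , trans (cong (# 2 *_) h) (eq u (Q j))
  where
  eq = solve 2 (λ u q → :# 2 :* (u :* q) := :- :I :* u :* (:π :² :* q)) refl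

-- Neighbourhoods of the known points

record Base (k : ℤ[i]) : Set where
  field
    z₀ b₀ c₀ h₀ s : ℤ[i]
    on-H   : OnH k 1# z₀ (c₀ + I * h₀)
    πz₀²≡  : π * z₀ ² ≡ b₀ + I * c₀
    h₀≡    : # 2 * h₀ ≡ # 5 * b₀ - # 9 * k
    conic≡ : # 2 * c₀ ² ≡ # 5 * b₀ ² - # 18 * b₀ * k + # 15 * k ²
    s≡     : # 8 * s ≡ # 10 * b₀ - # 18 * k
    c₀-odd : Odd c₀
    W₀-odd : Odd (c₀ + I * h₀)

-- The points [1:1:1:1:1] and [1:3:5:7:9] with e = 1. In the second, c₀ = -1 because 7 - i = π (2 -
-- i)², while 7 + i is π times i times a square. The imaginary part of W₀ is h₀, and 8s is the
-- derivative of 5b² - 18bk + 15k² at b₀.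
base : ∀ {k} → Scale k → Base k
base one = record { z₀ = 1# ; b₀ = 1# ; c₀ = 1# ; h₀ = - # 2 ; s = - 1# ; on-H = refl ; πz₀²≡ = refl ; h₀≡ = refl ;
    conic≡ = refl ; s≡ = refl
  ; c₀-odd = 0# , refl ; W₀-odd = - 1# - I , refl }
base three = record { z₀ = # 2 - I ; b₀ = # 7 ; c₀ = - 1# ; h₀ = # 4 ; s = # 2 ; on-H = refl ; πz₀²≡ = refl ; h₀≡ =
    refl ; conic≡ = refl ; s≡ = refl
  ; c₀-odd = - 1# + I , refl ; W₀-odd = 1# + # 3 * I , refl }

cop-2^ : ∀ {x} j → Odd x → Coprime x (2^ j)
cop-2^ zero    o = cop-1
cop-2^ (suc j) o = cop-* (cop-∣₂ (cop-* π⊥ π⊥) ∣-refl (I , refl)) (cop-2^ j o)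
  where π⊥ = cop-sym (odd⇒cop o)

module _ {k e z b c β γ : ℤ[i]} (sc : Scale k) where
  open Base (base sc)

  -- Subtracting the conic at the base point gives γ (c₀ e² + 4γ) = 2β (5β + s e²). The second
  -- factor on the left is odd, so γ is divisible by 2^(j+1), and β + iγ is 2^j times an odd number.
  -- Since π (z₀² e² - z²) = -8 (β + iγ), this fixes the valuation of the difference exactly.
  ¬near-base : ∀ {j β′} → b ≡ b₀ * e ² + # 8 * β → c ≡ c₀ * e ² + # 8 * γ → b + I * c ≡ π * z ² →
    # 2 * c ² ≡ # 5 * b ² - # 18 * b * k * e ² + # 15 * k ² * e ² ² →
    Odd e → Odd z → Odd β′ → β ≡ β′ * 2^ j → ⊥
  ¬near-base {j} {β′} refl refl πz²≡ conic e-odd z-odd β′-odd β≡ = from-γ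
      (cop-∣* (cop-sym (cop-2^ (suc j) x-odd)) (β′ * (# 5 * β + s * e ²) , trans γx≡′
      (lin₁ (# 2 * (# 5 * β + s * e ²)) β≡ (eq₂ β β′ s (e ²) (2^ j)))))
    where
    x : ℤ[i]
    x = c₀ * e ² + # 4 * γ
    x-odd : Odd x
    x-odd = odd+even (odd-* c₀-odd (odd-* e-odd e-odd)) (# 2 * (1# - I) * γ , eq γ)
      where
      eq = solve 1 (λ γ → :# 4 :* γ := :# 2 :* (:# 1 :- :I) :* γ :* :π) refl
    γx≡ : γ * x ≡ # 2 * β * (# 5 * β + s * e ²)
    γx≡ = *-cancelˡ (# 32) (λ ()) (lin₃ 1# (- (e ² ²)) (# 8 * β * e ²) conic conic≡ (sym s≡)
        (eq b₀ c₀ (e ²) β γ k s))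
      where
      eq = solve 7 (λ b c E β γ k s → :# 32 :* (γ :* (c :* E :+ :# 4 :* γ))
          :- :# 32 :* (:# 2 :* β :* (:# 5 :* β :+ s :* E))
        := :# 1 :* (:# 2 :* (c :* E :+ :# 8 :* γ) :² :- (:# 5 :* (b :* E :+ :# 8 :* β) :²
              :- :# 18 :* (b :* E :+ :# 8 :* β) :* k :* E :+ :# 15 :* k :² :* E :²))
          :+ :- E :² :* (:# 2 :* c :² :- (:# 5 :* b :² :- :# 18 :* b :* k :+ :# 15 :* k :²))
          :+ :# 8 :* β :* E :* (:# 10 :* b :- :# 18 :* k :- :# 8 :* s)) refl
    γx≡′ : x * γ ≡ # 2 * β * (# 5 * β + s * e ²)
    γx≡′ = trans (*-comm x γ) γx≡
    eq₂ = solve 5 (λ β β′ s E t → :# 2 :* β :* (:# 5 :* β :+ s :* E)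
        :- β′ :* (:# 5 :* β :+ s :* E) :* (:# 2 :* t) := :# 2 :* (:# 5 :* β :+ s :* E) :* (β :- β′ :* t)) refl
    -- This is c + i (5b - 9k e²) / 2 written without division; with b + ic = π z² and π² = 2i, the
    -- conic makes its square the quartic of `H`.
    W : ℤ[i]
    W = c₀ * e ² + # 8 * γ + I * (h₀ * e ² + # 20 * β)
    point : OnH k e z W
    point = *-cancelˡ (# 4) (λ ()) (lin₃ (# 7) (# 10 * (b + I * c + π * z ²) - # 36 * k * e ²)
        (# 2 * I * e ² * (# 2 * (c₀ * e ² + # 8 * γ) + I * (h₀ * e ² + # 20 * β)) - e ² *
            (# 5 * b₀ * e ² + # 40 * β - # 9 * k * e ²)) conic πz²≡ h₀≡
        (eq b₀ c₀ h₀ (e ²) (z ²) β γ k))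
      where
      eq = solve 8 (λ b₀ c₀ h₀ E Z β γ k → :# 4 :* (c₀ :* E :+ :# 8 :* γ :+ :I :* (h₀ :* E :+ :# 20 :* β)) :²
          :- :# 4 :* (:# 6 :* k :² :* E :² :- :# 9 :* :π :* k :* E :* Z :+ :# 5 :* :I :* Z :²)
        := :# 7 :* (:# 2 :* (c₀ :* E :+ :# 8 :* γ) :² :- (:# 5 :* (b₀ :* E :+ :# 8 :* β) :²
              :- :# 18 :* (b₀ :* E :+ :# 8 :* β) :* k :* E :+ :# 15 :* k :² :* E :²))
          :+ (:# 10 :* (b₀ :* E :+ :# 8 :* β :+ :I :* (c₀ :* E :+ :# 8 :* γ) :+ :π :* Z) :- :# 36 :* k :* E)
          :* (b₀ :* E :+ :# 8 :* β :+ :I :* (c₀ :* E :+ :# 8 :* γ) :- :π :* Z)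
          :+ (:# 2 :* :I :* E :* (:# 2 :* (c₀ :* E :+ :# 8 :* γ) :+ :I :* (h₀ :* E :+ :# 20 :* β)) :- E :* (:# 5
              :* b₀ :* E :+ :# 40 :* β :- :# 9 :* k :* E)) :* (:# 2 :* h₀ :- (:# 5 :* b₀ :- :# 9 :* k))) refl
    from-γ : 2^ (suc j) ∣ γ → ⊥
    from-γ (γ′ , γ≡) =
      let u , u-odd , 2^≡ = Q-2^ j
      in ¬OnH-near-base {j = j} {o = I * u * o′} sc on-H point W₀-odd e-odd z-odd
          (odd-* (odd-* (I , refl) u-odd) o′-odd)
           (*-cancelˡ π (λ ()) (lin₄ (e ²) (- 1#) (- # 8) (- # 8 * I) πz₀²≡ (sym πz²≡)
               (trans β≡ (cong (β′ *_) 2^≡)) (trans γ≡ (cong (λ t → γ′ * (# 2 * t)) 2^≡))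
             (eq z₀ e z b₀ c₀ β γ β′ γ′ u (Q j))))
      where
      o′ : ℤ[i]
      o′ = β′ + # 2 * I * γ′
      o′-odd : Odd o′
      o′-odd = odd+even β′-odd ((1# - I) * I * γ′ , eq′ γ′)
        where
        eq′ = solve 1 (λ γ → :# 2 :* :I :* γ := (:# 1 :- :I) :* :I :* γ :* :π) refl
      eq = solve 11 (λ z₀ e z b₀ c₀ β γ β′ γ′ u q → :π :* (z₀ :² :* e :² :- z :²)
          :- :π :* (:# 4 :* (:π :* q :* (:I :* u :* (β′ :+ :# 2 :* :I :* γ′))))
        := e :² :* (:π :* z₀ :² :- (b₀ :+ :I :* c₀))
          :+ :- :# 1 :* (:π :* z :² :- (b₀ :* e :² :+ :# 8 :* β :+ :I :* (c₀ :* e :² :+ :# 8 :* γ)))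
          :+ :- :# 8 :* (β :- β′ :* (u :* q)) :+ :- :# 8 :* :I :* (γ :- γ′ :* (:# 2 :* (u :* q)))) refl

-- Rational integers

ℤ-lin : ∀ {x y l r} c → l ≡ r → x ℤ.- y ≡ c ℤ.* (l ℤ.- r) → x ≡ y
ℤ-lin {x} {y} {l} c refl h = ℤₚ.i-j≡0⇒i≡j x y (trans h (eq c l))
  where
  eq = ℤ-solve 2 (λ c l → c :* (l :- l) := ℤ# 0) refl

ℤ-lin₂ : ∀ {x y l r l′ r′} c d → l ≡ r → l′ ≡ r′ → x ℤ.- y ≡ c ℤ.* (l ℤ.- r) ℤ.+ d ℤ.* (l′ ℤ.- r′) → x ≡ y
ℤ-lin₂ {l = l} {l′ = l′} c d refl refl h = ℤ-lin {l = l} c refl (trans h (eq c d l l′))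
  where
  eq = ℤ-solve 4 (λ c d l l′ → c :* (l :- l) :+ d :* (l′ :- l′) := c :* (l :- l)) refl

ℤ-lin₃ : ∀ {x y l r l′ r′ l″ r″} c d f → l ≡ r → l′ ≡ r′ → l″ ≡ r″ →
         x ℤ.- y ≡ c ℤ.* (l ℤ.- r) ℤ.+ d ℤ.* (l′ ℤ.- r′) ℤ.+ f ℤ.* (l″ ℤ.- r″) → x ≡ y
ℤ-lin₃ {l = l} {l′ = l′} {l″ = l″} c d f refl refl refl h = ℤ-lin {l = l} c refl (trans h (eq c d f l l′ l″))
  where
  eq = ℤ-solve 6 (λ c d f l l′ l″ → c :* (l :- l) :+ d :* (l′ :- l′) :+ f :* (l″ :- l″) := c :* (l :- l)) refl

ℤ-lin₄ : ∀ {x y l r l′ r′ l″ r″ l‴ r‴} c d f g → l ≡ r → l′ ≡ r′ → l″ ≡ r″ → l‴ ≡ r‴ →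
         x ℤ.- y ≡ c ℤ.* (l ℤ.- r) ℤ.+ d ℤ.* (l′ ℤ.- r′) ℤ.+ f ℤ.* (l″ ℤ.- r″) ℤ.+ g ℤ.* (l‴ ℤ.- r‴) → x ≡ y
ℤ-lin₄ {l = l} {l′ = l′} {l″ = l″} {l‴ = l‴} c d f g refl refl refl refl h = ℤ-lin {l = l} c refl
    (trans h (eq c d f g l l′ l″ l‴))
  where
  eq = ℤ-solve 8 (λ c d f g l l′ l″ l‴ → c :* (l :- l) :+ d :* (l′ :- l′) :+ f :* (l″ :- l″) :+ g :* (l‴ :- l‴)
    := c :* (l :- l)) refl

ℤEven ℤOdd : ℤ → Set
ℤEven n = ∃ λ q → n ≡ + 2 ℤ.* q
ℤOdd n = ∃ λ q → n ≡ + 1 ℤ.+ + 2 ℤ.* q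

ℤ-parity : ∀ n → ℤEven n ⊎ ℤOdd n
ℤ-parity n = go (ℤ-residue 2 n)
  where
  go : (∃₂ λ (r : Fin 2) q → n ≡ + toℕ r ℤ.+ q ℤ.* + 2) → ℤEven n ⊎ ℤOdd n
  go (Fin.zero , q , h) = inj₁ (q , trans h (trans (ℤₚ.+-identityˡ (q ℤ.* + 2)) (ℤₚ.*-comm q (+ 2))))
  go (Fin.suc Fin.zero , q , h) = inj₂ (q , trans h (cong (λ t → + 1 ℤ.+ t) (ℤₚ.*-comm q (+ 2))))

¬even×ℤodd : ∀ {n} → ℤEven n → ¬ ℤOdd n
¬even×ℤodd {n} (x , h) (y , h′) = from-no (2 ℕ.∣? 1) (ℕ.divides ℤ.∣ x ℤ.- y ∣
    (trans (cong ℤ.∣_∣ 1≡) (trans (ℤₚ.abs-* (+ 2) (x ℤ.- y)) (ℕₚ.*-comm 2 ℤ.∣ x ℤ.- y ∣))))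
  where
  1≡ : + 1 ≡ + 2 ℤ.* (x ℤ.- y)
  1≡ = ℤ-lin₂ (+ 1) (ℤ.- + 1) h h′ (eq n x y)
    where
    eq = ℤ-solve 3 (λ n x y → ℤ# 1 :- ℤ# 2 :* (x :- y)
      := ℤ# 1 :* (n :- ℤ# 2 :* x) :+ :- ℤ# 1 :* (n :- (ℤ# 1 :+ ℤ# 2 :* y))) refl

-- q (q + 1) is even
ℤodd-square : ∀ {n} → ℤOdd n → ∃ λ t → n ℤ.* n ≡ + 1 ℤ.+ + 8 ℤ.* t
ℤodd-square (q , refl) = [ (λ { (p , refl) → p ℤ.* (+ 1 ℤ.+ + 2 ℤ.* p) , e₁ p }) ,
    (λ { (p , refl) → (+ 1 ℤ.+ + 2 ℤ.* p) ℤ.* (p ℤ.+ + 1) , e₂ p }) ]′ (ℤ-parity q)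
  where
  e₁ = ℤ-solve 1 (λ p → (ℤ# 1 :+ ℤ# 2 :* (ℤ# 2 :* p)) :² := ℤ# 1 :+ ℤ# 8 :* (p :* (ℤ# 1 :+ ℤ# 2 :* p))) refl
  e₂ = ℤ-solve 1 (λ p → (ℤ# 1 :+ ℤ# 2 :* (ℤ# 1 :+ ℤ# 2 :* p)) :²
    := ℤ# 1 :+ ℤ# 8 :* ((ℤ# 1 :+ ℤ# 2 :* p) :* (p :+ ℤ# 1))) refl

R : ℤ → ℤ[i]
R a = a +i + 0

R-injective : ∀ {a b} → R a ≡ R b → a ≡ b
R-injective refl = refl

R-* : ∀ a b → R (a ℤ.* b) ≡ R a * R b
R-* a b = cong₂ _+i_ (re a b) (im a b)
  where
  re = ℤ-solve 2 (λ a b → a :* b := a :* b :- (ℤ# 0) :²) refl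
  im = ℤ-solve 2 (λ a b → ℤ# 0 := a :* ℤ# 0 :+ ℤ# 0 :* b) refl

R-∣ : ∀ {m n} → R m ∣ R n → ∃ λ q → n ≡ q ℤ.* m
R-∣ {m} ((x +i y) , h) = x , trans (cong re h) (eq x y m)
  where
  re : ℤ[i] → ℤ
  re (a +i _) = a
  eq = ℤ-solve 3 (λ x y m → x :* m :- y :* ℤ# 0 := x :* m) refl

ℤodd⇒odd : ∀ {n} → ℤOdd n → Odd (R n)
ℤodd⇒odd (q , refl) = (1# - I) * R q , trans (cong (λ t → R (+ 1) + t) (R-* (+ 2) q)) (eq (R q))
  where
  eq = solve 1 (λ q → :# 1 :+ :# 2 :* q := :# 1 :+ :π :* ((:# 1 :- :I) :* q)) refl

odd⇒ℤodd : ∀ {n} → Odd (R n) → ℤOdd n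
odd⇒ℤodd {n} o = [ (λ { (q , refl) → contradiction o (¬even×odd ((1# - I) * R q , trans (R-* (+ 2) q) (eq (R q))))
    }) , (λ z → z) ]′ (ℤ-parity n)
  where
  eq = solve 1 (λ q → :# 2 :* q := (:# 1 :- :I) :* q :* :π) refl

-- If n = h (x + i y)² with h = ± i then n = ∓ 2 x y is even.
real-square : ∀ {n h r} → ℤOdd n → h ∈ units → R n ≡ h * r ² → ∃ λ e → n ≡ e ℤ.* e ⊎ n ≡ ℤ.- (e ℤ.* e)
real-square {n} {h} {x +i y} n-odd h∈ e = go h∈ (cong re e) (cong im e)
  where
  re im : ℤ[i] → ℤ
  re (a +i _) = a
  im (_ +i b) = b
  xy≡0 : ∀ {s} → ¬ s ≡ + 0 → + 0 ≡ s ℤ.* (x ℤ.* y) → x ≡ + 0 ⊎ y ≡ + 0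
  xy≡0 {s} s≢0 h = [ (λ s≡0 → contradiction s≡0 s≢0) , (λ e → ℤₚ.i*j≡0⇒i≡0∨j≡0 x e) ]′ (ℤₚ.i*j≡0⇒i≡0∨j≡0 s (sym h))
  go : h ∈ units → n ≡ re (h * (x +i y) ²) → + 0 ≡ im (h * (x +i y) ²) → _
  go (here refl) e₁ e₂ = [ (λ { refl → y , inj₂ (trans e₁ (s₁ y)) }) , (λ { refl → x , inj₁ (trans e₁ (s₂ x)) }) ]′
      (xy≡0 {+ 2} (λ ()) (trans e₂ (s₃ x y)))
    where
    s₁ = ℤ-solve 1 (λ y → ℤ# 1 :* ((ℤ# 0) :² :- y :²) :- ℤ# 0 :* (ℤ# 0 :* y :+ y :* ℤ# 0) := :- y :²) refl
    s₂ = ℤ-solve 1 (λ x → ℤ# 1 :* (x :² :- (ℤ# 0) :²) :- ℤ# 0 :* (x :* ℤ# 0 :+ ℤ# 0 :* x) := x :²) refl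
    s₃ = ℤ-solve 2 (λ x y → ℤ# 1 :* (x :* y :+ y :* x) :+ ℤ# 0 :* (x :² :- y :²) := ℤ# 2 :* (x :* y)) refl
  go (there (here refl)) e₁ e₂ = [ (λ { refl → y , inj₁ (trans e₁ (s₁ y)) }) ,
      (λ { refl → x , inj₂ (trans e₁ (s₂ x)) }) ]′ (xy≡0 {ℤ.- + 2} (λ ()) (trans e₂ (s₃ x y)))
    where
    s₁ = ℤ-solve 1 (λ y → :- ℤ# 1 :* ((ℤ# 0) :² :- y :²) :- ℤ# 0 :* (ℤ# 0 :* y :+ y :* ℤ# 0) := y :²) refl
    s₂ = ℤ-solve 1 (λ x → :- ℤ# 1 :* (x :² :- (ℤ# 0) :²) :- ℤ# 0 :* (x :* ℤ# 0 :+ ℤ# 0 :* x) := :- x :²) refl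
    s₃ = ℤ-solve 2 (λ x y → :- ℤ# 1 :* (x :* y :+ y :* x) :+ ℤ# 0 :* (x :² :- y :²) := :- ℤ# 2 :* (x :* y)) refl
  go (there (there (here refl))) e₁ e₂ = contradiction n-odd (¬even×ℤodd (ℤ.- (x ℤ.* y) , trans e₁ (s x y)))
    where
    s = ℤ-solve 2 (λ x y → ℤ# 0 :* (x :² :- y :²) :- ℤ# 1 :* (x :* y :+ y :* x) := ℤ# 2 :* :- (x :* y)) refl
  go (there (there (there (here refl)))) e₁ e₂ = contradiction n-odd (¬even×ℤodd (x ℤ.* y , trans e₁ (s x y)))
    where
    s = ℤ-solve 2 (λ x y → ℤ# 0 :* (x :² :- y :²) :- :- ℤ# 1 :* (x :* y :+ y :* x) := ℤ# 2 :* (x :* y)) refl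

-- A nonzero rational integer is an odd number times 2^j, so its π-adic valuation is even. Applied
-- to β, this is how rationality enters the argument.
power-of-2 : ∀ n → ¬ n ≡ + 0 → ∃₂ λ j m → ℤOdd m × R n ≡ R m * 2^ j
power-of-2 n n≢0 = go n n≢0 (<-wellFounded ℤ.∣ n ∣)
  where
  go : ∀ n → ¬ n ≡ + 0 → Acc ℕ._<_ ℤ.∣ n ∣ → ∃₂ λ j m → ℤOdd m × R n ≡ R m * 2^ j
  go n n≢0 (acc rec) = [ even , (λ o → 0 , n , o , eq₀ (R n)) ]′ (ℤ-parity n)
    where
    eq₀ = solve 1 (λ n → n := n :* :# 1) refl
    even : ℤEven n → ∃₂ λ j m → ℤOdd m × R n ≡ R m * 2^ j
    even (q , n≡) = next (go q q≢0 (rec q<n))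
      where
      q≢0 : ¬ q ≡ + 0
      q≢0 refl = n≢0 n≡
      ∣q∣≢0 : ¬ ℤ.∣ q ∣ ≡ 0
      ∣q∣≢0 h = q≢0 (ℤₚ.∣i∣≡0⇒i≡0 h)
      double : ∀ m → ¬ m ≡ 0 → m ℕ.< 2 ℕ.* m
      double zero    h = contradiction refl h
      double (suc m) _ = ℕₚ.m<m+n (suc m) (s≤s z≤n)
      q<n : ℤ.∣ q ∣ ℕ.< ℤ.∣ n ∣
      q<n = subst (ℤ.∣ q ∣ ℕ.<_) (sym (trans (cong ℤ.∣_∣ n≡) (ℤₚ.abs-* (+ 2) q))) (double ℤ.∣ q ∣ ∣q∣≢0)
      next : (∃₂ λ j m → ℤOdd m × R q ≡ R m * 2^ j) → ∃₂ λ j m → ℤOdd m × R n ≡ R m * 2^ j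
      next (j , m , o , h) = suc j , m , o , trans (cong R n≡)
          (trans (R-* (+ 2) q) (trans (cong (# 2 *_) h) (eq (R m) (2^ j))))
        where
        eq = solve 2 (λ m t → :# 2 :* (m :* t) := m :* (:# 2 :* t)) refl

-- b + c i = π z² with z² ≡ ± 1 (mod 4 π), so b ≡ c ≡ ± 1 (mod 8).
residues-mod-8 : ∀ {b c z} → Odd z → R b + I * R c ≡ π * z ² → ∃₂ λ p q →
  (b ≡ + 1 ℤ.+ + 8 ℤ.* p × c ≡ + 1 ℤ.+ + 8 ℤ.* q) ⊎ (b ≡ ℤ.- + 1 ℤ.+ + 8 ℤ.* p × c ≡ ℤ.- + 1 ℤ.+ + 8 ℤ.* q)
residues-mod-8 {b} {c} {z} z-odd h = go (odd-square z-odd)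
  where
  re im : ℤ[i] → ℤ
  re (a +i _) = a
  im (_ +i b) = b
  go : (∃₂ λ ε y → ε ∈ signs × z ² ≡ ε + # 4 * π * y) → _
  go (_ , p +i q , here refl , z²≡) = ℤ.- q , p , inj₁
      ( trans (s₁ b c) (trans (cong re h′) (s₂ p q))
      , trans (s₃ c) (trans (cong im h′) (s₄ p q)))
    where
    h′ = trans h (cong (π *_) z²≡)
    s₁ = ℤ-solve 2 (λ b c → b := b :+ (ℤ# 0 :* c :- ℤ# 1 :* ℤ# 0)) refl
    s₂ = ℤ-solve 2 (λ p q → ℤ# 1 :* (ℤ# 1 :+ (ℤ# 4 :* p :- ℤ# 4 :* q))
        :- ℤ# 1 :* (ℤ# 0 :+ (ℤ# 4 :* q :+ ℤ# 4 :* p)) := ℤ# 1 :+ ℤ# 8 :* :- q) refl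
    s₃ = ℤ-solve 1 (λ c → c := ℤ# 0 :+ ((ℤ# 0) :² :+ ℤ# 1 :* c)) refl
    s₄ = ℤ-solve 2 (λ p q → ℤ# 1 :* (ℤ# 0 :+ (ℤ# 4 :* q :+ ℤ# 4 :* p))
        :+ ℤ# 1 :* (ℤ# 1 :+ (ℤ# 4 :* p :- ℤ# 4 :* q)) := ℤ# 1 :+ ℤ# 8 :* p) refl
  go (_ , p +i q , there (here refl) , z²≡) = ℤ.- q , p , inj₂
      ( trans (s₁ b c) (trans (cong re h′) (s₂ p q))
      , trans (s₃ c) (trans (cong im h′) (s₄ p q)))
    where
    h′ = trans h (cong (π *_) z²≡)
    s₁ = ℤ-solve 2 (λ b c → b := b :+ (ℤ# 0 :* c :- ℤ# 1 :* ℤ# 0)) refl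
    s₂ = ℤ-solve 2 (λ p q → ℤ# 1 :* (:- ℤ# 1 :+ (ℤ# 4 :* p :- ℤ# 4 :* q))
        :- ℤ# 1 :* (ℤ# 0 :+ (ℤ# 4 :* q :+ ℤ# 4 :* p)) := :- ℤ# 1 :+ ℤ# 8 :* :- q) refl
    s₃ = ℤ-solve 1 (λ c → c := ℤ# 0 :+ ((ℤ# 0) :² :+ ℤ# 1 :* c)) refl
    s₄ = ℤ-solve 2 (λ p q → ℤ# 1 :* (ℤ# 0 :+ (ℤ# 4 :* q :+ ℤ# 4 :* p))
        :+ ℤ# 1 :* (:- ℤ# 1 :+ (ℤ# 4 :* p :- ℤ# 4 :* q)) := :- ℤ# 1 :+ ℤ# 8 :* p) refl

R-² : ∀ a → R (a ℤ.* a) ≡ R a ²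
R-² a = R-* a a

R-8 : ∀ u v → R (u ℤ.+ + 8 ℤ.* v) ≡ R u + # 8 * R v
R-8 u v = cong (λ t → R u + t) (R-* (+ 8) v)

module Near-base {k : ℤ[i]} (sc : Scale k) {b c e : ℤ} {z : ℤ[i]} (e-odd : ℤOdd e) (z-odd : Odd z)
  (πz²≡ : R b + I * R c ≡ π * z ²)
  (conic : # 2 * R c ² ≡ # 5 * R b ² - # 18 * R b * k * R e ² + # 15 * k ² * R e ² ²) where
  open Base (base sc)

  -- A nonzero β would have some finite valuation j, and `¬near-base` excludes every j. So β = 0.
  b≡b₀e² : ∀ β γ → R b ≡ b₀ * R e ² + # 8 * R β → R c ≡ c₀ * R e ² + # 8 * R γ → R b ≡ b₀ * R e ²
  b≡b₀e² β γ b≡ c≡ with β ℤₚ.≟ + 0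
  ... | yes refl = trans b≡ (eq (b₀ * R e ²))
    where
    eq = solve 1 (λ x → x :+ :# 8 :* :# 0 := x) refl
  ... | no β≢0 = ⊥-elim (absurd (power-of-2 β β≢0))
    where
    absurd : _ → ⊥
    absurd (j , m , m-odd , h) = ¬near-base {e = R e} {β = R β} {γ = R γ} sc {j = j} {β′ = R m} b≡ c≡ πz²≡ conic
        (ℤodd⇒odd e-odd) z-odd (ℤodd⇒odd m-odd) h

-- The relation 6b = 5e² + f² ≡ 6 modulo 8 gives b ≡ 1 modulo 4, which excludes b ≡ -1. So b ≡ c ≡ 1
-- ≡ e² modulo 8, and the point is close to the base point.
near-one : ∀ {b c e f z} → ℤOdd e → ℤOdd f → Odd z → R b + I * R c ≡ π * z ² →
  # 2 * R c ² ≡ # 5 * R b ² - # 18 * R b * 1# * R e ² + # 15 * 1# ² * R e ² ² →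
  + 6 ℤ.* b ≡ + 5 ℤ.* (e ℤ.* e) ℤ.+ f ℤ.* f → b ≡ e ℤ.* e
near-one {b} {c} {e} {f} {z} e-odd f-odd z-odd πz²≡ conic b≡ = go (residues-mod-8 {b} {c} z-odd πz²≡)
    (ℤodd-square e-odd) (ℤodd-square f-odd)
  where
  open Near-base one {b} {c} {e} e-odd z-odd πz²≡ conic
  go : _ → (∃ λ t → e ℤ.* e ≡ + 1 ℤ.+ + 8 ℤ.* t) → (∃ λ t → f ℤ.* f ≡ + 1 ℤ.+ + 8 ℤ.* t) → b ≡ e ℤ.* e
  go (p , q , inj₁ (b≡8 , c≡8)) (t , e²≡) _ = R-injective (trans
      (b≡b₀e² (p ℤ.- t) (q ℤ.- t) (shift b p b≡8) (shift c q c≡8)) (trans (*-identityˡ (R e ²)) (sym (R-² e))))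
    where
    shift : ∀ b p → b ≡ + 1 ℤ.+ + 8 ℤ.* p → R b ≡ 1# * R e ² + # 8 * R (p ℤ.- t)
    shift b p h = trans (cong R (ℤ-lin₂ (+ 1) (ℤ.- + 1) h e²≡ (eq b p t (e ℤ.* e))))
        (trans (R-8 (e ℤ.* e) (p ℤ.- t)) (cong (λ x → x + # 8 * R (p ℤ.- t))
        (trans (R-² e) (sym (*-identityˡ (R e ²))))))
      where
      eq = ℤ-solve 4 (λ b p t E → b :- (E :+ ℤ# 8 :* (p :- t))
        := ℤ# 1 :* (b :- (ℤ# 1 :+ ℤ# 8 :* p)) :+ :- ℤ# 1 :* (E :- (ℤ# 1 :+ ℤ# 8 :* t))) refl
  go (p , _ , inj₂ (b≡8 , _)) (t , e²≡) (t′ , f²≡) = contradiction (+ 1 , refl)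
      (¬even×ℤodd {+ 3} (+ 6 ℤ.* p ℤ.- + 5 ℤ.* t ℤ.- t′ ,
    ℤₚ.*-cancelˡ-≡ (+ 4) (+ 3) _ (ℤ-lin₄ (ℤ.- + 1) (+ 6) (ℤ.- + 5) (ℤ.- + 1) b≡ b≡8 e²≡ f²≡
        (eq b p t t′ (e ℤ.* e) (f ℤ.* f)))))
    where
    eq = ℤ-solve 6 (λ b p t t′ E F → ℤ# 12 :- ℤ# 4 :* (ℤ# 2 :* (ℤ# 6 :* p :- ℤ# 5 :* t :- t′))
      := :- ℤ# 1 :* (ℤ# 6 :* b :- (ℤ# 5 :* E :+ F)) :+ ℤ# 6 :* (b :- (:- ℤ# 1 :+ ℤ# 8 :* p))
        :+ :- ℤ# 5 :* (E :- (ℤ# 1 :+ ℤ# 8 :* t)) :+ :- ℤ# 1 :* (F :- (ℤ# 1 :+ ℤ# 8 :* t′))) refl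

-- Here 2b = 5e² + f² ≡ 6 modulo 8 forces b ≡ c ≡ -1 modulo 8. This matches (b₀ , c₀) = (7 , -1), as
-- e² ≡ 1.
near-three : ∀ {b c e f z} → ℤOdd e → ℤOdd f → Odd z → R b + I * R c ≡ π * z ² →
  # 2 * R c ² ≡ # 5 * R b ² - # 18 * R b * # 3 * R e ² + # 15 * # 3 ² * R e ² ² →
  + 2 ℤ.* b ≡ + 5 ℤ.* (e ℤ.* e) ℤ.+ f ℤ.* f → b ≡ + 7 ℤ.* (e ℤ.* e)
near-three {b} {c} {e} {f} {z} e-odd f-odd z-odd πz²≡ conic b≡ = go (residues-mod-8 {b} {c} z-odd πz²≡)
    (ℤodd-square e-odd) (ℤodd-square f-odd)
  where
  open Near-base three {b} {c} {e} e-odd z-odd πz²≡ conic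
  go : _ → (∃ λ t → e ℤ.* e ≡ + 1 ℤ.+ + 8 ℤ.* t) → (∃ λ t → f ℤ.* f ≡ + 1 ℤ.+ + 8 ℤ.* t) → b ≡ + 7 ℤ.* (e ℤ.* e)
  go (p , q , inj₂ (b≡8 , c≡8)) (t , e²≡) _ = R-injective (trans (b≡b₀e² (p ℤ.- + 7 ℤ.* t ℤ.- + 1) (q ℤ.+ t)
      (trans (cong R (ℤ-lin₂ (+ 1) (ℤ.- + 7) b≡8 e²≡ (eq₁ b p t (e ℤ.* e))))
          (trans (R-8 (+ 7 ℤ.* (e ℤ.* e)) (p ℤ.- + 7 ℤ.* t ℤ.- + 1))
          (cong (λ x → x + # 8 * R (p ℤ.- + 7 ℤ.* t ℤ.- + 1)) (sym 7e²))))
      (trans (cong R (ℤ-lin₂ (+ 1) (+ 1) c≡8 e²≡ (eq₂ c q t (e ℤ.* e))))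
          (trans (R-8 (ℤ.- + 1 ℤ.* (e ℤ.* e)) (q ℤ.+ t)) (cong (λ x → x + # 8 * R (q ℤ.+ t)) (sym -e²)))))
    7e²)
    where
    7e² : # 7 * R e ² ≡ R (+ 7 ℤ.* (e ℤ.* e))
    7e² = sym (trans (R-* (+ 7) (e ℤ.* e)) (cong (# 7 *_) (R-² e)))
    -e² : - 1# * R e ² ≡ R (ℤ.- + 1 ℤ.* (e ℤ.* e))
    -e² = sym (trans (R-* (ℤ.- + 1) (e ℤ.* e)) (cong (- 1# *_) (R-² e)))
    eq₁ = ℤ-solve 4 (λ b p t E → b :- (ℤ# 7 :* E :+ ℤ# 8 :* (p :- ℤ# 7 :* t :- ℤ# 1))
      := ℤ# 1 :* (b :- (:- ℤ# 1 :+ ℤ# 8 :* p)) :+ :- ℤ# 7 :* (E :- (ℤ# 1 :+ ℤ# 8 :* t))) refl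
    eq₂ = ℤ-solve 4 (λ c q t E → c :- (:- ℤ# 1 :* E :+ ℤ# 8 :* (q :+ t))
      := ℤ# 1 :* (c :- (:- ℤ# 1 :+ ℤ# 8 :* q)) :+ ℤ# 1 :* (E :- (ℤ# 1 :+ ℤ# 8 :* t))) refl
  go (p , _ , inj₁ (b≡8 , _)) (t , e²≡) (t′ , f²≡) = contradiction (+ 0 , refl)
      (¬even×ℤodd {+ 1} (+ 2 ℤ.* p ℤ.- + 5 ℤ.* t ℤ.- t′ ,
    ℤₚ.*-cancelˡ-≡ (+ 4) (+ 1) _ (ℤ-lin₄ (ℤ.- + 1) (+ 2) (ℤ.- + 5) (ℤ.- + 1) b≡ b≡8 e²≡ f²≡
        (eq b p t t′ (e ℤ.* e) (f ℤ.* f)))))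
    where
    eq = ℤ-solve 6 (λ b p t t′ E F → ℤ# 4 :- ℤ# 4 :* (ℤ# 2 :* (ℤ# 2 :* p :- ℤ# 5 :* t :- t′))
      := :- ℤ# 1 :* (ℤ# 2 :* b :- (ℤ# 5 :* E :+ F)) :+ ℤ# 2 :* (b :- (ℤ# 1 :+ ℤ# 8 :* p))
        :+ :- ℤ# 5 :* (E :- (ℤ# 1 :+ ℤ# 8 :* t)) :+ :- ℤ# 1 :* (F :- (ℤ# 1 :+ ℤ# 8 :* t′))) refl

ℤodd-∣ : ∀ {m n q} → n ≡ q ℤ.* m → ℤOdd n → ℤOdd m
ℤodd-∣ {m} {n} {q} h o = odd⇒ℤodd (odd-∣ (R q , trans (cong R h) (R-* q m)) (ℤodd⇒odd o))

ℤodd-* : ∀ {m n} → ℤOdd m → ℤOdd n → ℤOdd (m ℤ.* n)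
ℤodd-* {m} {n} o o′ = odd⇒ℤodd (subst Odd (sym (R-* m n)) (odd-* (ℤodd⇒odd o) (ℤodd⇒odd o′)))

R-quad : ∀ n a → R (+ n ℤ.* (a ℤ.* a)) ≡ # n * R a ²
R-quad n a = trans (R-* (+ n) (a ℤ.* a)) (cong (# n *_) (R-² a))

odd⊥2 : ∀ {x} → Odd x → Coprime x (# 2)
odd⊥2 o = cop-∣₂ (cop-* π⊥ π⊥) ∣-refl (I , refl)
  where π⊥ = cop-sym (odd⇒cop o)

odd-cop-2* : ∀ {g x} → Odd g → g ∣ # 2 * x → g ∣ x
odd-cop-2* o = cop-∣* (odd⊥2 o)

-- Parities, coprimality and factorisation over ℤ

module Parities {a b c : ℤ} (h₁ : + 5 ℤ.* (c ℤ.* c) ℤ.+ b ℤ.* b ≡ + 6 ℤ.* (a ℤ.* a))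
    (a⊥b : Coprime (R a) (R b)) where

  ¬both-even : ℤEven a → ¬ ℤEven b
  ¬both-even (p , a≡) (q , b≡) = from-no (4 ℕ.∣? 1) (N-∣ (cop-gcd a⊥b (# 2) (2∣ p a≡) (2∣ q b≡)))
    where
    2∣ : ∀ {n} q → n ≡ + 2 ℤ.* q → # 2 ∣ R n
    2∣ q h = R q , trans (cong R (trans h (ℤₚ.*-comm (+ 2) q))) (R-* q (+ 2))

  b-odd : ℤOdd b
  b-odd = [ (λ e → ⊥-elim (b-even e (ℤ-parity c))) , (λ o → o) ]′ (ℤ-parity b)
    where
    b-even : ℤEven b → ℤEven c ⊎ ℤOdd c → ⊥
    b-even (q , b≡) (inj₂ (p , c≡)) = ¬even×ℤodd (+ 3 ℤ.* (a ℤ.* a) , eq₁ (a ℤ.* a))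
        (+ 2 ℤ.+ + 10 ℤ.* p ℤ.+ + 10 ℤ.* p ℤ.* p ℤ.+ + 2 ℤ.* q ℤ.* q ,
         ℤ-lin₃ (ℤ.- + 1) (+ 5 ℤ.* (c ℤ.+ + 1 ℤ.+ + 2 ℤ.* p)) (b ℤ.+ + 2 ℤ.* q) h₁ c≡ b≡ (eq₂ a b c p q))
      where
      eq₁ = ℤ-solve 1 (λ x → ℤ# 6 :* x := ℤ# 2 :* (ℤ# 3 :* x)) refl
      eq₂ = ℤ-solve 5 (λ a b c p q → ℤ# 6 :* a :²
          :- (ℤ# 1 :+ ℤ# 2 :* (ℤ# 2 :+ ℤ# 10 :* p :+ ℤ# 10 :* p :* p :+ ℤ# 2 :* q :* q))
        := :- ℤ# 1 :* (ℤ# 5 :* c :² :+ b :² :- ℤ# 6 :* a :²) :+ ℤ# 5 :* (c :+ ℤ# 1 :+ ℤ# 2 :* p)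
          :* (c :- (ℤ# 1 :+ ℤ# 2 :* p)) :+ (b :+ ℤ# 2 :* q) :* (b :- ℤ# 2 :* q)) refl
    b-even e@(q , b≡) (inj₁ (p , c≡)) = [ (λ a-even → ¬both-even a-even e) , a-odd′ ]′ (ℤ-parity a)
      where
      a-odd′ : ℤOdd a → ⊥
      a-odd′ o = ¬even×ℤodd (+ 5 ℤ.* p ℤ.* p ℤ.+ q ℤ.* q , ℤₚ.*-cancelˡ-≡ (+ 2) _ _
          (ℤ-lin₃ (ℤ.- + 1) (+ 5 ℤ.* (c ℤ.+ + 2 ℤ.* p)) (b ℤ.+ + 2 ℤ.* q) h₁ c≡ b≡ (eq a b c p q)))
              (ℤodd-* {+ 3} (+ 1 , refl) (ℤodd-* o o))
        where
        eq = ℤ-solve 5 (λ a b c p q → ℤ# 2 :* (ℤ# 3 :* a :²) :- ℤ# 2 :* (ℤ# 2 :* (ℤ# 5 :* p :* p :+ q :²))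
          := :- ℤ# 1 :* (ℤ# 5 :* c :² :+ b :² :- ℤ# 6 :* a :²)
            :+ ℤ# 5 :* (c :+ ℤ# 2 :* p) :* (c :- ℤ# 2 :* p) :+ (b :+ ℤ# 2 :* q) :* (b :- ℤ# 2 :* q)) refl

  c-odd : ℤOdd c
  c-odd = [ (λ e → ⊥-elim (c-even e)) , (λ o → o) ]′ (ℤ-parity c)
    where
    c-even : ℤEven c → ⊥
    c-even (p , c≡) = ¬even×ℤodd (+ 3 ℤ.* (a ℤ.* a) ℤ.- + 10 ℤ.* p ℤ.* p , ℤ-lin₂ (+ 1)
        (ℤ.- (+ 5 ℤ.* (c ℤ.+ + 2 ℤ.* p))) h₁ c≡ (eq a b c p)) (ℤodd-* b-odd b-odd)
      where
      eq = ℤ-solve 4 (λ a b c p → b :² :- ℤ# 2 :* (ℤ# 3 :* a :² :- ℤ# 10 :* p :* p)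
        := ℤ# 1 :* (ℤ# 5 :* c :² :+ b :² :- ℤ# 6 :* a :²)
          :+ :- (ℤ# 5 :* (c :+ ℤ# 2 :* p)) :* (c :- ℤ# 2 :* p)) refl

  -- With b and c odd, 5c² + b² ≡ 6 modulo 8, while 6a² ≡ 0 modulo 8 for even a.
  a-odd : ℤOdd a
  a-odd = [ (λ e → ⊥-elim (a-even e (ℤodd-square b-odd) (ℤodd-square c-odd))) , (λ o → o) ]′ (ℤ-parity a)
    where
    a-even : ℤEven a → (∃ λ t → b ℤ.* b ≡ + 1 ℤ.+ + 8 ℤ.* t) → (∃ λ t → c ℤ.* c ≡ + 1 ℤ.+ + 8 ℤ.* t) → ⊥
    a-even (p , a≡) (t , b²≡) (t′ , c²≡) = ¬even×ℤodd {+ 3}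
        (+ 6 ℤ.* p ℤ.* p ℤ.- + 2 ℤ.* t ℤ.- + 10 ℤ.* t′ , ℤₚ.*-cancelˡ-≡ (+ 2) _ _
        (ℤ-lin₄ (+ 1) (+ 6 ℤ.* (a ℤ.+ + 2 ℤ.* p)) (ℤ.- + 1) (ℤ.- + 5) h₁ a≡ b²≡ c²≡
            (eq a (b ℤ.* b) (c ℤ.* c) p t t′))) (+ 1 , refl)
      where
      eq = ℤ-solve 6 (λ a B C p t t′ → ℤ# 2 :* ℤ# 3
          :- ℤ# 2 :* (ℤ# 2 :* (ℤ# 6 :* p :* p :- ℤ# 2 :* t :- ℤ# 10 :* t′))
        := ℤ# 1 :* (ℤ# 5 :* C :+ B :- ℤ# 6 :* a :²) :+ ℤ# 6 :* (a :+ ℤ# 2 :* p) :* (a :- ℤ# 2 :* p)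
          :+ :- ℤ# 1 :* (B :- (ℤ# 1 :+ ℤ# 8 :* t)) :+ :- ℤ# 5 :* (C :- (ℤ# 1 :+ ℤ# 8 :* t′))) refl

  h₁′ : # 5 * R c ² + R b ² ≡ # 6 * R a ²
  h₁′ = trans (sym (cong₂ _+_ (R-quad 5 c) (R-² b))) (trans (cong R h₁) (R-quad 6 a))

  -- The square of a common divisor g is odd and divides 6a², so it divides 3a². As 3 is squarefree
  -- in ℤ[i], g ∣ a.
  b⊥c : Coprime (R b) (R c)
  b⊥c = cop-by-∣ λ g g∣b g∣c →
    let g-odd = odd-∣ g∣b (ℤodd⇒odd b-odd)
        g²⊥2 = cop-sym (cop-* (cop-sym (odd⊥2 g-odd)) (cop-sym (odd⊥2 g-odd)))
        g²∣3a² = cop-∣* g²⊥2 (∣-≡ (∣-lin (# 5) 1# (*-∣-* g∣c g∣c) (*-∣-* g∣b g∣b))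
            (trans (eq₁ (R c) (R b)) (trans h₁′ (eq₂ (R a)))))
    in cop-gcd a⊥b g (squareFree-∣ squareFree-3 (odd≢0 g-odd) g²∣3a²) g∣b
    where
    eq₁ = solve 2 (λ c b → :# 5 :* c :² :+ :# 1 :* b :² := :# 5 :* c :² :+ b :²) refl
    eq₂ = solve 1 (λ a → :# 6 :* a :² := :# 2 :* (:# 3 :* a :²)) refl

-- b + c i = π y with y coprime to its conjugate and of norm x²
gaussian-square : ∀ {b c x} → ℤOdd b → ℤOdd c → ℤOdd x → Coprime (R b) (R c) → + 2 ℤ.* (x ℤ.* x)
    ≡ b ℤ.* b ℤ.+ c ℤ.* c →
  ∃ λ z → Odd z × (R b + I * R c ≡ π * z ² ⊎ R b + I * R (ℤ.- c) ≡ π * z ²)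
gaussian-square {b} {c} {x} (p , b≡) (q , c≡) x-odd b⊥c h = go (coprime-square (odd≢0 y-odd) y⊥ȳ yȳ≡)
  where
  y ȳ : ℤ[i]
  y = 1# + (1# - I) * (R p + I * R q)
  ȳ = 1# + (1# + I) * (R p - I * R q)
  Rb≡ : R b ≡ 1# + # 2 * R p
  Rb≡ = trans (cong R b≡) (cong (λ t → R (+ 1) + t) (R-* (+ 2) p))
  Rc≡ : R c ≡ 1# + # 2 * R q
  Rc≡ = trans (cong R c≡) (cong (λ t → R (+ 1) + t) (R-* (+ 2) q))
  h′ : # 2 * R x ² ≡ R b ² + R c ²
  h′ = trans (sym (R-quad 2 x)) (trans (cong R h) (cong₂ _+_ (R-² b) (R-² c)))
  yȳ≡ : y * ȳ ≡ R x ²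
  yȳ≡ = *-cancelˡ (# 2) (λ ()) (lin₃ (- 1#) (- (R b + 1# + # 2 * R p)) (- (R c + 1# + # 2 * R q)) h′ Rb≡ Rc≡
      (eq (R b) (R c) (R x) (R p) (R q)))
    where
    eq = solve 5 (λ b c x p q → :# 2 :* ((:# 1 :+ (:# 1 :- :I) :* (p :+ :I :* q))
          :* (:# 1 :+ (:# 1 :+ :I) :* (p :- :I :* q))) :- :# 2 :* x :²
      := :- :# 1 :* (:# 2 :* x :² :- (b :² :+ c :²)) :+ :- (b :+ :# 1 :+ :# 2 :* p)
        :* (b :- (:# 1 :+ :# 2 :* p)) :+ :- (c :+ :# 1 :+ :# 2 :* q) :* (c :- (:# 1 :+ :# 2 :* q))) refl
  y-odd : Odd y
  y-odd = odd-∣ (ȳ , trans (sym yȳ≡) (*-comm y ȳ)) (odd-* (ℤodd⇒odd x-odd) (ℤodd⇒odd x-odd))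
  y⊥ȳ : Coprime y ȳ
  y⊥ȳ = cop-by-∣ λ g g∣y g∣ȳ →
    let g-odd = odd-∣ g∣y y-odd
    in cop-gcd b⊥c g
         (odd-cop-2* g-odd (∣-≡ (∣-lin (1# + I) (1# - I) g∣y g∣ȳ)
             (trans (eq₁ (R p) (R q)) (cong (# 2 *_) (sym Rb≡)))))
         (odd-cop-2* g-odd (∣-≡ (∣-lin (1# - I) (1# + I) g∣y g∣ȳ)
             (trans (eq₂ (R p) (R q)) (cong (# 2 *_) (sym Rc≡)))))
    where
    eq₁ = solve 2 (λ p q → (:# 1 :+ :I) :* (:# 1 :+ (:# 1 :- :I) :* (p :+ :I :* q))
        :+ (:# 1 :- :I) :* (:# 1 :+ (:# 1 :+ :I) :* (p :- :I :* q)) := :# 2 :* (:# 1 :+ :# 2 :* p)) refl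
    eq₂ = solve 2 (λ p q → (:# 1 :- :I) :* (:# 1 :+ (:# 1 :- :I) :* (p :+ :I :* q))
        :+ (:# 1 :+ :I) :* (:# 1 :+ (:# 1 :+ :I) :* (p :- :I :* q)) := :# 2 :* (:# 1 :+ :# 2 :* q)) refl
  πy≡ : R b + I * R c ≡ π * y
  πy≡ = lin₂ 1# I Rb≡ Rc≡ (eq (R b) (R c) (R p) (R q))
    where
    eq = solve 4 (λ b c p q → b :+ :I :* c :- :π :* (:# 1 :+ (:# 1 :- :I) :* (p :+ :I :* q))
      := :# 1 :* (b :- (:# 1 :+ :# 2 :* p)) :+ :I :* (c :- (:# 1 :+ :# 2 :* q))) refl
  πȳ≡ : R b + I * R (ℤ.- c) ≡ - I * π * ȳ
  πȳ≡ = trans (cong (λ t → R b + I * t) (R-neg c)) (lin₂ 1# (- I) Rb≡ Rc≡ (eq (R b) (R c) (R p) (R q)))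
    where
    R-neg : ∀ c → R (ℤ.- c) ≡ - R c
    R-neg c = refl
    eq = solve 4 (λ b c p q → b :+ :I :* :- c :- :- :I :* :π :* (:# 1 :+ (:# 1 :+ :I) :* (p :- :I :* q))
      := :# 1 :* (b :- (:# 1 :+ :# 2 :* p)) :+ :- :I :* (c :- (:# 1 :+ :# 2 :* q))) refl
  Result : Set
  Result = ∃ λ z → Odd z × (R b + I * R c ≡ π * z ² ⊎ R b + I * R (ℤ.- c) ≡ π * z ²)
  go : SquareFactors y ȳ (R x) → Result
  go (h , h′ , r , s , hh′ , y≡ , ȳ≡ , rs≡) = by-unit (unit-∈ (h′ , trans (sym hh′) (*-comm h h′))) refl
    where
    rx-odd : Odd (r * s)
    rx-odd = subst Odd (sym rs≡) (ℤodd⇒odd x-odd)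
    r-odd : Odd r
    r-odd = odd-∣ (s , *-comm r s) rx-odd
    s-odd : Odd s
    s-odd = odd-∣ (r , refl) rx-odd
    I-odd : Odd I
    I-odd = I , refl
    by-unit : ∀ {u} → u ∈ units → h ≡ u → Result
    by-unit (here refl) h≡ = r , r-odd , inj₁ (trans πy≡ (lin₂ π (π * r ²) y≡ h≡ (eq y r h)))
      where
      eq = solve 3 (λ y r h → :π :* y :- :π :* r :² := :π :* (y :- h :* r :²) :+ :π :* r :² :* (h :- :# 1)) refl
    by-unit (there (here refl)) h≡ = I * r , odd-* I-odd r-odd , inj₁
        (trans πy≡ (lin₂ π (π * r ²) y≡ h≡ (eq y r h)))
      where
      eq = solve 3 (λ y r h → :π :* y :- :π :* (:I :* r) :²
        := :π :* (y :- h :* r :²) :+ :π :* r :² :* (h :- :- :# 1)) refl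
    -- For h = ±i the conjugate works instead: b - ci = -iπ ȳ, and -i h′ is a sign, hence a square.
    -- Changing the sign of c is harmless on the curve.
    by-unit (there (there (here refl))) h≡ = I * s , odd-* I-odd s-odd , inj₂
        (trans πȳ≡ (lin₃ (- I * π) (- π * s ²) (π * h′ * s ²) ȳ≡ hh′ h≡ (eq ȳ s h h′)))
      where
      eq = solve 4 (λ y s h h′ → :- :I :* :π :* y :- :π :* (:I :* s) :² := :- :I :* :π :* (y :- h′ :* s :²)
          :+ :- :π :* s :² :* (h :* h′ :- :# 1) :+ :π :* h′ :* s :² :* (h :- :I)) refl
    by-unit (there (there (there (here refl)))) h≡ = s , s-odd , inj₂
        (trans πȳ≡ (lin₃ (- I * π) (π * s ²) (- π * h′ * s ²) ȳ≡ hh′ h≡ (eq ȳ s h h′)))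
      where
      eq = solve 4 (λ y s h h′ → :- :I :* :π :* y :- :π :* s :² := :- :I :* :π :* (y :- h′ :* s :²)
          :+ :π :* s :² :* (h :* h′ :- :# 1) :+ :- :π :* h′ :* s :² :* (h :- :- :I)) refl

-- `coprime-square` over ℤ[i] gives each factor as a unit times a Gaussian square, and `real-square`
-- descends this to ℤ. Opposite signs are impossible because an odd square is not -1 modulo 8.
signed-squares : ∀ {P Q x} → ℤOdd P → ℤOdd Q → ℤOdd x → Coprime (R P) (R Q) → P ℤ.* Q ≡ x ℤ.* x →
  ∃₂ λ e f → ℤOdd e × ℤOdd f × ((P ≡ e ℤ.* e × Q ≡ f ℤ.* f) ⊎ (P ≡ ℤ.- (e ℤ.* e) × Q ≡ ℤ.- (f ℤ.* f)))
signed-squares {P} {Q} {x} P-odd Q-odd x-odd P⊥Q h = go (coprime-square (odd≢0 (ℤodd⇒odd P-odd)) P⊥Q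
    (trans (sym (R-* P Q)) (trans (cong R h) (R-² x))))
  where
  Result : Set
  Result = ∃₂ λ e f → ℤOdd e × ℤOdd f × ((P ≡ e ℤ.* e × Q ≡ f ℤ.* f) ⊎ (P ≡ ℤ.- (e ℤ.* e) × Q ≡ ℤ.- (f ℤ.* f)))
  odd-root : ∀ {n} e → ℤOdd n → n ≡ e ℤ.* e → ℤOdd e
  odd-root e o h = ℤodd-∣ {q = e} h o
  odd-root⁻ : ∀ {n} e → ℤOdd n → n ≡ ℤ.- (e ℤ.* e) → ℤOdd e
  odd-root⁻ {n} e o h = ℤodd-∣ {q = ℤ.- e} (trans h (ℤₚ.neg-distribˡ-* e e)) o
  mixed : ∀ e f → ℤOdd e → ℤOdd f → ¬ x ℤ.* x ≡ ℤ.- (e ℤ.* e ℤ.* (f ℤ.* f))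
  mixed e f oe of eqn = go′ (ℤodd-square x-odd) (ℤodd-square oe) (ℤodd-square of)
    where
    go′ : (∃ λ t → x ℤ.* x ≡ + 1 ℤ.+ + 8 ℤ.* t) → (∃ λ t → e ℤ.* e ≡ + 1 ℤ.+ + 8 ℤ.* t)
        → (∃ λ t → f ℤ.* f ≡ + 1 ℤ.+ + 8 ℤ.* t) → ⊥
    go′ (t , e₁) (t′ , e₂) (t″ , e₃) = ¬even×ℤodd {+ 1} (ℤ.-
        (+ 2 ℤ.* t ℤ.+ + 2 ℤ.* t′ ℤ.+ + 2 ℤ.* t″ ℤ.+ + 16 ℤ.* t′ ℤ.* t″) , ℤₚ.*-cancelˡ-≡ (+ 2) _ _
        (ℤ-lin₄ (+ 1) (ℤ.- + 1) (ℤ.- (f ℤ.* f)) (ℤ.- (+ 1 ℤ.+ + 8 ℤ.* t′)) eqn e₁ e₂ e₃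
            (eq (x ℤ.* x) (e ℤ.* e) (f ℤ.* f) t t′ t″))) (+ 0 , refl)
      where
      eq = ℤ-solve 6 (λ X E F t t′ t″ → ℤ# 2 :* ℤ# 1
          :- ℤ# 2 :* (ℤ# 2 :* :- (ℤ# 2 :* t :+ ℤ# 2 :* t′ :+ ℤ# 2 :* t″ :+ ℤ# 16 :* t′ :* t″))
        := ℤ# 1 :* (X :- :- (E :* F)) :+ :- ℤ# 1 :* (X :- (ℤ# 1 :+ ℤ# 8 :* t))
          :+ :- F :* (E :- (ℤ# 1 :+ ℤ# 8 :* t′)) :+ :- (ℤ# 1 :+ ℤ# 8 :* t′) :* (F :- (ℤ# 1 :+ ℤ# 8 :* t″))) refl
  combine : (∃ λ e → P ≡ e ℤ.* e ⊎ P ≡ ℤ.- (e ℤ.* e)) → (∃ λ f → Q ≡ f ℤ.* f ⊎ Q ≡ ℤ.- (f ℤ.* f)) → Result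
  combine (e , inj₁ p) (f , inj₁ q) = e , f , odd-root e P-odd p , odd-root f Q-odd q , inj₁ (p , q)
  combine (e , inj₂ p) (f , inj₂ q) = e , f , odd-root⁻ e P-odd p , odd-root⁻ f Q-odd q , inj₂ (p , q)
  combine (e , inj₁ p) (f , inj₂ q) = ⊥-elim (mixed e f (odd-root e P-odd p) (odd-root⁻ f Q-odd q)
    (trans (sym h) (trans (cong₂ ℤ._*_ p q) (sym (ℤₚ.neg-distribʳ-* (e ℤ.* e) (f ℤ.* f))))))
  combine (e , inj₂ p) (f , inj₁ q) = ⊥-elim (mixed e f (odd-root⁻ e P-odd p) (odd-root f Q-odd q)
    (trans (sym h) (trans (cong₂ ℤ._*_ p q) (sym (ℤₚ.neg-distribˡ-* (e ℤ.* e) (f ℤ.* f))))))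
  go : SquareFactors (R P) (R Q) (R x) → Result
  go (h , h′ , r , s , hh′ , P≡ , Q≡ , _) = combine
    (real-square P-odd (unit-∈ (h′ , trans (sym hh′) (*-comm h h′))) P≡)
    (real-square Q-odd (unit-∈ (h , sym hh′)) Q≡)

-- (x₀ , x₁ , x₃) = (c , a , b)
record Point (a b c x₂ x₄ : ℤ) : Set where
  field
    on₀ : + 5 ℤ.* (c ℤ.* c) ℤ.+ b ℤ.* b ≡ + 6 ℤ.* (a ℤ.* a)
    on₂ : + 2 ℤ.* (x₂ ℤ.* x₂) ≡ b ℤ.* b ℤ.+ c ℤ.* c
    on₄ : + 5 ℤ.* (x₄ ℤ.* x₄) ℤ.+ + 4 ℤ.* (a ℤ.* a) ≡ + 9 ℤ.* (b ℤ.* b)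
    a⊥b : Coprime (R a) (R b)

-- The two values of (a : b) up to signs, 1 : 1 and 3 : 7. The other squared coordinates are linear
-- in a² and b².
Conclusion-at : ℤ → ℤ → Set
Conclusion-at a b = a ℤ.* a ≡ b ℤ.* b ⊎ + 9 ℤ.* (b ℤ.* b) ≡ + 49 ℤ.* (a ℤ.* a)

neg² : ∀ x → ℤ.- x ℤ.* ℤ.- x ≡ x ℤ.* x
neg² = ℤ-solve 1 (λ x → (:- x) :² := x :²) refl

cop-neg : ∀ {x y} → Coprime x y → Coprime (- x) y
cop-neg {x} c = cop-∣ c (- 1# , eq x)
  where
  eq = solve 1 (λ x → x := :- :# 1 :* :- x) refl

negate-a : ∀ {a b c x₂ x₄} → Point a b c x₂ x₄ → Point (ℤ.- a) b c x₂ x₄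
negate-a {a} {x₄ = x₄} p = record
  { on₀ = trans on₀ (cong (+ 6 ℤ.*_) (sym (neg² a))) ; on₂ = on₂
  ; on₄ = trans (cong (λ t → + 5 ℤ.* (x₄ ℤ.* x₄) ℤ.+ + 4 ℤ.* t) (neg² a)) on₄ ; a⊥b = cop-neg a⊥b }
  where open Point p

negate-b : ∀ {a b c x₂ x₄} → Point a b c x₂ x₄ → Point a (ℤ.- b) c x₂ x₄
negate-b {b = b} {c} p = record
  { on₀ = trans (cong (λ t → + 5 ℤ.* (c ℤ.* c) ℤ.+ t) (neg² b)) on₀ ; on₂ = trans on₂
        (cong (λ t → t ℤ.+ c ℤ.* c) (sym (neg² b)))
  ; on₄ = trans on₄ (cong (+ 9 ℤ.*_) (sym (neg² b))) ; a⊥b = cop-sym (cop-neg (cop-sym a⊥b)) }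
  where open Point p

negate-c : ∀ {a b c x₂ x₄} → Point a b c x₂ x₄ → Point a b (ℤ.- c) x₂ x₄
negate-c {b = b} {c} p = record
  { on₀ = trans (cong (λ t → + 5 ℤ.* t ℤ.+ b ℤ.* b) (neg² c)) on₀ ; on₂ = trans on₂
        (cong (λ t → b ℤ.* b ℤ.+ t) (sym (neg² c)))
  ; on₄ = on₄ ; a⊥b = a⊥b }
  where open Point p

conclude-neg-a : ∀ a b → Conclusion-at (ℤ.- a) b → Conclusion-at a b
conclude-neg-a a b (inj₁ h) = inj₁ (trans (sym (neg² a)) h)
conclude-neg-a a b (inj₂ h) = inj₂ (trans h (cong (+ 49 ℤ.*_) (neg² a)))

conclude-neg-b : ∀ a b → Conclusion-at a (ℤ.- b) → Conclusion-at a b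
conclude-neg-b a b (inj₁ h) = inj₁ (trans h (neg² b))
conclude-neg-b a b (inj₂ h) = inj₂ (trans (cong (+ 9 ℤ.*_) (sym (neg² b))) h)

module _ {a b c x₂ x₄ : ℤ} (p : Point a b c x₂ x₄) where
  open Point p
  open Parities {a} {b} {c} on₀ a⊥b

  x₂-odd : ℤOdd x₂
  x₂-odd = [ (λ e → ⊥-elim (even e (ℤodd-square b-odd) (ℤodd-square c-odd))) , (λ o → o) ]′ (ℤ-parity x₂)
    where
    even : ℤEven x₂ → (∃ λ t → b ℤ.* b ≡ + 1 ℤ.+ + 8 ℤ.* t) → (∃ λ t → c ℤ.* c ≡ + 1 ℤ.+ + 8 ℤ.* t) → ⊥
    even (q , x≡) (t , b²≡) (t′ , c²≡) = ¬even×ℤodd {+ 1} (+ 2 ℤ.* q ℤ.* q ℤ.- + 2 ℤ.* t ℤ.- + 2 ℤ.* t′ ,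
        ℤₚ.*-cancelˡ-≡ (+ 2) _ _
        (ℤ-lin₄ (ℤ.- + 1) (+ 2 ℤ.* (x₂ ℤ.+ + 2 ℤ.* q)) (ℤ.- + 1) (ℤ.- + 1) on₂ x≡ b²≡ c²≡
            (eq x₂ (b ℤ.* b) (c ℤ.* c) q t t′))) (+ 0 , refl)
      where
      eq = ℤ-solve 6 (λ x B C q t t′ → ℤ# 2 :* ℤ# 1
          :- ℤ# 2 :* (ℤ# 2 :* (ℤ# 2 :* q :* q :- ℤ# 2 :* t :- ℤ# 2 :* t′))
        := :- ℤ# 1 :* (ℤ# 2 :* x :² :- (B :+ C)) :+ ℤ# 2 :* (x :+ ℤ# 2 :* q) :* (x :- ℤ# 2 :* q)
          :+ :- ℤ# 1 :* (B :- (ℤ# 1 :+ ℤ# 8 :* t)) :+ :- ℤ# 1 :* (C :- (ℤ# 1 :+ ℤ# 8 :* t′))) refl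

  x₄-odd : ℤOdd x₄
  x₄-odd = [ (λ e → ⊥-elim (even e)) , (λ o → o) ]′ (ℤ-parity x₄)
    where
    even : ℤEven x₄ → ⊥
    even (q , x≡) = ¬even×ℤodd (+ 10 ℤ.* q ℤ.* q ℤ.+ + 2 ℤ.* (a ℤ.* a) , ℤ-lin₂ (ℤ.- + 1)
        (+ 5 ℤ.* (x₄ ℤ.+ + 2 ℤ.* q)) on₄ x≡ (eq a b x₄ q)) (ℤodd-* {+ 9} (+ 4 , refl) (ℤodd-* b-odd b-odd))
      where
      eq = ℤ-solve 4 (λ a b x q → ℤ# 9 :* b :² :- ℤ# 2 :* (ℤ# 10 :* q :* q :+ ℤ# 2 :* a :²)
        := :- ℤ# 1 :* (ℤ# 5 :* x :² :+ ℤ# 4 :* a :² :- ℤ# 9 :* b :²)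
          :+ ℤ# 5 :* (x :+ ℤ# 2 :* q) :* (x :- ℤ# 2 :* q)) refl

  gaussian : ∃ λ z → Odd z × (R b + I * R c ≡ π * z ² ⊎ R b + I * R (ℤ.- c) ≡ π * z ²)
  gaussian = gaussian-square b-odd c-odd x₂-odd b⊥c on₂

R-lin : ∀ n a m b → R (+ n ℤ.* a ℤ.- + m ℤ.* b) ≡ # n * R a - # m * R b
R-lin n a m b = trans refl (cong₂ (λ s t → s - t) (R-* (+ n) a) (R-* (+ m) b))

module One {a b e f : ℤ} (e-odd : ℤOdd e) (f-odd : ℤOdd f)
  (P≡ : + 3 ℤ.* b ℤ.- + 2 ℤ.* a ≡ + 5 ℤ.* (e ℤ.* e)) (Q≡ : + 3 ℤ.* b ℤ.+ + 2 ℤ.* a ≡ f ℤ.* f) where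

  private
    P≡′ : # 3 * R b - # 2 * R a ≡ # 5 * R e ²
    P≡′ = trans (sym (R-lin 3 b 2 a)) (trans (cong R P≡) (R-quad 5 e))

    6b≡ : + 6 ℤ.* b ≡ + 5 ℤ.* (e ℤ.* e) ℤ.+ f ℤ.* f
    6b≡ = ℤ-lin₂ (+ 1) (+ 1) P≡ Q≡ (eq a b (e ℤ.* e) (f ℤ.* f))
      where
      eq = ℤ-solve 4 (λ a b E F → ℤ# 6 :* b :- (ℤ# 5 :* E :+ F)
        := ℤ# 1 :* (ℤ# 3 :* b :- ℤ# 2 :* a :- ℤ# 5 :* E) :+ ℤ# 1 :* (ℤ# 3 :* b :+ ℤ# 2 :* a :- F)) refl

  -- Eliminating 2a = 3b - 5e² from the first equation yields the conic for k = 1. The result b = e²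
  -- then forces a = -e².
  for : ∀ {c x₂ x₄ z} → Point a b c x₂ x₄ → Odd z → R b + I * R c ≡ π * z ² → a ℤ.* a ≡ b ℤ.* b
  for {c} {z = z} p z-odd πz²≡ = ℤₚ.*-cancelˡ-≡ (+ 4) _ _ (ℤ-lin₂ (ℤ.- (+ 2 ℤ.* a ℤ.- + 2 ℤ.* b))
      (+ 5 ℤ.* (+ 2 ℤ.* a ℤ.- + 2 ℤ.* b)) P≡ b≡ (eq a b (e ℤ.* e)))
    where
    open Point p
    open Parities {a} {b} {c} on₀ a⊥b using (h₁′)
    conic : # 2 * R c ² ≡ # 5 * R b ² - # 18 * R b * 1# * R e ² + # 15 * 1# ² * R e ² ²
    conic = *-cancelˡ (# 5) (λ ()) (lin₂ (# 2) (- # 3 * (# 2 * R a + # 3 * R b - # 5 * R e ²)) h₁′ P≡′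
        (eq′ (R a) (R b) (R c) (R e ²)))
      where
      eq′ = solve 4 (λ a b c E → :# 5 :* (:# 2 :* c :²)
          :- :# 5 :* (:# 5 :* b :² :- :# 18 :* b :* :# 1 :* E :+ :# 15 :* (:# 1) :² :* E :²)
        := :# 2 :* (:# 5 :* c :² :+ b :² :- :# 6 :* a :²)
          :+ :- :# 3 :* (:# 2 :* a :+ :# 3 :* b :- :# 5 :* E) :* (:# 3 :* b :- :# 2 :* a :- :# 5 :* E)) refl
    b≡ : b ≡ e ℤ.* e
    b≡ = near-one {b} {c} {e} {f} e-odd f-odd z-odd πz²≡ conic 6b≡
    eq = ℤ-solve 3 (λ a b E → ℤ# 4 :* a :² :- ℤ# 4 :* b :²
      := :- (ℤ# 2 :* a :- ℤ# 2 :* b) :* (ℤ# 3 :* b :- ℤ# 2 :* a :- ℤ# 5 :* E)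
        :+ ℤ# 5 :* (ℤ# 2 :* a :- ℤ# 2 :* b) :* (b :- E)) refl

module Three {a₁ b e f : ℤ} (e-odd : ℤOdd e) (f-odd : ℤOdd f)
  (P≡ : b ℤ.- + 2 ℤ.* a₁ ≡ + 5 ℤ.* (e ℤ.* e)) (Q≡ : b ℤ.+ + 2 ℤ.* a₁ ≡ f ℤ.* f) where

  private
    P≡′ : R b - # 2 * R a₁ ≡ # 5 * R e ²
    P≡′ = trans (sym (trans refl (cong (λ t → R b - t) (R-* (+ 2) a₁)))) (trans (cong R P≡) (R-quad 5 e))

    2b≡ : + 2 ℤ.* b ≡ + 5 ℤ.* (e ℤ.* e) ℤ.+ f ℤ.* f
    2b≡ = ℤ-lin₂ (+ 1) (+ 1) P≡ Q≡ (eq a₁ b (e ℤ.* e) (f ℤ.* f))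
      where
      eq = ℤ-solve 4 (λ a b E F → ℤ# 2 :* b :- (ℤ# 5 :* E :+ F)
        := ℤ# 1 :* (b :- ℤ# 2 :* a :- ℤ# 5 :* E) :+ ℤ# 1 :* (b :+ ℤ# 2 :* a :- F)) refl

  -- Eliminating 2a₁ = b - 5e² yields the conic for k = 3. The result b = 7e² then gives a₁ = e² and
  -- a = 3e².
  for : ∀ {a c x₂ x₄ z} → a ≡ a₁ ℤ.* + 3 → Point a b c x₂ x₄ → Odd z → R b + I * R c ≡ π * z ² → + 9 ℤ.* (b ℤ.* b)
      ≡ + 49 ℤ.* (a ℤ.* a)
  for {a} {c} {z = z} a≡ p z-odd πz²≡ = ℤₚ.*-cancelˡ-≡ (+ 4) _ _
      (ℤ-lin₃ (+ 21 ℤ.* (+ 6 ℤ.* b ℤ.+ + 42 ℤ.* a₁)) (ℤ.- (+ 15 ℤ.* (+ 6 ℤ.* b ℤ.+ + 42 ℤ.* a₁)))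
      (ℤ.- (+ 196 ℤ.* (a ℤ.+ + 3 ℤ.* a₁))) P≡ b≡ a≡ (eq a a₁ b (e ℤ.* e)))
    where
    open Point p
    open Parities {a} {b} {c} on₀ a⊥b using (h₁′)
    a≡′ : R a ≡ R a₁ * # 3
    a≡′ = trans (cong R a≡) (R-* a₁ (+ 3))
    conic : # 2 * R c ² ≡ # 5 * R b ² - # 18 * R b * # 3 * R e ² + # 15 * # 3 ² * R e ² ²
    conic = *-cancelˡ (# 5) (λ ()) (lin₃ (# 2) (- # 27 * (# 2 * R a₁ + R b - # 5 * R e ²))
        (# 12 * (R a + # 3 * R a₁)) h₁′ P≡′ a≡′ (eq′ (R a) (R a₁) (R b) (R c) (R e ²)))
      where
      eq′ = solve 5 (λ a a₁ b c E → :# 5 :* (:# 2 :* c :²)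
          :- :# 5 :* (:# 5 :* b :² :- :# 18 :* b :* :# 3 :* E :+ :# 15 :* (:# 3) :² :* E :²)
        := :# 2 :* (:# 5 :* c :² :+ b :² :- :# 6 :* a :²) :+ :- :# 27 :* (:# 2 :* a₁ :+ b :- :# 5 :* E)
          :* (b :- :# 2 :* a₁ :- :# 5 :* E) :+ :# 12 :* (a :+ :# 3 :* a₁) :* (a :- a₁ :* :# 3)) refl
    b≡ : b ≡ + 7 ℤ.* (e ℤ.* e)
    b≡ = near-three {b} {c} {e} {f} e-odd f-odd z-odd πz²≡ conic 2b≡
    eq = ℤ-solve 4 (λ a a₁ b E → ℤ# 4 :* (ℤ# 9 :* b :²) :- ℤ# 4 :* (ℤ# 49 :* a :²)
      := ℤ# 21 :* (ℤ# 6 :* b :+ ℤ# 42 :* a₁) :* (b :- ℤ# 2 :* a₁ :- ℤ# 5 :* E) :+ :- (ℤ# 15 :* (ℤ# 6 :* b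
            :+ ℤ# 42 :* a₁)) :* (b :- ℤ# 7 :* E) :+ :- (ℤ# 196 :* (a :+ ℤ# 3 :* a₁)) :* (a :- a₁ :* ℤ# 3)) refl

one-case : ∀ {a b c x₂ x₄ e f} → Point a b c x₂ x₄ → ℤOdd e → ℤOdd f →
  + 3 ℤ.* b ℤ.- + 2 ℤ.* a ≡ + 5 ℤ.* (e ℤ.* e) → + 3 ℤ.* b ℤ.+ + 2 ℤ.* a ≡ f ℤ.* f → Conclusion-at a b
one-case {a} {b} {e = e} {f} p e-odd f-odd P≡ Q≡ = go (gaussian p)
  where
  open One {a} {b} {e} {f} e-odd f-odd P≡ Q≡
  go : _ → Conclusion-at a b
  go (_ , z-odd , inj₁ h) = inj₁ (for p z-odd h)
  go (_ , z-odd , inj₂ h) = inj₁ (for (negate-c p) z-odd h)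

three-case : ∀ {a a₁ b c x₂ x₄ e f} → Point a b c x₂ x₄ → a ≡ a₁ ℤ.* + 3 → ℤOdd e → ℤOdd f →
  b ℤ.- + 2 ℤ.* a₁ ≡ + 5 ℤ.* (e ℤ.* e) → b ℤ.+ + 2 ℤ.* a₁ ≡ f ℤ.* f → Conclusion-at a b
three-case {a} {a₁} {b} {e = e} {f} p a≡ e-odd f-odd P≡ Q≡ = go (gaussian p)
  where
  open Three {a₁} {b} {e} {f} e-odd f-odd P≡ Q≡
  go : _ → Conclusion-at a b
  go (_ , z-odd , inj₁ h) = inj₂ (for a≡ p z-odd h)
  go (_ , z-odd , inj₂ h) = inj₂ (for a≡ (negate-c p) z-odd h)

module _ {a b c x₂ x₄ P : ℤ} (p : Point a b c x₂ x₄) (P≡ : + 3 ℤ.* b ℤ.- + 2 ℤ.* a ≡ + 5 ℤ.* P) where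
  open Point p
  open Parities {a} {b} {c} on₀ a⊥b

  -- A common divisor of P and 3b + 2a is odd and divides a and 3b, hence 3, so it is a unit. If
  -- both factors are negative squares, (a , b) is replaced by (-a , -b).
  coprime-to-3 : Coprime (# 3) (R a) → Conclusion-at a b
  coprime-to-3 3⊥a = go (signed-squares P-odd Q-odd (x₄-odd p) P⊥Q PQ≡)
    where
    T : ℤ
    T = + 3 ℤ.* b ℤ.+ + 2 ℤ.* a
    3b-odd : ℤOdd (+ 3 ℤ.* b)
    3b-odd = ℤodd-* {+ 3} (+ 1 , refl) b-odd
    Q-odd : ℤOdd T
    Q-odd = let t , h = 3b-odd in t ℤ.+ a , ℤ-lin (+ 1) h (eq (+ 3 ℤ.* b) a t)
      where
      eq = ℤ-solve 3 (λ b a t → b :+ ℤ# 2 :* a :- (ℤ# 1 :+ ℤ# 2 :* (t :+ a))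
        := ℤ# 1 :* (b :- (ℤ# 1 :+ ℤ# 2 :* t))) refl
    P-odd : ℤOdd P
    P-odd = let t , h = 3b-odd in ℤodd-∣ {q = + 5} P≡ (t ℤ.- a , ℤ-lin (+ 1) h (eq (+ 3 ℤ.* b) a t))
      where
      eq = ℤ-solve 3 (λ b a t → b :- ℤ# 2 :* a :- (ℤ# 1 :+ ℤ# 2 :* (t :- a))
        := ℤ# 1 :* (b :- (ℤ# 1 :+ ℤ# 2 :* t))) refl
    PQ≡ : P ℤ.* T ≡ x₄ ℤ.* x₄
    PQ≡ = ℤₚ.*-cancelˡ-≡ (+ 5) _ _ (ℤ-lin₂ (ℤ.- T) (ℤ.- + 1) P≡ on₄ (eq a b P x₄))
      where
      eq = ℤ-solve 4 (λ a b P x → ℤ# 5 :* (P :* (ℤ# 3 :* b :+ ℤ# 2 :* a)) :- ℤ# 5 :* x :²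
        := :- (ℤ# 3 :* b :+ ℤ# 2 :* a) :* (ℤ# 3 :* b :- ℤ# 2 :* a :- ℤ# 5 :* P)
          :+ :- ℤ# 1 :* (ℤ# 5 :* x :² :+ ℤ# 4 :* a :² :- ℤ# 9 :* b :²)) refl
    RQ≡ : R T ≡ # 3 * R b + # 2 * R a
    RQ≡ = cong₂ _+_ (R-* (+ 3) b) (R-* (+ 2) a)
    R5P≡ : # 5 * R P ≡ # 3 * R b - # 2 * R a
    R5P≡ = trans (sym (R-* (+ 5) P)) (trans (cong R (sym P≡)) (R-lin 3 b 2 a))
    P⊥Q : Coprime (R P) (R T)
    P⊥Q = cop-by-∣ λ g g∣P g∣Q →
      let g-odd = odd-∣ g∣P (ℤodd⇒odd P-odd)
          g∣5P = ∣-≡ (∣-* (# 5) g∣P) R5P≡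
          g∣3b = odd-cop-2* {x = R b * # 3} g-odd (∣-≡ (∣-lin 1# 1# g∣5P (∣-≡ g∣Q RQ≡)) (eq₁ (R a) (R b)))
          g∣a = odd-cop-2* {x = R a} g-odd (odd-cop-2* {x = # 2 * R a} g-odd
              (∣-≡ (∣-lin (- 1#) 1# g∣5P (∣-≡ g∣Q RQ≡)) (eq₂ (R a) (R b))))
          g∣3 = cop-∣* {y = R b} {# 3} (cop-∣ a⊥b g∣a) g∣3b
      in cop-gcd 3⊥a g g∣3 g∣a
      where
      eq₁ = solve 2 (λ a b → :# 1 :* (:# 3 :* b :- :# 2 :* a) :+ :# 1 :* (:# 3 :* b :+ :# 2 :* a)
        := :# 2 :* (b :* :# 3)) refl
      eq₂ = solve 2 (λ a b → :- :# 1 :* (:# 3 :* b :- :# 2 :* a) :+ :# 1 :* (:# 3 :* b :+ :# 2 :* a)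
        := :# 2 :* (:# 2 :* a)) refl
    go : _ → Conclusion-at a b
    go (e , f , e-odd , f-odd , inj₁ (P≡e² , Q≡f²)) = one-case p e-odd f-odd (trans P≡ (cong (+ 5 ℤ.*_) P≡e²)) Q≡f²
    go (e , f , e-odd , f-odd , inj₂ (P≡e² , Q≡f²)) = conclude-neg-a a b
        (conclude-neg-b (ℤ.- a) b (one-case (negate-b (negate-a p)) e-odd f-odd
        (ℤ-lin₂ (ℤ.- + 1) (ℤ.- + 5) P≡ P≡e² (eq₁ a b P (e ℤ.* e))) (ℤ-lin (ℤ.- + 1) Q≡f² (eq₂ a b (f ℤ.* f)))))
      where
      eq₁ = ℤ-solve 4 (λ a b P E → ℤ# 3 :* :- b :- ℤ# 2 :* :- a :- ℤ# 5 :* E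
        := :- ℤ# 1 :* (ℤ# 3 :* b :- ℤ# 2 :* a :- ℤ# 5 :* P) :+ :- ℤ# 5 :* (P :- :- E)) refl
      eq₂ = ℤ-solve 3 (λ a b F → ℤ# 3 :* :- b :+ ℤ# 2 :* :- a :- F
        := :- ℤ# 1 :* (ℤ# 3 :* b :+ ℤ# 2 :* a :- :- F)) refl

  divisible-by-3 : ∀ {a₁ y} → a ≡ a₁ ℤ.* + 3 → x₄ ≡ y ℤ.* + 3 → Conclusion-at a b
  divisible-by-3 {a₁} {y} a≡ x₄≡ = go (signed-squares P′-odd Q-odd y-odd P′⊥Q P′Q≡)
    where
    P′ T : ℤ
    -- This is (b - 2a₁) / 5 without division: 3 (b - 2a₁) = 5P, and 6 - 5 = 1.
    P′ = + 2 ℤ.* P ℤ.- (b ℤ.- + 2 ℤ.* a₁)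
    T = b ℤ.+ + 2 ℤ.* a₁
    5P′≡ : b ℤ.- + 2 ℤ.* a₁ ≡ + 5 ℤ.* P′
    5P′≡ = ℤ-lin₂ (+ 2) (+ 4) P≡ a≡ (eq a a₁ b P)
      where
      eq = ℤ-solve 4 (λ a a₁ b P → b :- ℤ# 2 :* a₁ :- ℤ# 5 :* (ℤ# 2 :* P :- (b :- ℤ# 2 :* a₁))
        := ℤ# 2 :* (ℤ# 3 :* b :- ℤ# 2 :* a :- ℤ# 5 :* P) :+ ℤ# 4 :* (a :- a₁ :* ℤ# 3)) refl
    Q-odd : ℤOdd T
    Q-odd = let t , h = b-odd in t ℤ.+ a₁ , ℤ-lin (+ 1) h (eq b a₁ t)
      where
      eq = ℤ-solve 3 (λ b a t → b :+ ℤ# 2 :* a :- (ℤ# 1 :+ ℤ# 2 :* (t :+ a))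
        := ℤ# 1 :* (b :- (ℤ# 1 :+ ℤ# 2 :* t))) refl
    P′-odd : ℤOdd P′
    P′-odd = let t , h = b-odd in ℤodd-∣ {q = + 5} 5P′≡ (t ℤ.- a₁ , ℤ-lin (+ 1) h (eq b a₁ t))
      where
      eq = ℤ-solve 3 (λ b a t → b :- ℤ# 2 :* a :- (ℤ# 1 :+ ℤ# 2 :* (t :- a))
        := ℤ# 1 :* (b :- (ℤ# 1 :+ ℤ# 2 :* t))) refl
    y-odd : ℤOdd y
    y-odd = ℤodd-∣ {q = + 3} (trans x₄≡ (ℤₚ.*-comm y (+ 3))) (x₄-odd p)
    P′Q≡ : P′ ℤ.* T ≡ y ℤ.* y
    P′Q≡ = ℤₚ.*-cancelˡ-≡ (+ 45) _ _ (ℤ-lin₄ (ℤ.- (+ 9 ℤ.* T)) (ℤ.- + 1) (+ 5 ℤ.* (x₄ ℤ.+ y ℤ.* + 3))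
        (+ 4 ℤ.* (a ℤ.+ a₁ ℤ.* + 3)) 5P′≡ on₄ x₄≡ a≡ (eq a a₁ b P′ x₄ y))
      where
      eq = ℤ-solve 6 (λ a a₁ b P x y → ℤ# 45 :* (P :* (b :+ ℤ# 2 :* a₁)) :- ℤ# 45 :* y :²
        := :- (ℤ# 9 :* (b :+ ℤ# 2 :* a₁)) :* (b :- ℤ# 2 :* a₁ :- ℤ# 5 :* P)
          :+ :- ℤ# 1 :* (ℤ# 5 :* x :² :+ ℤ# 4 :* a :² :- ℤ# 9 :* b :²) :+ ℤ# 5
          :* (x :+ y :* ℤ# 3) :* (x :- y :* ℤ# 3) :+ ℤ# 4 :* (a :+ a₁ :* ℤ# 3) :* (a :- a₁ :* ℤ# 3)) refl
    RQ≡ : R T ≡ R b + # 2 * R a₁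
    RQ≡ = cong (λ t → R b + t) (R-* (+ 2) a₁)
    R5P′≡ : # 5 * R P′ ≡ R b - # 2 * R a₁
    R5P′≡ = trans (sym (R-* (+ 5) P′)) (trans (cong R (sym 5P′≡)) (cong (λ t → R b - t) (R-* (+ 2) a₁)))
    P′⊥Q : Coprime (R P′) (R T)
    P′⊥Q = cop-by-∣ λ g g∣P g∣Q →
      let g-odd = odd-∣ g∣P (ℤodd⇒odd P′-odd)
          g∣5P = ∣-≡ (∣-* (# 5) g∣P) R5P′≡
          g∣b = odd-cop-2* {x = R b} g-odd (∣-≡ (∣-lin 1# 1# g∣5P (∣-≡ g∣Q RQ≡)) (eq₁ (R a₁) (R b)))
          g∣a₁ = odd-cop-2* {x = R a₁} g-odd (odd-cop-2* {x = # 2 * R a₁} g-odd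
              (∣-≡ (∣-lin (- 1#) 1# g∣5P (∣-≡ g∣Q RQ≡)) (eq₂ (R a₁) (R b))))
      in cop-gcd a⊥b g (∣-trans g∣a₁ (# 3 , trans (cong R a≡) (trans (R-* a₁ (+ 3)) (*-comm (R a₁) (# 3))))) g∣b
      where
      eq₁ = solve 2 (λ a b → :# 1 :* (b :- :# 2 :* a) :+ :# 1 :* (b :+ :# 2 :* a) := :# 2 :* b) refl
      eq₂ = solve 2 (λ a b → :- :# 1 :* (b :- :# 2 :* a) :+ :# 1 :* (b :+ :# 2 :* a)
        := :# 2 :* (:# 2 :* a)) refl
    go : _ → Conclusion-at a b
    go (e , f , e-odd , f-odd , inj₁ (P≡e² , Q≡f²)) = three-case p a≡ e-odd f-odd
        (trans 5P′≡ (cong (+ 5 ℤ.*_) P≡e²)) Q≡f²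
    go (e , f , e-odd , f-odd , inj₂ (P≡e² , Q≡f²)) = conclude-neg-a a b
        (conclude-neg-b (ℤ.- a) b (three-case {a₁ = ℤ.- a₁} (negate-b (negate-a p))
        (trans (cong ℤ.-_ a≡) (ℤₚ.neg-distribˡ-* a₁ (+ 3))) e-odd f-odd
        (ℤ-lin₂ (ℤ.- + 1) (ℤ.- + 5) 5P′≡ P≡e² (eq₁ a₁ b P′ (e ℤ.* e))) (ℤ-lin (ℤ.- + 1) Q≡f² (eq₂ a₁ b (f ℤ.* f)))))
      where
      eq₁ = ℤ-solve 4 (λ a b P E → :- b :- ℤ# 2 :* :- a :- ℤ# 5 :* E
        := :- ℤ# 1 :* (b :- ℤ# 2 :* a :- ℤ# 5 :* P) :+ :- ℤ# 5 :* (P :- :- E)) refl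
      eq₂ = ℤ-solve 3 (λ a b F → :- b :+ ℤ# 2 :* :- a :- F := :- ℤ# 1 :* (b :+ ℤ# 2 :* a :- :- F)) refl

  -- If 3 ∣ a, then 5x₄² = 9b² - 4a² gives 3 ∣ x₄, and a factor 9 can be cancelled; this is the
  -- origin of k = 3.
  5∣-case : Conclusion-at a b
  5∣-case = [ (λ d → by-3 (R-∣ {+ 3} {a} d)) , coprime-to-3 ]′ (3-prime (R a))
    where
    by-3 : (∃ λ a₁ → a ≡ a₁ ℤ.* + 3) → Conclusion-at a b
    by-3 (a₁ , a≡) = by-y (R-∣ {+ 3} {x₄} 3∣x₄)
      where
      on₄′ : # 5 * R x₄ ² + # 4 * R a ² ≡ # 9 * R b ²
      on₄′ = trans (sym (cong₂ _+_ (R-quad 5 x₄) (R-quad 4 a))) (trans (cong R on₄) (R-quad 9 b))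
      by-y : (∃ λ y → x₄ ≡ y ℤ.* + 3) → Conclusion-at a b
      by-y (y , x₄≡) = divisible-by-3 {a₁} {y} a≡ x₄≡
      3∣x₄ : # 3 ∣ R x₄
      3∣x₄ = prime-∣² 3-prime (R x₄) (cop-∣* {# 3} {# 5} (# 2 , - 1# , refl) (# 3 * R b ² - # 12 * R a₁ ² ,
          lin₂ 1# (- # 4 * (R a + R a₁ * # 3)) on₄′ (trans (cong R a≡) (R-* a₁ (+ 3)))
              (eq (R a) (R a₁) (R b) (R x₄))))
        where
        eq = solve 4 (λ a a₁ b x → :# 5 :* x :² :- (:# 3 :* b :² :- :# 12 :* a₁ :²) :* :# 3
          := :# 1 :* (:# 5 :* x :² :+ :# 4 :* a :² :- :# 9 :* b :²)
            :+ :- :# 4 :* (a :+ a₁ :* :# 3) :* (a :- a₁ :* :# 3)) refl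

±-quotient : ∀ {d} m → d ℕ.∣ ℤ.∣ m ∣ → ∃ λ q → m ≡ q ℤ.* + d
±-quotient {d} m (ℕ.divides q h) = [ (λ e → + q , trans (sym e) q*d≡)
                                   , (λ e → ℤ.- + q , trans (sym (ℤₚ.neg-involutive m))
                                         (trans (cong ℤ.-_ (trans (sym e) q*d≡)) (ℤₚ.neg-distribˡ-* (+ q) (+ d))))
                                         ]′ (ℤₚ.+∣i∣≡i⊎+∣i∣≡-i m)
  where
  q*d≡ : + ℤ.∣ m ∣ ≡ + q ℤ.* + d
  q*d≡ = trans (cong +_ h) (ℤₚ.pos-* q d)

-- The rational prime 5 divides one of 3b ± 2a, and a ↦ -a exchanges the two.
classify : ∀ {a b c x₂ x₄} → Point a b c x₂ x₄ → Conclusion-at a b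
classify {a} {b} {c} {x₂} {x₄} p = [ (λ d → from-P (±-quotient (+ 3 ℤ.* b ℤ.- + 2 ℤ.* a) d)) ,
    (λ d → from-Q (±-quotient (+ 3 ℤ.* b ℤ.+ + 2 ℤ.* a) d)) ]′
    (ℕ.euclidsLemma ℤ.∣ + 3 ℤ.* b ℤ.- + 2 ℤ.* a ∣ ℤ.∣ + 3 ℤ.* b ℤ.+ + 2 ℤ.* a ∣ (from-yes (ℕ.prime? 5))
        (ℕ.divides ℤ.∣ x₄ ℤ.* x₄ ∣ ∣PQ∣≡))
  where
  open Point p
  PQ≡ : (+ 3 ℤ.* b ℤ.- + 2 ℤ.* a) ℤ.* (+ 3 ℤ.* b ℤ.+ + 2 ℤ.* a) ≡ x₄ ℤ.* x₄ ℤ.* + 5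
  PQ≡ = ℤ-lin (ℤ.- + 1) on₄ (eq a b x₄)
    where
    eq = ℤ-solve 3 (λ a b x → (ℤ# 3 :* b :- ℤ# 2 :* a) :* (ℤ# 3 :* b :+ ℤ# 2 :* a) :- x :² :* ℤ# 5
      := :- ℤ# 1 :* (ℤ# 5 :* x :² :+ ℤ# 4 :* a :² :- ℤ# 9 :* b :²)) refl
  ∣PQ∣≡ : ℤ.∣ + 3 ℤ.* b ℤ.- + 2 ℤ.* a ∣ ℕ.* ℤ.∣ + 3 ℤ.* b ℤ.+ + 2 ℤ.* a ∣ ≡ ℤ.∣ x₄ ℤ.* x₄ ∣ ℕ.* 5
  ∣PQ∣≡ = trans (sym (ℤₚ.abs-* (+ 3 ℤ.* b ℤ.- + 2 ℤ.* a) (+ 3 ℤ.* b ℤ.+ + 2 ℤ.* a)))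
      (trans (cong ℤ.∣_∣ PQ≡) (ℤₚ.abs-* (x₄ ℤ.* x₄) (+ 5)))
  from-P : (∃ λ P → + 3 ℤ.* b ℤ.- + 2 ℤ.* a ≡ P ℤ.* + 5) → Conclusion-at a b
  from-P (P , h) = 5∣-case p (trans h (ℤₚ.*-comm P (+ 5)))
  from-Q : (∃ λ P → + 3 ℤ.* b ℤ.+ + 2 ℤ.* a ≡ P ℤ.* + 5) → Conclusion-at a b
  from-Q (P , h) = conclude-neg-a a b (5∣-case (negate-a p) (trans (eq a b) (trans h (ℤₚ.*-comm P (+ 5)))))
    where
    eq = ℤ-solve 2 (λ a b → ℤ# 3 :* b :- ℤ# 2 :* :- a := ℤ# 3 :* b :+ ℤ# 2 :* a) refl

-- Primitive representatives

abs-multiple : ∀ m → ∃ λ s → + ℤ.∣ m ∣ ≡ s ℤ.* m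
abs-multiple m = [ (λ e → + 1 , trans e (sym (ℤₚ.*-identityˡ m))) , (λ e → ℤ.- + 1 , trans e (sym (ℤₚ.-1*i≡-i m)))
    ]′ (ℤₚ.+∣i∣≡i⊎+∣i∣≡-i m)

ℤ-bézout : ∀ {d} a b → ℕ.Bézout.Identity d ℤ.∣ a ∣ ℤ.∣ b ∣ → ∃₂ λ u v → u ℤ.* a ℤ.+ v ℤ.* b ≡ + d
ℤ-bézout {d} a b (ℕ.Bézout.+- x y h) =
  let s , ∣a∣≡ = abs-multiple a
      t , ∣b∣≡ = abs-multiple b
  in + x ℤ.* s , ℤ.- (+ y ℤ.* t) , ℤ-lin₃ (ℤ.- + 1) (ℤ.- + x) (+ y) (lift h) ∣a∣≡ ∣b∣≡
      (eq (+ d) (+ x) (+ y) s t a b (+ ℤ.∣ a ∣) (+ ℤ.∣ b ∣))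
  where
  lift : d ℕ.+ y ℕ.* ℤ.∣ b ∣ ≡ x ℕ.* ℤ.∣ a ∣ → + d ℤ.+ + y ℤ.* + ℤ.∣ b ∣ ≡ + x ℤ.* + ℤ.∣ a ∣
  lift h = trans (sym (trans (ℤₚ.pos-+ d _) (cong (λ t → + d ℤ.+ t) (ℤₚ.pos-* y ℤ.∣ b ∣))))
      (trans (cong +_ h) (ℤₚ.pos-* x ℤ.∣ a ∣))
  eq = ℤ-solve 9 (λ d x y s t a b A B → x :* s :* a :+ :- (y :* t) :* b :- d
    := :- ℤ# 1 :* (d :+ y :* B :- x :* A) :+ :- x :* (A :- s :* a) :+ y :* (B :- t :* b)) refl
ℤ-bézout {d} a b i@(ℕ.Bézout.-+ x y h) =
  let u , v , e = ℤ-bézout b a (ℕ.Bézout.+- y x h) in v , u , trans (ℤₚ.+-comm (v ℤ.* a) (u ℤ.* b)) e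

-- The gcd is taken over ℤ so that the cofactors stay rational; its Bézout coefficients also witness
-- coprimality in ℤ[i].
ℤ-reduce : ∀ a b → ¬ (a ≡ + 0 × b ≡ + 0) → ∃ λ g → ∃₂ λ a′ b′ → ¬ g ≡ + 0 × a ≡ a′ ℤ.* g × b
    ≡ b′ ℤ.* g × Coprime (R a′) (R b′)
ℤ-reduce a b ≢0 = go (ℕ.Bézout.lemma ℤ.∣ a ∣ ℤ.∣ b ∣)
  where
  go : ℕ.Bézout.Lemma ℤ.∣ a ∣ ℤ.∣ b ∣ → _
  go (ℕ.Bézout.result d g i) = go′ (±-quotient a (ℕ.GCD.gcd∣m g)) (±-quotient b (ℕ.GCD.gcd∣n g)) (ℤ-bézout a b i)
    where
    go′ : (∃ λ q → a ≡ q ℤ.* + d) → (∃ λ q → b ≡ q ℤ.* + d) → (∃₂ λ u v → u ℤ.* a ℤ.+ v ℤ.* b ≡ + d) →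
          ∃ λ g → ∃₂ λ a′ b′ → ¬ g ≡ + 0 × a ≡ a′ ℤ.* g × b ≡ b′ ℤ.* g × Coprime (R a′) (R b′)
    go′ (a′ , a≡) (b′ , b≡) (u , v , e) = + d , a′ , b′ , d≢0 , a≡ , b≡ , R u , R v ,
        trans (sym (cong₂ _+_ (R-* u a′) (R-* v b′))) (cong R
            (ℤₚ.*-cancelʳ-≡ (u ℤ.* a′ ℤ.+ v ℤ.* b′) (+ 1) (+ d) {{ℤ.≢-nonZero d≢0}}
          (ℤ-lin₃ (+ 1) (ℤ.- u) (ℤ.- v) e a≡ b≡ (eq a b u v a′ b′ (+ d)))))
      where
      d≢0 : ¬ + d ≡ + 0
      d≢0 refl = ≢0 (trans a≡ (ℤₚ.*-zeroʳ a′) , trans b≡ (ℤₚ.*-zeroʳ b′))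
      eq = ℤ-solve 7 (λ a b u v a′ b′ d → (u :* a′ :+ v :* b′) :* d :- ℤ# 1 :* d
        := ℤ# 1 :* (u :* a :+ v :* b :- d) :+ :- u :* (a :- a′ :* d) :+ :- v :* (b :- b′ :* d)) refl

squareFree-5 : SquareFree (# 5)
squareFree-5 = squareFree-* λ₁-factor (from-no (5 ℕ.∣? 1) ∘ N-∣) (λ₂ - 1# , - 1# , refl)
  (squareFree-* λ₂-factor (from-no (5 ℕ.∣? 1) ∘ N-∣) (0# , 1# , refl) squareFree-1)

record IntegralPoint (a b c x₂ x₄ : ℤ) : Set where
  field
    on₃ : + 5 ℤ.* (c ℤ.* c) ℤ.+ b ℤ.* b ≡ + 6 ℤ.* (a ℤ.* a)
    on₂ : x₂ ℤ.* x₂ ℤ.+ + 2 ℤ.* (c ℤ.* c) ≡ + 3 ℤ.* (a ℤ.* a)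
    on₄ : x₄ ℤ.* x₄ ℤ.+ + 9 ℤ.* (c ℤ.* c) ≡ + 10 ℤ.* (a ℤ.* a)

module _ {a b c x₂ x₄ : ℤ} (p : IntegralPoint a b c x₂ x₄) where
  open IntegralPoint p

  private
    -- The gcd of a and b divides the whole point: 5c² is a multiple of g² and 5 is squarefree in
    -- ℤ[i], so g ∣ c; then x₂² and x₄² are multiples of g².
    reduced : ∀ {g a′ b′} → ¬ g ≡ + 0 → a ≡ a′ ℤ.* g → b ≡ b′ ℤ.* g → Coprime (R a′) (R b′) → Conclusion-at a b
    reduced {g} {a′} {b′} g≢0 a≡ b≡ a′⊥b′ = from-c (R-∣ {g} {c}
        (squareFree-∣ squareFree-5 Rg≢0 (R (+ 6 ℤ.* (a′ ℤ.* a′) ℤ.- b′ ℤ.* b′) ,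
        trans (sym (R-quad 5 c)) (trans (cong R (ℤ-lin₃ (+ 1) (+ 6 ℤ.* (a ℤ.+ a′ ℤ.* g)) (ℤ.- (b ℤ.+ b′ ℤ.* g)) on₃
            a≡ b≡ (eq₁ a b c a′ b′ g)))
          (trans (R-* (+ 6 ℤ.* (a′ ℤ.* a′) ℤ.- b′ ℤ.* b′) (g ℤ.* g))
              (cong (R (+ 6 ℤ.* (a′ ℤ.* a′) ℤ.- b′ ℤ.* b′) *_) (R-² g)))))))
      where
      Rg≢0 : ¬ R g ≡ 0#
      Rg≢0 h = g≢0 (R-injective h)
      eq₁ = ℤ-solve 6 (λ a b c a′ b′ g → ℤ# 5 :* c :² :- (ℤ# 6 :* a′ :² :- b′ :²) :* g :²
        := ℤ# 1 :* (ℤ# 5 :* c :² :+ b :² :- ℤ# 6 :* a :²)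
          :+ ℤ# 6 :* (a :+ a′ :* g) :* (a :- a′ :* g) :+ :- (b :+ b′ :* g) :* (b :- b′ :* g)) refl
      divides-root : ∀ x y → x ℤ.* x ≡ y ℤ.* (g ℤ.* g) → ∃ λ q → x ≡ q ℤ.* g
      divides-root x y h = R-∣ {g} {x} (squareFree-∣ squareFree-1 Rg≢0 (R y ,
        trans (*-identityˡ _) (trans (sym (R-² x)) (trans (cong R h)
            (trans (R-* y (g ℤ.* g)) (cong (R y *_) (R-² g)))))))
      from-c : (∃ λ c′ → c ≡ c′ ℤ.* g) → Conclusion-at a b
      from-c (c′ , c≡) = from-x (divides-root x₂ (+ 3 ℤ.* (a′ ℤ.* a′) ℤ.- + 2 ℤ.* (c′ ℤ.* c′))
          (ℤ-lin₃ (+ 1) (+ 3 ℤ.* (a ℤ.+ a′ ℤ.* g)) (ℤ.- (+ 2 ℤ.* (c ℤ.+ c′ ℤ.* g))) on₂ a≡ c≡ (eq₂ a c x₂ a′ c′ g)))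
                                (divides-root x₄ (+ 10 ℤ.* (a′ ℤ.* a′) ℤ.- + 9 ℤ.* (c′ ℤ.* c′))
                                    (ℤ-lin₃ (+ 1) (+ 10 ℤ.* (a ℤ.+ a′ ℤ.* g)) (ℤ.- (+ 9 ℤ.* (c ℤ.+ c′ ℤ.* g))) on₄
                                    a≡ c≡ (eq₄ a c x₄ a′ c′ g)))
        where
        eq₂ = ℤ-solve 6 (λ a c x a′ c′ g → x :² :- (ℤ# 3 :* a′ :² :- ℤ# 2 :* c′ :²) :* g :²
          := ℤ# 1 :* (x :² :+ ℤ# 2 :* c :² :- ℤ# 3 :* a :²)
            :+ ℤ# 3 :* (a :+ a′ :* g) :* (a :- a′ :* g) :+ :- (ℤ# 2 :* (c :+ c′ :* g)) :* (c :- c′ :* g)) refl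
        eq₄ = ℤ-solve 6 (λ a c x a′ c′ g → x :² :- (ℤ# 10 :* a′ :² :- ℤ# 9 :* c′ :²) :* g :²
          := ℤ# 1 :* (x :² :+ ℤ# 9 :* c :² :- ℤ# 10 :* a :²)
            :+ ℤ# 10 :* (a :+ a′ :* g) :* (a :- a′ :* g) :+ :- (ℤ# 9 :* (c :+ c′ :* g)) :* (c :- c′ :* g)) refl
        from-x : (∃ λ y → x₂ ≡ y ℤ.* g) → (∃ λ y → x₄ ≡ y ℤ.* g) → Conclusion-at a b
        from-x (y₂ , x₂≡) (y₄ , x₄≡) = rescale a≡ b≡ (classify (point a≡ b≡ c≡ x₂≡ x₄≡))
          where
          cancel-g² : ∀ {x y} → g ℤ.* g ℤ.* x ≡ g ℤ.* g ℤ.* y → x ≡ y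
          cancel-g² {x} {y} h = ℤₚ.*-cancelˡ-≡ (g ℤ.* g) x y
              {{ℤ.≢-nonZero (λ e → [ g≢0 , g≢0 ]′ (ℤₚ.i*j≡0⇒i≡0∨j≡0 g e))}} h
          point : a ≡ a′ ℤ.* g → b ≡ b′ ℤ.* g → c ≡ c′ ℤ.* g → x₂ ≡ y₂ ℤ.* g → x₄ ≡ y₄ ℤ.* g → Point a′ b′ c′ y₂ y₄
          point refl refl refl refl refl = record
            { on₀ = cancel-g² (ℤ-lin (+ 1) on₃ (e₀ a′ b′ c′ g))
            ; on₂ = cancel-g² (ℤ-lin₂ (+ 2) (ℤ.- + 1) on₂ on₃ (e₂ a′ b′ c′ y₂ g))
            ; on₄ = cancel-g² (ℤ-lin₂ (+ 5) (ℤ.- + 9) on₄ on₃ (e₄ a′ b′ c′ y₄ g))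
            ; a⊥b = a′⊥b′ }
            where
            e₀ = ℤ-solve 4 (λ a b c g → g :² :* (ℤ# 5 :* c :² :+ b :²) :- g :² :* (ℤ# 6 :* a :²)
              := ℤ# 1 :* (ℤ# 5 :* (c :* g) :² :+ (b :* g) :² :- ℤ# 6 :* (a :* g) :²)) refl
            e₂ = ℤ-solve 5 (λ a b c x g → g :² :* (ℤ# 2 :* x :²) :- g :² :* (b :² :+ c :²)
              := ℤ# 2 :* ((x :* g) :² :+ ℤ# 2 :* (c :* g) :² :- ℤ# 3 :* (a :* g) :²)
                :+ :- ℤ# 1 :* (ℤ# 5 :* (c :* g) :² :+ (b :* g) :² :- ℤ# 6 :* (a :* g) :²)) refl
            e₄ = ℤ-solve 5 (λ a b c x g → g :² :* (ℤ# 5 :* x :² :+ ℤ# 4 :* a :²) :- g :² :* (ℤ# 9 :* b :²)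
              := ℤ# 5 :* ((x :* g) :² :+ ℤ# 9 :* (c :* g) :² :- ℤ# 10 :* (a :* g) :²)
                :+ :- ℤ# 9 :* (ℤ# 5 :* (c :* g) :² :+ (b :* g) :² :- ℤ# 6 :* (a :* g) :²)) refl
          rescale : a ≡ a′ ℤ.* g → b ≡ b′ ℤ.* g → Conclusion-at a′ b′ → Conclusion-at a b
          rescale refl refl (inj₁ h) = inj₁ (ℤ-lin (g ℤ.* g) h (e₁ a′ b′ g))
            where
            e₁ = ℤ-solve 3 (λ a b g → (a :* g) :² :- (b :* g) :² := g :² :* (a :² :- b :²)) refl
          rescale refl refl (inj₂ h) = inj₂ (ℤ-lin (g ℤ.* g) h (e₁ a′ b′ g))
            where
            e₁ = ℤ-solve 3 (λ a b g → ℤ# 9 :* (b :* g) :² :- ℤ# 49 :* (a :* g) :²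
              := g :² :* (ℤ# 9 :* b :² :- ℤ# 49 :* a :²)) refl

    from-reduce : (∃ λ g → ∃₂ λ a′ b′ → ¬ g ≡ + 0 × a ≡ a′ ℤ.* g × b ≡ b′ ℤ.* g × Coprime (R a′) (R b′))
        → Conclusion-at a b
    from-reduce (_ , _ , _ , g≢0 , a≡ , b≡ , a′⊥b′) = reduced g≢0 a≡ b≡ a′⊥b′

  integral-conclusion : Conclusion-at a b
  integral-conclusion with a ℤₚ.≟ + 0 | b ℤₚ.≟ + 0
  ... | yes a≡0 | yes b≡0 = inj₁ (cong₂ ℤ._*_ (trans a≡0 (sym b≡0)) (trans a≡0 (sym b≡0)))
  ... | yes _   | no b≢0  = from-reduce (ℤ-reduce a b (λ (_ , h) → b≢0 h))
  ... | no a≢0  | _       = from-reduce (ℤ-reduce a b (λ (h , _) → a≢0 h))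

-- Rational points


ℚ-ring : AlmostCommutativeRing _ _
ℚ-ring = fromCommutativeRing ℚₚ.+-*-commutativeRing λ x → 0≟ x
  where
  0≟ : ∀ x → Maybe (0ℚ ≡ x)
  0≟ x with 0ℚ ℚₚ.≟ x
  ... | yes e = just e
  ... | no _  = nothing

open Solver ℚ-ring using () renaming (solve to ℚ-solve)

ℚ# : ∀ {n} → ℕ → Expr ℚ n
ℚ# k = con (fromℤ (+ k))

ℚ-lin : ∀ {x y l r} c → l ≡ r → x ℚ.- y ≡ c ℚ.* (l ℚ.- r) → x ≡ y
ℚ-lin {x} {y} {l} c refl h = trans (eq x y) (trans (cong (ℚ._+ y) (trans h (eq′ c l))) (ℚₚ.+-identityˡ y))
  where
  eq = ℚ-solve 2 (λ x y → x := x :- y :+ y) refl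
  eq′ = ℚ-solve 2 (λ c l → c :* (l :- l) := ℚ# 0) refl

ℚ-lin₂ : ∀ {x y l r l′ r′} c d → l ≡ r → l′ ≡ r′ → x ℚ.- y ≡ c ℚ.* (l ℚ.- r) ℚ.+ d ℚ.* (l′ ℚ.- r′) → x ≡ y
ℚ-lin₂ {l = l} {l′ = l′} c d refl refl h = ℚ-lin {l = l} c refl (trans h (eq c d l l′))
  where
  eq = ℚ-solve 4 (λ c d l l′ → c :* (l :- l) :+ d :* (l′ :- l′) := c :* (l :- l)) refl

ℚ-lin₃ : ∀ {x y l r l′ r′ l″ r″} c d f → l ≡ r → l′ ≡ r′ → l″ ≡ r″ →
         x ℚ.- y ≡ c ℚ.* (l ℚ.- r) ℚ.+ d ℚ.* (l′ ℚ.- r′) ℚ.+ f ℚ.* (l″ ℚ.- r″) → x ≡ y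
ℚ-lin₃ {l = l} {l′ = l′} {l″ = l″} c d f refl refl refl h = ℚ-lin {l = l} c refl (trans h (eq c d f l l′ l″))
  where
  eq = ℚ-solve 6 (λ c d f l l′ l″ → c :* (l :- l) :+ d :* (l′ :- l′) :+ f :* (l″ :- l″) := c :* (l :- l)) refl

fromℤ-* : ∀ m n → fromℤ (m ℤ.* n) ≡ fromℤ m ℚ.* fromℤ n
fromℤ-* m n = ℚₚ.toℚᵘ-injective (ℚᵘₚ.≃-trans (ℚᵘ.*≡* refl) (ℚᵘₚ.≃-sym (ℚₚ.toℚᵘ-homo-* (fromℤ m) (fromℤ n))))

fromℤ-+ : ∀ m n → fromℤ (m ℤ.+ n) ≡ fromℤ m ℚ.+ fromℤ n
fromℤ-+ m n = ℚₚ.toℚᵘ-injective (ℚᵘₚ.≃-trans (ℚᵘ.*≡* (eq m n)) (ℚᵘₚ.≃-sym (ℚₚ.toℚᵘ-homo-+ (fromℤ m) (fromℤ n))))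
  where
  eq = ℤ-solve 2 (λ m n → (m :+ n) :* (ℤ# 1) :² := (m :* ℤ# 1 :+ n :* ℤ# 1) :* ℤ# 1) refl

fromℤ-injective : ∀ {m n} → fromℤ m ≡ fromℤ n → m ≡ n
fromℤ-injective refl = refl

*-denominator : ∀ x → x ℚ.* fromℤ (↧ x) ≡ fromℤ (↥ x)
*-denominator x@record{} = ℚₚ.toℚᵘ-injective (ℚᵘₚ.≃-trans (ℚₚ.toℚᵘ-homo-* x (fromℤ (↧ x))) (ℚᵘ.*≡* (eq (↥ x) (↧ x))))
  where
  eq = ℤ-solve 2 (λ p q → p :* q :* ℤ# 1 := p :* (q :* ℤ# 1)) refl

ℚ-inverse : ∀ {x} → ¬ x ≡ 0ℚ → ∃ λ y → y ℚ.* x ≡ 1ℚ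
ℚ-inverse {x} x≢0 = ℚ.1/_ x {{ℚ.≢-nonZero x≢0}} , ℚₚ.*-inverseˡ x {{ℚ.≢-nonZero x≢0}}

ℚ-x*y≡0 : ∀ {x y} → x ℚ.* y ≡ 0ℚ → x ≡ 0ℚ ⊎ y ≡ 0ℚ
ℚ-x*y≡0 {x} {y} h with x ℚₚ.≟ 0ℚ
... | yes x≡0 = inj₁ x≡0
... | no x≢0  = let z , zx≡1 = ℚ-inverse x≢0 in inj₂ (ℚ-lin₂ z (ℚ.- y) h zx≡1 (eq x y z))
  where
  eq = ℚ-solve 3 (λ x y z → y :- ℚ# 0 := z :* (x :* y :- ℚ# 0) :+ :- y :* (z :* x :- ℚ# 1)) refl

ℚ-cancel : ∀ {c x y} → ¬ c ≡ 0ℚ → c ℚ.* x ≡ c ℚ.* y → x ≡ y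
ℚ-cancel {c} {x} {y} c≢0 h = [ (λ e → contradiction e c≢0) , (λ e → ℚ-lin 1ℚ e (eq′ x y)) ]′
    (ℚ-x*y≡0 (trans (eq c x y) (ℚ-lin 1ℚ h (eq″ c x y))))
  where
  eq = ℚ-solve 3 (λ c x y → c :* (x :- y) := c :* x :- c :* y) refl
  eq′ = ℚ-solve 2 (λ x y → x :- y := ℚ# 1 :* (x :- y :- ℚ# 0)) refl
  eq″ = ℚ-solve 3 (λ c x y → c :* x :- c :* y :- ℚ# 0 := ℚ# 1 :* (c :* x :- c :* y)) refl

square-roots : ∀ {x y} → x ℚ.* x ≡ y ℚ.* y → ∃ λ s → x ≡ sgn s ℚ.* y
square-roots {x} {y} h = [ (λ e → true , ℚ-lin 1ℚ e (eq₁ x y)) , (λ e → false , ℚ-lin 1ℚ e (eq₂ x y)) ]′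
    (ℚ-x*y≡0 {x ℚ.- y} {x ℚ.+ y} (ℚ-lin 1ℚ h (eq x y)))
  where
  eq = ℚ-solve 2 (λ x y → (x :- y) :* (x :+ y) :- ℚ# 0 := ℚ# 1 :* (x :² :- y :²)) refl
  eq₁ = ℚ-solve 2 (λ x y → x :- ℚ# 1 :* y := ℚ# 1 :* (x :- y :- ℚ# 0)) refl
  eq₂ = ℚ-solve 2 (λ x y → x :- :- ℚ# 1 :* y := ℚ# 1 :* (x :+ y :- ℚ# 0)) refl

↧≢0 : ∀ x → ¬ ↧ x ≡ + 0
↧≢0 (mkℚ _ _ _) ()

ℤ-x*y≢0 : ∀ {x y} → ¬ x ≡ + 0 → ¬ y ≡ + 0 → ¬ x ℤ.* y ≡ + 0
ℤ-x*y≢0 {x} x≢0 y≢0 h = [ x≢0 , y≢0 ]′ (ℤₚ.i*j≡0⇒i≡0∨j≡0 x h)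

clear-denominator : ∀ x {M L} → L ≡ ↧ x ℤ.* M → x ℚ.* fromℤ L ≡ fromℤ (↥ x ℤ.* M)
clear-denominator x {M} refl = begin
  x ℚ.* fromℤ (↧ x ℤ.* M)          ≡⟨ cong (x ℚ.*_) (fromℤ-* (↧ x) M) ⟩
  x ℚ.* (fromℤ (↧ x) ℚ.* fromℤ M)  ≡⟨ ℚₚ.*-assoc x (fromℤ (↧ x)) (fromℤ M) ⟨
  x ℚ.* fromℤ (↧ x) ℚ.* fromℤ M    ≡⟨ cong (ℚ._* fromℤ M) (*-denominator x) ⟩
  fromℤ (↥ x) ℚ.* fromℤ M          ≡⟨ fromℤ-* (↥ x) M ⟨
  fromℤ (↥ x ℤ.* M)                ∎
  where open ≡-Reasoning

Scaled : Coords → Set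
Scaled x = ∃₂ λ L (n : Fin 5 → ℤ) → ¬ L ≡ + 0 × (∀ i → x i ℚ.* fromℤ L ≡ fromℤ (n i))

clear-denominators : ∀ x → Scaled x
clear-denominators x = D 0F ℤ.* (D 1F ℤ.* (D 2F ℤ.* (D 3F ℤ.* D 4F))) , (λ i → ↥ x i ℤ.* cofactor i)
  , ℤ-x*y≢0 (↧≢0 (x 0F)) (ℤ-x*y≢0 (↧≢0 (x 1F)) (ℤ-x*y≢0 (↧≢0 (x 2F)) (ℤ-x*y≢0 (↧≢0 (x 3F)) (↧≢0 (x 4F)))))
  , λ i → clear-denominator (x i) {cofactor i} (D≡ i)
  where
  D : Fin 5 → ℤ
  D i = ↧ x i
  cofactor : Fin 5 → ℤ
  cofactor 0F = D 1F ℤ.* (D 2F ℤ.* (D 3F ℤ.* D 4F))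
  cofactor 1F = D 0F ℤ.* (D 2F ℤ.* (D 3F ℤ.* D 4F))
  cofactor 2F = D 0F ℤ.* (D 1F ℤ.* (D 3F ℤ.* D 4F))
  cofactor 3F = D 0F ℤ.* (D 1F ℤ.* (D 2F ℤ.* D 4F))
  cofactor 4F = D 0F ℤ.* (D 1F ℤ.* (D 2F ℤ.* D 3F))
  D≡ : ∀ i → D 0F ℤ.* (D 1F ℤ.* (D 2F ℤ.* (D 3F ℤ.* D 4F))) ≡ D i ℤ.* cofactor i
  D≡ 0F = refl
  D≡ 1F = ℤ-solve 4 (λ a b c d → a :* (b :* (c :* d)) := b :* (a :* (c :* d))) refl (D 0F) (D 1F) (D 2F) (D 3F ℤ.* D 4F)
  D≡ 2F = ℤ-solve 4 (λ a b c d → a :* (b :* (c :* d)) := c :* (a :* (b :* d))) refl (D 0F) (D 1F) (D 2F) (D 3F ℤ.* D 4F)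
  D≡ 3F = ℤ-solve 5 (λ a b c d e → a :* (b :* (c :* (d :* e))) := d :* (a :* (b :* (c :* e)))) refl
    (D 0F) (D 1F) (D 2F) (D 3F) (D 4F)
  D≡ 4F = ℤ-solve 5 (λ a b c d e → a :* (b :* (c :* (d :* e))) := e :* (a :* (b :* (c :* d)))) refl
    (D 0F) (D 1F) (D 2F) (D 3F) (D 4F)

q : ℕ → ℚ
q n = fromℤ (+ n)

fromℤ-quad : ∀ k {n} X l → X ℚ.* l ≡ fromℤ n → fromℤ (+ k ℤ.* (n ℤ.* n)) ≡ q k ℚ.* (X ℚ.* X) ℚ.* (l ℚ.* l)
fromℤ-quad k {n} X l h = trans (fromℤ-* (+ k) (n ℤ.* n)) (trans
    (cong (q k ℚ.*_) (trans (fromℤ-* n n) (cong₂ ℚ._*_ (sym h) (sym h)))) (eq (q k) X l))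
  where
  eq = ℚ-solve 3 (λ k X l → k :* (X :* l) :² := k :* X :² :* l :²) refl

fromℤ-square : ∀ {n} X l → X ℚ.* l ≡ fromℤ n → fromℤ (n ℤ.* n) ≡ X ℚ.* X ℚ.* (l ℚ.* l)
fromℤ-square {n} X l h = trans (fromℤ-* n n) (trans (cong₂ ℚ._*_ (sym h) (sym h)) (eq X l))
  where
  eq = ℚ-solve 2 (λ X l → (X :* l) :² := X :² :* l :²) refl

module _ {x : Coords} (on : OnC x) where
  private
    X₀ = x 0F
    X₁ = x 1F
    X₂ = x 2F
    X₃ = x 3F
    X₄ = x 4F
    E₂ : q 2 ℚ.* (X₀ ℚ.* X₀) ℚ.- q 3 ℚ.* (X₁ ℚ.* X₁) ℚ.+ X₂ ℚ.* X₂ ≡ 0ℚ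
    E₂ = proj₁ on
    E₃ : q 5 ℚ.* (X₀ ℚ.* X₀) ℚ.- q 6 ℚ.* (X₁ ℚ.* X₁) ℚ.+ X₃ ℚ.* X₃ ≡ 0ℚ
    E₃ = proj₁ (proj₂ on)
    E₄ : q 9 ℚ.* (X₀ ℚ.* X₀) ℚ.- q 10 ℚ.* (X₁ ℚ.* X₁) ℚ.+ X₄ ℚ.* X₄ ≡ 0ℚ
    E₄ = proj₂ (proj₂ on)

  integral-point : ∀ {L} {n : Fin 5 → ℤ} → (∀ i → x i ℚ.* fromℤ L ≡ fromℤ (n i))
      → IntegralPoint (n 1F) (n 3F) (n 0F) (n 2F) (n 4F)
  integral-point {L} {n} h = record
    { on₃ = fromℤ-injective (trans (fromℤ-+ (+ 5 ℤ.* (n 0F ℤ.* n 0F)) (n 3F ℤ.* n 3F))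
          (trans (cong₂ ℚ._+_ (fromℤ-quad 5 {n 0F} X₀ l (h 0F)) (fromℤ-square {n 3F} X₃ l (h 3F)))
        (trans (ℚ-lin (l ℚ.* l) E₃ (e₃ X₀ X₁ X₃ l)) (sym (fromℤ-quad 6 {n 1F} X₁ l (h 1F))))))
    ; on₂ = fromℤ-injective (trans (fromℤ-+ (n 2F ℤ.* n 2F) (+ 2 ℤ.* (n 0F ℤ.* n 0F)))
          (trans (cong₂ ℚ._+_ (fromℤ-square {n 2F} X₂ l (h 2F)) (fromℤ-quad 2 {n 0F} X₀ l (h 0F)))
        (trans (ℚ-lin (l ℚ.* l) E₂ (e₂ X₀ X₁ X₂ l)) (sym (fromℤ-quad 3 {n 1F} X₁ l (h 1F))))))
    ; on₄ = fromℤ-injective (trans (fromℤ-+ (n 4F ℤ.* n 4F) (+ 9 ℤ.* (n 0F ℤ.* n 0F)))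
          (trans (cong₂ ℚ._+_ (fromℤ-square {n 4F} X₄ l (h 4F)) (fromℤ-quad 9 {n 0F} X₀ l (h 0F)))
        (trans (ℚ-lin (l ℚ.* l) E₄ (e₄ X₀ X₁ X₄ l)) (sym (fromℤ-quad 10 {n 1F} X₁ l (h 1F)))))) }
    where
    l : ℚ
    l = fromℤ L
    e₃ = ℚ-solve 4 (λ X Y Z l → ℚ# 5 :* X :² :* l :² :+ Z :² :* l :² :- ℚ# 6 :* Y :² :* l :²
      := l :² :* (ℚ# 5 :* X :² :- ℚ# 6 :* Y :² :+ Z :² :- ℚ# 0)) refl
    e₂ = ℚ-solve 4 (λ X Y Z l → Z :² :* l :² :+ ℚ# 2 :* X :² :* l :² :- ℚ# 3 :* Y :² :* l :²
      := l :² :* (ℚ# 2 :* X :² :- ℚ# 3 :* Y :² :+ Z :² :- ℚ# 0)) refl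
    e₄ = ℚ-solve 4 (λ X Y Z l → Z :² :* l :² :+ ℚ# 9 :* X :² :* l :² :- ℚ# 10 :* Y :² :* l :²
      := l :² :* (ℚ# 9 :* X :² :- ℚ# 10 :* Y :² :+ Z :² :- ℚ# 0)) refl

  rational-conclusion : X₁ ℚ.* X₁ ≡ X₃ ℚ.* X₃ ⊎ q 9 ℚ.* (X₃ ℚ.* X₃) ≡ q 49 ℚ.* (X₁ ℚ.* X₁)
  rational-conclusion = go (clear-denominators x)
    where
    go : Scaled x → X₁ ℚ.* X₁ ≡ X₃ ℚ.* X₃ ⊎ q 9 ℚ.* (X₃ ℚ.* X₃) ≡ q 49 ℚ.* (X₁ ℚ.* X₁)
    go (L , n , L≢0 , h) = transfer (integral-conclusion (integral-point {L} {n} h))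
      where
      l : ℚ
      l = fromℤ L
      l²≢0 : ¬ l ℚ.* l ≡ 0ℚ
      l²≢0 e = [ (λ z → L≢0 (fromℤ-injective z)) , (λ z → L≢0 (fromℤ-injective z)) ]′ (ℚ-x*y≡0 e)
      transfer : Conclusion-at (n 1F) (n 3F) → X₁ ℚ.* X₁ ≡ X₃ ℚ.* X₃ ⊎ q 9 ℚ.* (X₃ ℚ.* X₃) ≡ q 49 ℚ.* (X₁ ℚ.* X₁)
      transfer (inj₁ e) = inj₁ (ℚ-cancel l²≢0 (trans (ℚₚ.*-comm (l ℚ.* l) _)
          (trans (sym (fromℤ-square {n 1F} X₁ l (h 1F))) (trans (cong fromℤ e)
          (trans (fromℤ-square {n 3F} X₃ l (h 3F)) (ℚₚ.*-comm _ (l ℚ.* l)))))))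
      transfer (inj₂ e) = inj₂ (ℚ-cancel l²≢0 (trans (ℚₚ.*-comm (l ℚ.* l) _)
          (trans (sym (fromℤ-quad 9 {n 3F} X₃ l (h 3F))) (trans (cong fromℤ e)
          (trans (fromℤ-quad 49 {n 1F} X₁ l (h 1F)) (ℚₚ.*-comm _ (l ℚ.* l)))))))

  -- The equations are linear in the squares of the coordinates. With one more linear relation the
  -- five squares are determined up to scaling; the factor 5 clears the coefficient of X₀² in `E₃`.
  squares-of-ones : X₁ ℚ.* X₁ ≡ X₃ ℚ.* X₃ → ∀ i → x i ℚ.* x i ≡ (X₁ ℚ.* ones i) ℚ.* (X₁ ℚ.* ones i)
  squares-of-ones h = λ { 0F → ℚ-cancel {q 5} (λ ()) (ℚ-lin₂ 1ℚ 1ℚ E₃ h (e₀ X₀ X₁ X₃))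
                        ; 1F → e₁ X₁
                        ; 2F → ℚ-cancel {q 5} (λ ()) (ℚ-lin₃ (q 5) (ℚ.- q 2) (ℚ.- q 2) E₂ E₃ h (e₂ X₀ X₁ X₂ X₃))
                        ; 3F → trans (sym h) (e₁ X₁)
                        ; 4F → ℚ-cancel {q 5} (λ ()) (ℚ-lin₃ (q 5) (ℚ.- q 9) (ℚ.- q 9) E₄ E₃ h (e₄ X₀ X₁ X₄ X₃)) }
    where
    e₁ = ℚ-solve 1 (λ X → X :² := (X :* ℚ# 1) :²) refl
    e₀ = ℚ-solve 3 (λ X Y Z → ℚ# 5 :* X :² :- ℚ# 5 :* (Y :* ℚ# 1) :²
      := ℚ# 1 :* (ℚ# 5 :* X :² :- ℚ# 6 :* Y :² :+ Z :² :- ℚ# 0) :+ ℚ# 1 :* (Y :² :- Z :²)) refl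
    e₂ = ℚ-solve 4 (λ X Y V Z → ℚ# 5 :* V :² :- ℚ# 5 :* (Y :* ℚ# 1) :²
      := ℚ# 5 :* (ℚ# 2 :* X :² :- ℚ# 3 :* Y :² :+ V :² :- ℚ# 0)
        :+ :- ℚ# 2 :* (ℚ# 5 :* X :² :- ℚ# 6 :* Y :² :+ Z :² :- ℚ# 0) :+ :- ℚ# 2 :* (Y :² :- Z :²)) refl
    e₄ = ℚ-solve 4 (λ X Y V Z → ℚ# 5 :* V :² :- ℚ# 5 :* (Y :* ℚ# 1) :²
      := ℚ# 5 :* (ℚ# 9 :* X :² :- ℚ# 10 :* Y :² :+ V :² :- ℚ# 0)
        :+ :- ℚ# 9 :* (ℚ# 5 :* X :² :- ℚ# 6 :* Y :² :+ Z :² :- ℚ# 0) :+ :- ℚ# 9 :* (Y :² :- Z :²)) refl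

  squares-of-odds : q 9 ℚ.* (X₃ ℚ.* X₃) ≡ q 49 ℚ.* (X₁ ℚ.* X₁) → ∀ i → x i ℚ.* x i ≡ (X₀ ℚ.* odds i) ℚ.* (X₀ ℚ.* odds i)
  squares-of-odds h = λ { 0F → e₀ X₀
                        ; 1F → ℚ-cancel {q 5} (λ ()) (ℚ-lin₂ (ℚ.- q 9) 1ℚ E₃ h (e₁ X₀ X₁ X₃))
                        ; 2F → ℚ-cancel {q 5} (λ ()) (ℚ-lin₃ (q 5) (ℚ.- q 27) (q 3) E₂ E₃ h (e₂ X₀ X₁ X₂ X₃))
                        ; 3F → ℚ-cancel {q 5} (λ ()) (ℚ-lin₂ (ℚ.- q 49) (q 6) E₃ h (e₃ X₀ X₁ X₃))
                        ; 4F → ℚ-cancel {q 5} (λ ()) (ℚ-lin₃ (q 5) (ℚ.- q 90) (q 10) E₄ E₃ h (e₄ X₀ X₁ X₄ X₃)) }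
    where
    e₀ = ℚ-solve 1 (λ X → X :² := (X :* ℚ# 1) :²) refl
    e₁ = ℚ-solve 3 (λ X Y Z → ℚ# 5 :* Y :² :- ℚ# 5 :* (X :* ℚ# 3) :²
      := :- ℚ# 9 :* (ℚ# 5 :* X :² :- ℚ# 6 :* Y :² :+ Z :² :- ℚ# 0)
        :+ ℚ# 1 :* (ℚ# 9 :* Z :² :- ℚ# 49 :* Y :²)) refl
    e₂ = ℚ-solve 4 (λ X Y V Z → ℚ# 5 :* V :² :- ℚ# 5 :* (X :* ℚ# 5) :²
      := ℚ# 5 :* (ℚ# 2 :* X :² :- ℚ# 3 :* Y :² :+ V :² :- ℚ# 0) :+ :- ℚ# 27
        :* (ℚ# 5 :* X :² :- ℚ# 6 :* Y :² :+ Z :² :- ℚ# 0) :+ ℚ# 3 :* (ℚ# 9 :* Z :² :- ℚ# 49 :* Y :²)) refl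
    e₃ = ℚ-solve 3 (λ X Y Z → ℚ# 5 :* Z :² :- ℚ# 5 :* (X :* ℚ# 7) :²
      := :- ℚ# 49 :* (ℚ# 5 :* X :² :- ℚ# 6 :* Y :² :+ Z :² :- ℚ# 0)
        :+ ℚ# 6 :* (ℚ# 9 :* Z :² :- ℚ# 49 :* Y :²)) refl
    e₄ = ℚ-solve 4 (λ X Y V Z → ℚ# 5 :* V :² :- ℚ# 5 :* (X :* ℚ# 9) :²
      := ℚ# 5 :* (ℚ# 9 :* X :² :- ℚ# 10 :* Y :² :+ V :² :- ℚ# 0) :+ :- ℚ# 90
        :* (ℚ# 5 :* X :² :- ℚ# 6 :* Y :² :+ Z :² :- ℚ# 0) :+ ℚ# 10 :* (ℚ# 9 :* Z :² :- ℚ# 49 :* Y :²)) refl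

-- A root is chosen in each coordinate separately, which is where arbitrary sign combinations arise.
-- If C were 0, every coordinate of x would vanish.
proportional : ∀ {x y : Coords} {C} → NonZeroCoords x → (∀ i → x i ℚ.* x i ≡ (C ℚ.* y i) ℚ.* (C ℚ.* y i)) → ∃ λ s
    → x ∼ₚ signed s y
proportional {x} {y} {C} x≢0 h = s , C , C≢0 , λ i → trans (proj₂ (root i)) (eq (sgn (s i)) C (y i))
  where
  root : ∀ i → ∃ λ s → x i ≡ sgn s ℚ.* (C ℚ.* y i)
  root i = square-roots (h i)
  s : Fin 5 → Bool
  s i = proj₁ (root i)
  eq = ℚ-solve 3 (λ s C y → s :* (C :* y) := C :* (s :* y)) refl
  C≢0 : ¬ C ≡ 0ℚ
  C≢0 refl = x≢0 λ i → trans (proj₂ (root i)) (eq₀ (sgn (s i)) (y i))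
    where
    eq₀ = ℚ-solve 2 (λ s y → s :* (ℚ# 0 :* y) := ℚ# 0) refl

square-of-signed : ∀ {x y : Coords} {s C} → (∀ i → x i ≡ C ℚ.* signed s y i) → ∀ i → x i ℚ.* x i ≡ (y i ℚ.* y i) ℚ.* (C ℚ.* C)
square-of-signed {x} {y} {s} {C} h i = trans (cong₂ ℚ._*_ (h i) (h i)) (by-sign (s i))
  where
  by-sign : ∀ b → C ℚ.* (sgn b ℚ.* y i) ℚ.* (C ℚ.* (sgn b ℚ.* y i)) ≡ (y i ℚ.* y i) ℚ.* (C ℚ.* C)
  by-sign true = eq C (y i)
    where
    eq = ℚ-solve 2 (λ C y → (C :* (ℚ# 1 :* y)) :² := y :² :* C :²) refl
  by-sign false = eq C (y i)
    where
    eq = ℚ-solve 2 (λ C y → (C :* (:- ℚ# 1 :* y)) :² := y :² :* C :²) refl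

-- The equations involve only squares: signs disappear, and scaling multiplies each equation by C².
on-C : ∀ {x y : Coords} {s} → OnC y → x ∼ₚ signed s y → OnC x
on-C {x} {y} {s} (E₂ , E₃ , E₄) (C , _ , h) = lift {q 2} {q 3} 2F E₂ , lift {q 5} {q 6} 3F E₃ , lift {q 9} {q 10} 4F
    E₄
  where
  lift : ∀ {k m} i → k ℚ.* (y 0F ℚ.* y 0F) ℚ.- m ℚ.* (y 1F ℚ.* y 1F) ℚ.+ y i ℚ.* y i ≡ 0ℚ
      → k ℚ.* (x 0F ℚ.* x 0F) ℚ.- m ℚ.* (x 1F ℚ.* x 1F) ℚ.+ x i ℚ.* x i ≡ 0ℚ
  lift {k} {m} i e = trans (cong₂ ℚ._+_ (cong₂ (λ u v → k ℚ.* u ℚ.- m ℚ.* v) (sq 0F) (sq 1F)) (sq i))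
      (ℚ-lin (C ℚ.* C) e (eq k m (y 0F ℚ.* y 0F) (y 1F ℚ.* y 1F) (y i ℚ.* y i) (C ℚ.* C)))
    where
    sq : ∀ i → x i ℚ.* x i ≡ (y i ℚ.* y i) ℚ.* (C ℚ.* C)
    sq = square-of-signed {x} {y} {s} {C} h
    eq = ℚ-solve 6 (λ k m u v w c → k :* (u :* c) :- m :* (v :* c) :+ w :* c :- ℚ# 0
      := c :* (k :* u :- m :* v :+ w :- ℚ# 0)) refl

theorem5p1 : (x : Coords) → NonZeroCoords x → (OnC x → Listed x) × (Listed x → OnC x)
theorem5p1 x x≢0 = forwards , backwards
  where
  forwards : OnC x → Listed x
  forwards on = [ (λ h → let s , p = proportional {x} {ones} {x 1F} x≢0 (squares-of-ones {x} on h) in s , inj₁ p)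
                , (λ h → let s , p = proportional {x} {odds} {x 0F} x≢0 (squares-of-odds {x} on h) in s , inj₂ p)
                ]′ (rational-conclusion {x} on)
  backwards : Listed x → OnC x
  backwards (s , inj₁ p) = on-C {x} {ones} {s} (refl , refl , refl) p
  backwards (s , inj₂ p) = on-C {x} {odds} {s} (refl , refl , refl) p
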